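{- Let $\gamma(t)=1+\gamma_1t+\gamma_2t^2$ be a polynomial with integer coefficients $\gamma_1,\gamma_2$, and assume that every root of $\gamma(t)-t$ is real and negative. Then $h(t)=(1+t)^4\gamma\!\left(\frac{t}{(1+t)^2}\right)$ is the h-polynomial of a flag simplicial complex triangulating the $3$-sphere.
   Context: Simplicial complexes contain the empty face; $\#\sigma$ denotes the number of vertices of $\sigma$. Flag: every set of pairwise adjacent vertices is a face. f-polynomial $f_X(t)=\sum_{\sigma\in X}t^{\#\sigma}$. For $X$ triangulating $S^3$, the h-polynomial $h_X$ is defined by $(1+t)^4h_X(\frac1{1+t})=t^4f_X(\frac1t)$. -}

module Defs where

open import Algebra.Bundles.Raw using (RawMonoid; RawRing)
open import Algebra.Definitions.RawMonoid using (sum)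
open import Data.Fin using (Fin)
open import Data.Fin.Subset using (Subset; inside; outside; ⁅_⁆; _∈_; _⊆_; _∪_; ∣_∣) renaming (⊥ to ∅)
open import Data.Integer using (ℤ)
open import Data.List using (List; []; _∷_; _++_; map; filter; foldr)
open import Data.Nat as ℕ using (ℕ; zero; suc)
import Data.Nat.Properties as ℕₚ
open import Data.Product using (Σ; Σ-syntax; ∃; _×_; _,_; proj₁; proj₂)
open import Data.Rational as ℚ using (ℚ; 0ℚ; 1ℚ; ½)
import Data.Rational.Properties as ℚₚ
open import Data.Rational.Solver using (module +-*-Solver)
open import Data.Vec using ([]; _∷_)
open import Data.Vec.Functional using (Vector)
open import Function.Bundles using (Inverse)
open import Level using (0ℓ)
open import Relation.Binary.Bundles using (Setoid)
open import Relation.Binary.PropositionalEquality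
  using (_≡_; _≢_; refl; sym; trans; cong; subst)
open import Relation.Nullary using (¬_)
open import Relation.Unary using (Pred; Decidable)

import Algebra.Definitions.RawSemiring (RawRing.rawSemiring ℚ.+-*-rawRing) as ℚ^
open ℚ^ public using (_^_)

private
  abstract
    half+half : ∀ ε → ½ ℚ.* ε ℚ.+ ½ ℚ.* ε ≡ ε
    half+half ε = trans (sym (ℚₚ.*-distribʳ-+ ε ½ ½)) (ℚₚ.*-identityˡ ε)

    0<half : ∀ {ε} → 0ℚ ℚ.< ε → 0ℚ ℚ.< ½ ℚ.* ε
    0<half {ε} 0<ε = subst (ℚ._< ½ ℚ.* ε) (ℚₚ.*-zeroʳ ½) (ℚₚ.*-monoʳ-<-pos ½ 0<ε)

    swap-∣-∣ : ∀ a b → ℚ.∣ a ℚ.- b ∣ ≡ ℚ.∣ b ℚ.- a ∣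
    swap-∣-∣ a b = trans (cong ℚ.∣_∣ lem) (ℚₚ.∣-p∣≡∣p∣ (b ℚ.- a))
      where
      open +-*-Solver
      lem : a ℚ.- b ≡ ℚ.- (b ℚ.- a)
      lem = solve 2 (λ x y → x :- y := :- (y :- x)) refl a b

    split-∣-∣ : ∀ {p q r ε} → p ≡ q ℚ.+ r → ℚ.∣ q ∣ ℚ.< ½ ℚ.* ε → ℚ.∣ r ∣ ℚ.< ½ ℚ.* ε → ℚ.∣ p ∣ ℚ.< ε
    split-∣-∣ {p} {q} {r} {ε} refl u v =
      ℚₚ.≤-<-trans (ℚₚ.∣p+q∣≤∣p∣+∣q∣ q r) (subst (ℚ.∣ q ∣ ℚ.+ ℚ.∣ r ∣ ℚ.<_) (half+half ε) (ℚₚ.+-mono-< u v))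

    sum-∣-∣ : ∀ a b a′ b′ {ε} → ℚ.∣ a ℚ.- a′ ∣ ℚ.< ½ ℚ.* ε → ℚ.∣ b ℚ.- b′ ∣ ℚ.< ½ ℚ.* ε →
              ℚ.∣ (a ℚ.+ b) ℚ.- (a′ ℚ.+ b′) ∣ ℚ.< ε
    sum-∣-∣ a b a′ b′ = split-∣-∣ (solve 4 (λ a b c d → (a :+ b) :- (c :+ d) := (a :- c) :+ (b :- d)) refl a b a′ b′)
      where open +-*-Solver

    triangle-∣-∣ : ∀ a b c {ε} → ℚ.∣ a ℚ.- b ∣ ℚ.< ½ ℚ.* ε → ℚ.∣ b ℚ.- c ∣ ℚ.< ½ ℚ.* ε → ℚ.∣ a ℚ.- c ∣ ℚ.< ε
    triangle-∣-∣ a b c = split-∣-∣ (solve 3 (λ a b c → a :- c := (a :- b) :+ (b :- c)) refl a b c)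
      where open +-*-Solver

    neg-∣-∣ : ∀ a b → ℚ.∣ (ℚ.- a) ℚ.- (ℚ.- b) ∣ ≡ ℚ.∣ a ℚ.- b ∣
    neg-∣-∣ a b = trans (cong ℚ.∣_∣ (solve 2 (λ a b → (:- a) :- (:- b) := b :- a) refl a b)) (swap-∣-∣ b a)
      where open +-*-Solver

    self-∣-∣ : ∀ a → ℚ.∣ a ℚ.- a ∣ ≡ 0ℚ
    self-∣-∣ a = cong ℚ.∣_∣ (ℚₚ.+-inverseʳ a)

    bound-∣-∣ : ∀ a b → ℚ.∣ a ℚ.- b ∣ ℚ.< 1ℚ → ℚ.∣ a ∣ ℚ.≤ ℚ.∣ b ∣ ℚ.+ 1ℚ
    bound-∣-∣ a b h = ℚₚ.≤-trans
      (subst (λ z → ℚ.∣ z ∣ ℚ.≤ ℚ.∣ b ∣ ℚ.+ ℚ.∣ a ℚ.- b ∣)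
             (solve 2 (λ a b → b :+ (a :- b) := a) refl a b)
             (ℚₚ.∣p+q∣≤∣p∣+∣q∣ b (a ℚ.- b)))
      (ℚₚ.+-monoʳ-≤ ℚ.∣ b ∣ (ℚₚ.<⇒≤ h))
      where open +-*-Solver

    0<∣∣+1 : ∀ a → 0ℚ ℚ.< ℚ.∣ a ∣ ℚ.+ 1ℚ
    0<∣∣+1 a = subst (ℚ._< ℚ.∣ a ∣ ℚ.+ 1ℚ) (ℚₚ.+-identityˡ 0ℚ)
                 (ℚₚ.+-mono-≤-< (ℚₚ.0≤∣p∣ a) (ℚₚ.positive⁻¹ 1ℚ))

    shrink : ∀ A ε → 0ℚ ℚ.< A → 0ℚ ℚ.< ε → ∃ λ δ → 0ℚ ℚ.< δ × A ℚ.* δ ≡ ε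
    shrink A ε 0<A 0<ε = 1/A ℚ.* ε , 0<δ , eq
      where
      instance
        A-pos : ℚ.Positive A
        A-pos = ℚ.positive 0<A
        A-nz : ℚ.NonZero A
        A-nz = ℚₚ.pos⇒nonZero A
      1/A : ℚ
      1/A = ℚ.1/ A
      instance
        1/A-pos : ℚ.Positive 1/A
        1/A-pos = ℚₚ.1/pos⇒pos A
      0<δ : 0ℚ ℚ.< 1/A ℚ.* ε
      0<δ = subst (ℚ._< 1/A ℚ.* ε) (ℚₚ.*-zeroʳ 1/A) (ℚₚ.*-monoʳ-<-pos 1/A 0<ε)
      eq : A ℚ.* (1/A ℚ.* ε) ≡ ε
      eq = trans (sym (ℚₚ.*-assoc A 1/A ε)) (trans (cong (ℚ._* ε) (ℚₚ.*-inverseʳ A)) (ℚₚ.*-identityˡ ε))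

    prod-< : ∀ {A δ ε} p q → 0ℚ ℚ.< A → ℚ.∣ p ∣ ℚ.≤ A → ℚ.∣ q ∣ ℚ.< δ → A ℚ.* δ ≡ ε → ℚ.∣ p ℚ.* q ∣ ℚ.< ε
    prod-< {A} {δ} p q 0<A u v refl = subst (ℚ._< A ℚ.* δ) (sym (ℚₚ.∣p*q∣≡∣p∣*∣q∣ p q))
      (ℚₚ.≤-<-trans (ℚₚ.*-monoʳ-≤-nonNeg ℚ.∣ q ∣ {{ℚₚ.∣-∣-nonNeg q}} u)
                    (ℚₚ.*-monoʳ-<-pos A {{ℚ.positive 0<A}} v))

    mul-∣-∣ : ∀ a b a′ b′ {ε} → ℚ.∣ a ℚ.* (b ℚ.- b′) ∣ ℚ.< ½ ℚ.* ε → ℚ.∣ b′ ℚ.* (a ℚ.- a′) ∣ ℚ.< ½ ℚ.* ε →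
              ℚ.∣ (a ℚ.* b) ℚ.- (a′ ℚ.* b′) ∣ ℚ.< ε
    mul-∣-∣ a b a′ b′ =
      split-∣-∣ (solve 4 (λ a b c d → (a :* b) :- (c :* d) := (a :* (b :- d)) :+ (d :* (a :- c))) refl a b a′ b′)
      where open +-*-Solver

Cauchy : (ℕ → ℚ) → Set
Cauchy x = ∀ ε → 0ℚ ℚ.< ε → ∃ λ N → ∀ m n → N ℕ.≤ m → N ℕ.≤ n → ℚ.∣ x m ℚ.- x n ∣ ℚ.< ε

-- Real numbers are Cauchy sequences up to the setoid equality _≈_ below.
record ℝ : Set where
  constructor mkℝ
  field
    seq    : ℕ → ℚ
    cauchy : Cauchy seq

open ℝ public

infix  4 _≈_ _<_ _≤_
infixl 6 _+_
infixl 7 _*_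
infix  8 -_

_≈_ : ℝ → ℝ → Set
x ≈ y = ∀ ε → 0ℚ ℚ.< ε → ∃ λ N → ∀ n → N ℕ.≤ n → ℚ.∣ seq x n ℚ.- seq y n ∣ ℚ.< ε

_<_ : ℝ → ℝ → Set
x < y = Σ[ ε ∈ ℚ ] 0ℚ ℚ.< ε × ∃ λ N → ∀ n → N ℕ.≤ n → seq x n ℚ.+ ε ℚ.< seq y n

_≤_ : ℝ → ℝ → Set
x ≤ y = ¬ (y < x)

private
  abstract
    const-cauchy : ∀ q → Cauchy (λ _ → q)
    const-cauchy q ε 0<ε = 0 , λ _ _ _ _ → subst (ℚ._< ε) (sym (self-∣-∣ q)) 0<ε

    +-cauchy : ∀ {x y} → Cauchy x → Cauchy y → Cauchy (λ n → x n ℚ.+ y n)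
    +-cauchy {x} {y} cx cy ε 0<ε with cx (½ ℚ.* ε) (0<half 0<ε) | cy (½ ℚ.* ε) (0<half 0<ε)
    ... | M , p | N , q = M ℕ.⊔ N , λ m n u v → sum-∣-∣ (x m) (y m) (x n) (y n)
      (p m n (ℕₚ.m⊔n≤o⇒m≤o M N u) (ℕₚ.m⊔n≤o⇒m≤o M N v))
      (q m n (ℕₚ.m⊔n≤o⇒n≤o M N u) (ℕₚ.m⊔n≤o⇒n≤o M N v))

    neg-cauchy : ∀ {x} → Cauchy x → Cauchy (λ n → ℚ.- x n)
    neg-cauchy {x} cx ε 0<ε with cx ε 0<ε
    ... | N , p = N , λ m n u v → subst (ℚ._< ε) (sym (neg-∣-∣ (x m) (x n))) (p m n u v)

    *-cauchy : ∀ {x y} → Cauchy x → Cauchy y → Cauchy (λ n → x n ℚ.* y n)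
    *-cauchy {x} {y} cx cy ε 0<ε
      with cx 1ℚ (ℚₚ.positive⁻¹ 1ℚ) | cy 1ℚ (ℚₚ.positive⁻¹ 1ℚ)
    ... | K , bx | L , by
      with shrink (ℚ.∣ x K ∣ ℚ.+ 1ℚ) (½ ℚ.* ε) (0<∣∣+1 (x K)) (0<half 0<ε)
         | shrink (ℚ.∣ y L ∣ ℚ.+ 1ℚ) (½ ℚ.* ε) (0<∣∣+1 (y L)) (0<half 0<ε)
    ... | δ , 0<δ , eδ | η , 0<η , eη with cy δ 0<δ | cx η 0<η
    ... | M , p | N , q = (K ℕ.⊔ L) ℕ.⊔ (M ℕ.⊔ N) , λ m n u v → mul-∣-∣ (x m) (y m) (x n) (y n)
      (prod-< (x m) (y m ℚ.- y n) (0<∣∣+1 (x K)) (bound-∣-∣ (x m) (x K) (bx m K (K≤ u) ℕₚ.≤-refl)) (p m n (M≤ u) (M≤ v)) eδ)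
      (prod-< (y n) (x m ℚ.- x n) (0<∣∣+1 (y L)) (bound-∣-∣ (y n) (y L) (by n L (L≤ v) ℕₚ.≤-refl)) (q m n (N≤ u) (N≤ v)) eη)
      where
      K≤ : ∀ {o} → (K ℕ.⊔ L) ℕ.⊔ (M ℕ.⊔ N) ℕ.≤ o → K ℕ.≤ o
      K≤ h = ℕₚ.m⊔n≤o⇒m≤o K L (ℕₚ.m⊔n≤o⇒m≤o (K ℕ.⊔ L) (M ℕ.⊔ N) h)
      L≤ : ∀ {o} → (K ℕ.⊔ L) ℕ.⊔ (M ℕ.⊔ N) ℕ.≤ o → L ℕ.≤ o
      L≤ h = ℕₚ.m⊔n≤o⇒n≤o K L (ℕₚ.m⊔n≤o⇒m≤o (K ℕ.⊔ L) (M ℕ.⊔ N) h)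
      M≤ : ∀ {o} → (K ℕ.⊔ L) ℕ.⊔ (M ℕ.⊔ N) ℕ.≤ o → M ℕ.≤ o
      M≤ h = ℕₚ.m⊔n≤o⇒m≤o M N (ℕₚ.m⊔n≤o⇒n≤o (K ℕ.⊔ L) (M ℕ.⊔ N) h)
      N≤ : ∀ {o} → (K ℕ.⊔ L) ℕ.⊔ (M ℕ.⊔ N) ℕ.≤ o → N ℕ.≤ o
      N≤ h = ℕₚ.m⊔n≤o⇒n≤o M N (ℕₚ.m⊔n≤o⇒n≤o (K ℕ.⊔ L) (M ℕ.⊔ N) h)

  abstract
    ≈-refl : ∀ {x} → x ≈ x
    ≈-refl {x} ε 0<ε = 0 , λ n _ → subst (ℚ._< ε) (sym (self-∣-∣ (seq x n))) 0<ε

    ≈-sym : ∀ {x y} → x ≈ y → y ≈ x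
    ≈-sym {x} {y} h ε 0<ε with h ε 0<ε
    ... | N , p = N , λ n u → subst (ℚ._< ε) (swap-∣-∣ (seq x n) (seq y n)) (p n u)

    ≈-trans : ∀ {x y z} → x ≈ y → y ≈ z → x ≈ z
    ≈-trans {x} {y} {z} h k ε 0<ε with h (½ ℚ.* ε) (0<half 0<ε) | k (½ ℚ.* ε) (0<half 0<ε)
    ... | M , p | N , q = M ℕ.⊔ N , λ n u → triangle-∣-∣ (seq x n) (seq y n) (seq z n)
      (p n (ℕₚ.m⊔n≤o⇒m≤o M N u)) (q n (ℕₚ.m⊔n≤o⇒n≤o M N u))

fromℚ : ℚ → ℝ
fromℚ q = mkℝ (λ _ → q) (const-cauchy q)

fromℤ : ℤ → ℝ
fromℤ i = fromℚ (i ℚ./ 1)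

0ℝ 1ℝ : ℝ
0ℝ = fromℚ 0ℚ
1ℝ = fromℚ 1ℚ

_+_ : ℝ → ℝ → ℝ
x + y = mkℝ (λ n → seq x n ℚ.+ seq y n) (+-cauchy {seq x} {seq y} (cauchy x) (cauchy y))

_*_ : ℝ → ℝ → ℝ
x * y = mkℝ (λ n → seq x n ℚ.* seq y n) (*-cauchy {seq x} {seq y} (cauchy x) (cauchy y))

-_ : ℝ → ℝ
- x = mkℝ (λ n → ℚ.- seq x n) (neg-cauchy {seq x} (cauchy x))

ℝ-setoid : Setoid 0ℓ 0ℓ
ℝ-setoid = record
  { Carrier = ℝ
  ; _≈_ = _≈_
  ; isEquivalence = record
    { refl = λ {x} → ≈-refl {x}
    ; sym = λ {x} {y} → ≈-sym {x} {y}
    ; trans = λ {x} {y} {z} → ≈-trans {x} {y} {z}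
    }
  }

+-rawMonoid : RawMonoid 0ℓ 0ℓ
+-rawMonoid = record { Carrier = ℝ ; _≈_ = _≈_ ; _∙_ = _+_ ; ε = 0ℝ }

Σℝ : ∀ {n} → Vector ℝ n → ℝ
Σℝ = sum +-rawMonoid

record ℂ : Set where
  constructor _+i_
  field
    re im : ℝ

open ℂ public

ℂ-rawRing : RawRing 0ℓ 0ℓ
ℂ-rawRing = record
  { Carrier = ℂ
  ; _≈_ = λ z w → re z ≈ re w × im z ≈ im w
  ; _+_ = λ z w → (re z + re w) +i (im z + im w)
  ; _*_ = λ z w → (re z * re w + - (im z * im w)) +i (re z * im w + im z * re w)
  ; -_ = λ z → (- re z) +i (- im z)
  ; 0# = 0ℝ +i 0ℝ
  ; 1# = 1ℝ +i 0ℝ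
  }

ℤ→ℂ : ℤ → ℂ
ℤ→ℂ i = fromℤ i +i 0ℝ

-- Coefficients, constant term first.
Polynomial : Set
Polynomial = List ℤ

eval : ∀ {c ℓ} (R : RawRing c ℓ) → (ℤ → RawRing.Carrier R) → Polynomial → RawRing.Carrier R → RawRing.Carrier R
eval R ι p x = foldr (λ a y → ι a R.+ x R.* y) R.0# p
  where module R = RawRing R

evalℚ : Polynomial → ℚ → ℚ
evalℚ = eval ℚ.+-*-rawRing (λ i → i ℚ./ 1)

evalℂ : Polynomial → ℂ → ℂ
evalℂ = eval ℂ-rawRing ℤ→ℂ

IsRootOf[_-t] : Polynomial → ℂ → Set
IsRootOf[ p -t] z = (evalℂ p z C.+ C.- z) C.≈ C.0#
  where module C = RawRing ℂ-rawRing

-- h(t) = (1+t)⁴ p(t/(1+t)²). An identity of rational functions is stated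
-- as equality of values wherever the denominators do not vanish; since ℚ is
-- infinite, this determines the polynomial h.
Is[1+t]⁴p[t/[1+t]²] : (h p : Polynomial) → Set
Is[1+t]⁴p[t/[1+t]²] h p = ∀ (t : ℚ) .{{_ : ℚ.NonZero ((1ℚ ℚ.+ t) ^ 2)}} →
  evalℚ h t ≡ (1ℚ ℚ.+ t) ^ 4 ℚ.* evalℚ p (t ℚ.÷ ((1ℚ ℚ.+ t) ^ 2))

-- Finite complexes whose vertices are exactly the elements of Fin n; a
-- triangulation of a compact space is necessarily finite.
record SimplicialComplex (n : ℕ) : Set₁ where
  field
    Face        : Pred (Subset n) 0ℓ
    face?       : Decidable Face
    empty-face  : Face ∅
    vertex-face : ∀ v → Face ⁅ v ⁆
    down-closed : ∀ {σ τ} → σ ⊆ τ → Face τ → Face σ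

allSubsets : ∀ n → List (Subset n)
allSubsets zero    = [] ∷ []
allSubsets (suc n) = map (outside ∷_) (allSubsets n) ++ map (inside ∷_) (allSubsets n)

module _ {n : ℕ} (X : SimplicialComplex n) where
  open SimplicialComplex X

  Adjacent : Fin n → Fin n → Set
  Adjacent u v = u ≢ v × Face (⁅ u ⁆ ∪ ⁅ v ⁆)

  Flag : Set
  Flag = ∀ σ → (∀ u v → u ∈ σ → v ∈ σ → u ≢ v → Adjacent u v) → Face σ

  faces : List (Subset n)
  faces = filter face? (allSubsets n)

  fPolynomial : ℚ → ℚ
  fPolynomial t = foldr ℚ._+_ 0ℚ (map (λ σ → t ^ ∣ σ ∣) faces)

  -- (1+t)⁴ h(1/(1+t)) = t⁴ f(1/t); the exponent 4 is that of complexes of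
  -- dimension 3.
  IsHPolynomial : Polynomial → Set
  IsHPolynomial h = ∀ (t : ℚ) .{{_ : ℚ.NonZero t}} .{{_ : ℚ.NonZero (1ℚ ℚ.+ t)}} →
    (1ℚ ℚ.+ t) ^ 4 ℚ.* evalℚ h (ℚ.1/ (1ℚ ℚ.+ t)) ≡ t ^ 4 ℚ.* fPolynomial (ℚ.1/ t)

  -- Barycentric coordinates. The last conjunct says that the support
  -- { v | x v > 0 } is a face; constructively this set need not be given by
  -- a Subset, so the condition is imposed on all Subsets contained in it.
  InRealization : Pred (Vector ℝ n) 0ℓ
  InRealization x = (∀ v → 0ℝ ≤ x v) × Σℝ x ≈ 1ℝ × (∀ τ → (∀ v → v ∈ τ → 0ℝ < x v) → Face τ)

Subspace : ∀ {n} → Pred (Vector ℝ n) 0ℓ → Setoid 0ℓ 0ℓ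
Subspace {n} P = record
  { Carrier = Σ (Vector ℝ n) P
  ; _≈_ = λ x y → ∀ i → proj₁ x i ≈ proj₁ y i
  ; isEquivalence = record
    { refl = λ {x} i → R.refl {proj₁ x i}
    ; sym = λ {x} {y} h i → R.sym {proj₁ x i} {proj₁ y i} (h i)
    ; trans = λ {x} {y} {z} h k i → R.trans {proj₁ x i} {proj₁ y i} {proj₁ z i} (h i) (k i)
    }
  }
  where module R = Setoid ℝ-setoid

-- Distance less than ε in the maximum metric, which induces the Euclidean
-- topology.
Within : ∀ {n} → ℝ → Vector ℝ n → Vector ℝ n → Set
Within ε x y = ∀ i → x i < y i + ε × y i < x i + ε

Continuous : ∀ {m n} {P : Pred (Vector ℝ m) 0ℓ} {Q : Pred (Vector ℝ n) 0ℓ} →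
             (Σ (Vector ℝ m) P → Σ (Vector ℝ n) Q) → Set
Continuous {P = P} f = ∀ x ε → 0ℝ < ε → Σ[ δ ∈ ℝ ] 0ℝ < δ ×
  (∀ y → Within δ (proj₁ x) (proj₁ y) → Within ε (proj₁ (f x)) (proj₁ (f y)))

record Homeomorphism {m n} (P : Pred (Vector ℝ m) 0ℓ) (Q : Pred (Vector ℝ n) 0ℓ) : Set where
  field
    bijection : Inverse (Subspace P) (Subspace Q)
  open Inverse bijection public
  field
    to-continuous   : Continuous {P = P} {Q = Q} to
    from-continuous : Continuous {P = Q} {Q = P} from

Sphere : (d : ℕ) → Pred (Vector ℝ (suc d)) 0ℓ
Sphere d x = Σℝ (λ i → x i * x i) ≈ 1ℝ

TriangulatesS³ : ∀ {n} → SimplicialComplex n → Set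
TriangulatesS³ X = Homeomorphism (InRealization X) (Sphere 3)

{-# OPTIONS --safe #-}

-- If γ₂ ≠ 0, the roots of γ(t) − t = γ₂ ((t − b)² − c) are b ± √ c, so they are real and negative
-- exactly when b < 0 ≤ c < b². This means that γ₁ = 1 + a with 0 ≤ γ₂ ≤ a² / 4.
--
-- Subdividing an edge of a flag complex gives a flag complex again. If the link of the edge in a
-- flag 3-sphere is a (4 + k)-gon, its subdivision adds (1 , k) to (γ₁ , γ₂). Start from the
-- cross-polytope, where (γ₁ , γ₂) = (0 , 0) and links of edges are quadrilaterals, and from
-- opposite edges e and e′ of a facet. Subdividing e adds a vertex to the link of e′ and
-- conversely, so c subdivisions of e followed by b subdivisions of e′ lead to (b + c , b c).
-- Subdividing an edge between e and e′ adds (1 , 0) and makes the link of e a quadrilateral again;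
-- r more subdivisions of e′ and one of e then bring γ₂ to c (r + b) + r. Division of γ₂ > 0 by
-- ⌊a / 2⌋ = r + b, with remainder 1 ≤ r ≤ ⌊a / 2⌋, reaches every γ₂ ≤ ⌊a / 2⌋ ⌈a / 2⌉.

module Submission where

open import Defs
open import Algebra.Bundles using (CommutativeMonoid; CommutativeRing)
import Algebra.Properties.CommutativeSemigroup
import Algebra.Properties.Semiring.Sum
import Algebra.Solver.Ring
open import Algebra.Solver.Ring.AlmostCommutativeRing using (fromCommutativeRing; _-Raw-AlmostCommutative⟶_)
open import Data.Bool as Bool using (Bool; true; false; _∧_; _∨_; not; if_then_else_)
open import Data.Bool.Properties using
  ( ∧-comm; ∧-assoc; ∧-zeroʳ; ∧-identityʳ; ∧-conicalˡ; ∧-conicalʳ; ∧-commutativeMonoid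
  ; ∨-comm; ∨-identityʳ; ∨-zeroʳ )
open import Data.Empty using (⊥)
open import Data.Fin using (Fin; zero; suc)
import Data.Fin.Properties as Fin
open import Data.Fin.Subset using (Subset; inside; outside; ⁅_⁆; _∈_; _∪_; ∁; ∣_∣) renaming (⊥ to ∅)
open import Data.Fin.Subset.Properties using (x∈⁅y⁆⇒x≡y; x∈⁅x⁆; ∉⊥; _∈?_; x∈p∪q⁺; x∈p∪q⁻)
open import Data.Integer as ℤ using (ℤ; +_; -[1+_])
import Data.Integer.Properties as ℤ
open import Data.List using (List; []; _∷_; _++_; map; filter; foldr)
open import Data.List.Properties using (filter-++; filter-none; filter-≐)
import Data.List.Relation.Unary.All as All
open import Data.Maybe as Maybe using (Maybe)
open import Data.Nat as ℕ using (ℕ; zero; suc; ⌊_/2⌋; ⌈_/2⌉)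
import Data.Nat.Coprimality as Coprimality
open import Data.Nat.DivMod using (_/_; _%_; m≡m%n+[m/n]*n; m%n<n; m<n*o⇒m/o<n)
import Data.Nat.Properties as ℕ
open import Data.Nat.Solver using () renaming (module +-*-Solver to ℕ-Solver)
open import Data.Product using (Σ; ∃; ∃₂; Σ-syntax; _×_; _,_; proj₁; proj₂)
open import Data.Rational as ℚ using (ℚ; 0ℚ; 1ℚ; ½; mkℚ; *<*; *≤*)
import Data.Rational.Properties as ℚ
open import Data.Rational.Solver using () renaming (module +-*-Solver to ℚ-Solver)
import Data.Rational.Unnormalised as ℚᵘ
import Data.Rational.Unnormalised.Properties as ℚᵘ
open import Data.Sum as Sum using (_⊎_; inj₁; inj₂; [_,_]′)
open import Data.Vec using ([]; _∷_; here; there; lookup; _[_]≔_)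
open import Data.Vec.Functional using (Vector; updateAt)
open import Data.Vec.Functional.Properties using (updateAt-updates; updateAt-minimal)
open import Data.Vec.Properties using (lookup∘update′)
open import Function using (_∘_)
open import Function.Construct.Composition using (inverse)
open import Level using (0ℓ)
import Relation.Binary.Reasoning.Setoid
open import Relation.Binary.PropositionalEquality as ≡ using (_≡_; _≢_; refl; sym; cong; cong₂; subst; subst₂)
open import Relation.Nullary using (¬_; Dec; yes; no; does; contradiction)
open import Relation.Nullary.Decidable using (_→-dec_; _×-dec_; ¬?; dec-true; dec-false; dec⇒maybe)
open import Relation.Unary using (Pred; Decidable; _≐_)

-- Integers as rationals

ι : ℤ → ℚ
ι i = i ℚ./ 1

toℚᵘ-ι : ∀ i → ℚ.toℚᵘ (ι i) ℚᵘ.≃ ℚᵘ.mkℚᵘ i 0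
toℚᵘ-ι i = ℚ.toℚᵘ-fromℚᵘ (ℚᵘ.mkℚᵘ i 0)

ι-homo-+ : ∀ i j → ι (i ℤ.+ j) ≡ ι i ℚ.+ ι j
ι-homo-+ i j = ℚ.toℚᵘ-injective (begin
  ℚ.toℚᵘ (ι (i ℤ.+ j))             ≈⟨ toℚᵘ-ι (i ℤ.+ j) ⟩
  ℚᵘ.mkℚᵘ (i ℤ.+ j) 0              ≈⟨ ℚᵘ.*≡* (cong₂ (λ k l → (k ℤ.+ l) ℤ.* + 1)
                                        (ℤ.*-identityʳ i) (ℤ.*-identityʳ j)) ⟨
  ℚᵘ.mkℚᵘ i 0 ℚᵘ.+ ℚᵘ.mkℚᵘ j 0     ≈⟨ ℚᵘ.+-cong (toℚᵘ-ι i) (toℚᵘ-ι j) ⟨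
  ℚ.toℚᵘ (ι i) ℚᵘ.+ ℚ.toℚᵘ (ι j)   ≈⟨ ℚ.toℚᵘ-homo-+ (ι i) (ι j) ⟨
  ℚ.toℚᵘ (ι i ℚ.+ ι j)             ∎)
  where open ℚᵘ.≃-Reasoning

ι-homo-* : ∀ i j → ι (i ℤ.* j) ≡ ι i ℚ.* ι j
ι-homo-* i j = ℚ.toℚᵘ-injective (begin
  ℚ.toℚᵘ (ι (i ℤ.* j))             ≈⟨ toℚᵘ-ι (i ℤ.* j) ⟩
  ℚᵘ.mkℚᵘ i 0 ℚᵘ.* ℚᵘ.mkℚᵘ j 0     ≈⟨ ℚᵘ.*-cong (toℚᵘ-ι i) (toℚᵘ-ι j) ⟨
  ℚ.toℚᵘ (ι i) ℚᵘ.* ℚ.toℚᵘ (ι j)   ≈⟨ ℚ.toℚᵘ-homo-* (ι i) (ι j) ⟨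
  ℚ.toℚᵘ (ι i ℚ.* ι j)             ∎)
  where open ℚᵘ.≃-Reasoning

ι-mono-≤ : ∀ {i j} → i ℤ.≤ j → ι i ℚ.≤ ι j
ι-mono-≤ {i} {j} i≤j = ℚ.toℚᵘ-cancel-≤ (begin
  ℚ.toℚᵘ (ι i)  ≃⟨ toℚᵘ-ι i ⟩
  ℚᵘ.mkℚᵘ i 0   ≤⟨ ℚᵘ.*≤* (ℤ.*-monoʳ-≤-nonNeg (+ 1) i≤j) ⟩
  ℚᵘ.mkℚᵘ j 0   ≃⟨ toℚᵘ-ι j ⟨
  ℚ.toℚᵘ (ι j)  ∎)
  where open ℚᵘ.≤-Reasoning

ι-cancel-≤ : ∀ {i j} → ι i ℚ.≤ ι j → i ℤ.≤ j
ι-cancel-≤ {i} {j} ιi≤ιj = ℤ.*-cancelʳ-≤-pos i j (+ 1) (ℚᵘ.drop-*≤* (begin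
  ℚᵘ.mkℚᵘ i 0   ≃⟨ toℚᵘ-ι i ⟨
  ℚ.toℚᵘ (ι i)  ≤⟨ ℚ.toℚᵘ-mono-≤ ιi≤ιj ⟩
  ℚ.toℚᵘ (ι j)  ≃⟨ toℚᵘ-ι j ⟩
  ℚᵘ.mkℚᵘ j 0   ∎))
  where open ℚᵘ.≤-Reasoning

nat : ℕ → ℚ
nat n = ι (+ n)

nat-homo-+ : ∀ m n → nat (m ℕ.+ n) ≡ nat m ℚ.+ nat n
nat-homo-+ m n = ι-homo-+ (+ m) (+ n)

nat-homo-* : ∀ m n → nat (m ℕ.* n) ≡ nat m ℚ.* nat n
nat-homo-* m n = ≡.trans (cong ι (ℤ.pos-* m n)) (ι-homo-* (+ m) (+ n))

nat-cancel-≤ : ∀ {m n} → nat m ℚ.≤ nat n → m ℕ.≤ n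
nat-cancel-≤ m≤n = ℤ.drop‿+≤+ (ι-cancel-≤ m≤n)

-- Rational estimates

p<q⇒0<q-p : ∀ {p q} → p ℚ.< q → 0ℚ ℚ.< q ℚ.- p
p<q⇒0<q-p {p} {q} p<q = subst (ℚ._< q ℚ.- p) (ℚ.+-inverseʳ p) (ℚ.+-monoˡ-< (ℚ.- p) p<q)

0<q-p⇒p<q : ∀ {p q} → 0ℚ ℚ.< q ℚ.- p → p ℚ.< q
0<q-p⇒p<q {p} {q} 0<q-p = subst₂ ℚ._<_ (ℚ.+-identityˡ p)
  (solve 2 (λ p q → (q :- p) :+ p := q) refl p q) (ℚ.+-monoˡ-< p 0<q-p)
  where open ℚ-Solver

-- Linear inequalities are derived from each other by a ring identity between the
-- differences of their sides.
<-resp-difference : ∀ {a b x y} → x ℚ.< y → b ℚ.- a ≡ y ℚ.- x → a ℚ.< b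
<-resp-difference x<y eq = 0<q-p⇒p<q (subst (0ℚ ℚ.<_) (sym eq) (p<q⇒0<q-p x<y))

≤-resp-difference : ∀ {a b x y} → x ℚ.≤ y → b ℚ.- a ≡ y ℚ.- x → a ℚ.≤ b
≤-resp-difference {a} {b} {x} {y} x≤y eq = ℚ.≮⇒≥ λ b<a → ℚ.<-irrefl refl
  (ℚ.<-≤-trans (<-resp-difference {y} {x} b<a (begin
    x ℚ.- y       ≡⟨ solve 2 (λ x y → x :- y := :- (y :- x)) refl x y ⟩
    ℚ.- (y ℚ.- x) ≡⟨ cong ℚ.-_ eq ⟨
    ℚ.- (b ℚ.- a) ≡⟨ solve 2 (λ a b → :- (b :- a) := a :- b) refl a b ⟩
    a ℚ.- b       ∎)) x≤y)
  where
  open ℚ-Solver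
  open ≡.≡-Reasoning

p<p+e : ∀ {p e} → 0ℚ ℚ.< e → p ℚ.< p ℚ.+ e
p<p+e {p} {e} 0<e = subst (ℚ._< p ℚ.+ e) (ℚ.+-identityʳ p) (ℚ.+-monoʳ-< p 0<e)

0<p+q : ∀ {p q} → 0ℚ ℚ.< p → 0ℚ ℚ.< q → 0ℚ ℚ.< p ℚ.+ q
0<p+q = ℚ.+-mono-<

0<p*q : ∀ {p q} → 0ℚ ℚ.< p → 0ℚ ℚ.< q → 0ℚ ℚ.< p ℚ.* q
0<p*q {p} {q} 0<p 0<q = ℚ.positive⁻¹ (p ℚ.* q) {{ℚ.pos*pos⇒pos p {{ℚ.positive 0<p}} q {{ℚ.positive 0<q}}}}

0≤p*q : ∀ {p q} → 0ℚ ℚ.≤ p → 0ℚ ℚ.≤ q → 0ℚ ℚ.≤ p ℚ.* q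
0≤p*q {p} {q} 0≤p 0≤q =
  ℚ.nonNegative⁻¹ (p ℚ.* q) {{ℚ.nonNeg*nonNeg⇒nonNeg p {{ℚ.nonNegative 0≤p}} q {{ℚ.nonNegative 0≤q}}}}

0<½*e : ∀ {e} → 0ℚ ℚ.< e → 0ℚ ℚ.< ½ ℚ.* e
0<½*e = 0<p*q (ℚ.positive⁻¹ ½)

½*e+½*e≡e : ∀ e → ½ ℚ.* e ℚ.+ ½ ℚ.* e ≡ e
½*e+½*e≡e = solve 1 (λ e → con ½ :* e :+ con ½ :* e := e) refl
  where open ℚ-Solver

½*e<e : ∀ {e} → 0ℚ ℚ.< e → ½ ℚ.* e ℚ.< e
½*e<e {e} 0<e = subst (½ ℚ.* e ℚ.<_) (½*e+½*e≡e e) (p<p+e (0<½*e 0<e))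

0≤p*p : ∀ p → 0ℚ ℚ.≤ p ℚ.* p
0≤p*p p with ℚ.≤-total 0ℚ p
... | inj₁ 0≤p = 0≤p*q 0≤p 0≤p
... | inj₂ p≤0 = ℚ.nonNegative⁻¹ (p ℚ.* p) {{ℚ.nonPos*nonPos⇒nonPos p p}}
  where
  instance
    p-nonPositive : ℚ.NonPositive p
    p-nonPositive = ℚ.nonPositive p≤0

square-mono-≤ : ∀ {p q} → 0ℚ ℚ.≤ p → p ℚ.≤ q → p ℚ.* p ℚ.≤ q ℚ.* q
square-mono-≤ {p} {q} 0≤p p≤q = ℚ.≤-trans
  (ℚ.*-monoˡ-≤-nonNeg p {{ℚ.nonNegative 0≤p}} p≤q)
  (ℚ.*-monoʳ-≤-nonNeg q {{ℚ.nonNegative (ℚ.≤-trans 0≤p p≤q)}} p≤q)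

square-cancel-< : ∀ {p q} → 0ℚ ℚ.≤ q → p ℚ.* p ℚ.< q ℚ.* q → p ℚ.< q
square-cancel-< 0≤q p²<q² = ℚ.≰⇒> λ q≤p → ℚ.<-irrefl refl (ℚ.<-≤-trans p²<q² (square-mono-≤ 0≤q q≤p))

p≤∣p∣ : ∀ p → p ℚ.≤ ℚ.∣ p ∣
p≤∣p∣ p with ℚ.≤-total 0ℚ p
... | inj₁ 0≤p = ℚ.≤-reflexive (sym (ℚ.0≤p⇒∣p∣≡p 0≤p))
... | inj₂ p≤0 = ℚ.≤-trans p≤0 (ℚ.0≤∣p∣ p)

⊓-mono-< : ∀ {a b c d} → a ℚ.< c → b ℚ.< d → a ℚ.⊓ b ℚ.< c ℚ.⊓ d
⊓-mono-< {a} {b} {c} {d} a<c b<d with ℚ.⊓-sel c d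
... | inj₁ eq = subst (a ℚ.⊓ b ℚ.<_) (sym eq) (ℚ.≤-<-trans (ℚ.p⊓q≤p a b) a<c)
... | inj₂ eq = subst (a ℚ.⊓ b ℚ.<_) (sym eq) (ℚ.≤-<-trans (ℚ.p⊓q≤q a b) b<d)

+-distribʳ-⊓ : ∀ e a b → a ℚ.⊓ b ℚ.+ e ≡ (a ℚ.+ e) ℚ.⊓ (b ℚ.+ e)
+-distribʳ-⊓ e = ℚ.mono-≤-distrib-⊓ (ℚ.+-monoˡ-≤ e)

multiplier≤1 : ∀ {C e} → 0ℚ ℚ.< C → 0ℚ ℚ.< e → ∃ λ d → 0ℚ ℚ.< d × d ℚ.≤ 1ℚ × C ℚ.* d ℚ.≤ e
multiplier≤1 {C} {e} 0<C 0<e = d , 0<d , d≤1 , Cd≤e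
  where
  open ℚ.≤-Reasoning
  D d : ℚ
  D = C ℚ.+ e
  instance
    D-positive : ℚ.Positive D
    D-positive = ℚ.positive (0<p+q 0<C 0<e)
    D-nonZero : ℚ.NonZero D
    D-nonZero = ℚ.pos⇒nonZero D
  d = ℚ.1/ D ℚ.* e
  0<d : 0ℚ ℚ.< d
  0<d = 0<p*q (ℚ.positive⁻¹ (ℚ.1/ D) {{ℚ.1/pos⇒pos D}}) 0<e
  Dd≡e : D ℚ.* d ≡ e
  Dd≡e = begin-equality
    D ℚ.* (ℚ.1/ D ℚ.* e)   ≡⟨ ℚ.*-assoc D (ℚ.1/ D) e ⟨
    (D ℚ.* ℚ.1/ D) ℚ.* e   ≡⟨ cong (ℚ._* e) (ℚ.*-inverseʳ D) ⟩
    1ℚ ℚ.* e               ≡⟨ ℚ.*-identityˡ e ⟩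
    e                      ∎
  d≤1 : d ℚ.≤ 1ℚ
  d≤1 = ℚ.*-cancelˡ-≤-pos D (begin
    D ℚ.* d    ≡⟨ Dd≡e ⟩
    e          ≡⟨ ℚ.+-identityˡ e ⟨
    0ℚ ℚ.+ e   ≤⟨ ℚ.+-monoˡ-≤ e (ℚ.<⇒≤ 0<C) ⟩
    D          ≡⟨ ℚ.*-identityʳ D ⟨
    D ℚ.* 1ℚ   ∎)
  Cd≤e : C ℚ.* d ℚ.≤ e
  Cd≤e = begin
    C ℚ.* d    ≤⟨ ℚ.*-monoʳ-≤-nonNeg d {{ℚ.nonNegative (ℚ.<⇒≤ 0<d)}} (ℚ.<⇒≤ (p<p+e {C} 0<e)) ⟩
    D ℚ.* d    ≡⟨ Dd≡e ⟩
    e          ∎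

record Near (e p q : ℚ) : Set where
  constructor _,_
  field
    below : p ℚ.< q ℚ.+ e
    above : q ℚ.< p ℚ.+ e

open Near

∣p-q∣<e⇒Near : ∀ {e p q} → ℚ.∣ p ℚ.- q ∣ ℚ.< e → Near e p q
∣p-q∣<e⇒Near {e} {p} {q} lt =
  <-resp-difference (ℚ.≤-<-trans (p≤∣p∣ (p ℚ.- q)) lt)
    (solve 3 (λ p q e → (q :+ e) :- p := e :- (p :- q)) refl p q e) ,
  <-resp-difference (ℚ.≤-<-trans (p≤∣p∣ (ℚ.- (p ℚ.- q))) (subst (ℚ._< e) (sym (ℚ.∣-p∣≡∣p∣ (p ℚ.- q))) lt))
    (solve 3 (λ p q e → (p :+ e) :- q := e :- (:- (p :- q))) refl p q e)
  where open ℚ-Solver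

Near⇒∣p-q∣<e : ∀ {e p q} → Near e p q → ℚ.∣ p ℚ.- q ∣ ℚ.< e
Near⇒∣p-q∣<e {e} {p} {q} (p<q+e , q<p+e) with ℚ.∣p∣≡p∨∣p∣≡-p (p ℚ.- q)
... | inj₁ eq = subst (ℚ._< e) (sym eq)
  (<-resp-difference p<q+e (solve 3 (λ p q e → e :- (p :- q) := (q :+ e) :- p) refl p q e))
  where open ℚ-Solver
... | inj₂ eq = subst (ℚ._< e) (sym eq)
  (<-resp-difference q<p+e (solve 3 (λ p q e → e :- (:- (p :- q)) := (p :+ e) :- q) refl p q e))
  where open ℚ-Solver

Near-refl : ∀ {e p} → 0ℚ ℚ.< e → Near e p p
Near-refl 0<e = p<p+e 0<e , p<p+e 0<e

Near-sym : ∀ {e p q} → Near e p q → Near e q p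
Near-sym (p<q+e , q<p+e) = q<p+e , p<q+e

Near-weaken : ∀ {e f p q} → e ℚ.≤ f → Near e p q → Near f p q
Near-weaken {p = p} {q} e≤f (p<q+e , q<p+e) =
  ℚ.<-≤-trans p<q+e (ℚ.+-monoʳ-≤ q e≤f) , ℚ.<-≤-trans q<p+e (ℚ.+-monoʳ-≤ p e≤f)

Near-+ : ∀ {e f a b a′ b′} → Near e a b → Near f a′ b′ → Near (e ℚ.+ f) (a ℚ.+ a′) (b ℚ.+ b′)
Near-+ {e} {f} {a} {b} {a′} {b′} (a<b+e , b<a+e) (a′<b′+f , b′<a′+f) =
  subst (a ℚ.+ a′ ℚ.<_) (interchange b b′) (ℚ.+-mono-< a<b+e a′<b′+f) ,
  subst (b ℚ.+ b′ ℚ.<_) (interchange a a′) (ℚ.+-mono-< b<a+e b′<a′+f)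
  where
  open ℚ-Solver
  interchange : ∀ x y → (x ℚ.+ e) ℚ.+ (y ℚ.+ f) ≡ (x ℚ.+ y) ℚ.+ (e ℚ.+ f)
  interchange x y = solve 4 (λ x y e f → (x :+ e) :+ (y :+ f) := (x :+ y) :+ (e :+ f)) refl x y e f

Near-neg : ∀ {e a b} → Near e a b → Near e (ℚ.- a) (ℚ.- b)
Near-neg {e} {a} {b} (a<b+e , b<a+e) =
  <-resp-difference b<a+e (solve 3 (λ a b e → ((:- b) :+ e) :- (:- a) := (a :+ e) :- b) refl a b e) ,
  <-resp-difference a<b+e (solve 3 (λ a b e → ((:- a) :+ e) :- (:- b) := (b :+ e) :- a) refl a b e)
  where open ℚ-Solver

Near-⊓ : ∀ {e a b a′ b′} → Near e a b → Near e a′ b′ → Near e (a ℚ.⊓ a′) (b ℚ.⊓ b′)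
Near-⊓ {e} {a} {b} {a′} {b′} (a<b+e , b<a+e) (a′<b′+e , b′<a′+e) =
  subst (a ℚ.⊓ a′ ℚ.<_) (sym (+-distribʳ-⊓ e b b′)) (⊓-mono-< a<b+e a′<b′+e) ,
  subst (b ℚ.⊓ b′ ℚ.<_) (sym (+-distribʳ-⊓ e a a′)) (⊓-mono-< b<a+e b′<a′+e)

Near⇒∣q∣≤∣p∣+e : ∀ {e p q} → Near e p q → ℚ.∣ q ∣ ℚ.≤ ℚ.∣ p ∣ ℚ.+ e
Near⇒∣q∣≤∣p∣+e {e} {p} {q} near = begin
  ℚ.∣ q ∣                       ≡⟨ cong ℚ.∣_∣ (solve 2 (λ p q → q := p :+ (q :- p)) refl p q) ⟩
  ℚ.∣ p ℚ.+ (q ℚ.- p) ∣         ≤⟨ ℚ.∣p+q∣≤∣p∣+∣q∣ p (q ℚ.- p) ⟩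
  ℚ.∣ p ∣ ℚ.+ ℚ.∣ q ℚ.- p ∣     ≤⟨ ℚ.+-monoʳ-≤ ℚ.∣ p ∣ (ℚ.<⇒≤ (Near⇒∣p-q∣<e (Near-sym near))) ⟩
  ℚ.∣ p ∣ ℚ.+ e                 ∎
  where
  open ℚ.≤-Reasoning
  open ℚ-Solver

Near-* : ∀ {A B d a b a′ b′} → 0ℚ ℚ.< A → 0ℚ ℚ.< B → ℚ.∣ a ∣ ℚ.≤ A → ℚ.∣ b′ ∣ ℚ.≤ B →
         Near d a b → Near d a′ b′ → Near ((A ℚ.+ B) ℚ.* d) (a ℚ.* a′) (b ℚ.* b′)
Near-* {A} {B} {d} {a} {b} {a′} {b′} 0<A 0<B ∣a∣≤A ∣b′∣≤B a≈b a′≈b′ = ∣p-q∣<e⇒Near (begin-strict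
  ℚ.∣ a ℚ.* a′ ℚ.- b ℚ.* b′ ∣
    ≡⟨ cong ℚ.∣_∣ (solve 4 (λ a b a′ b′ → a :* a′ :- b :* b′ := a :* (a′ :- b′) :+ b′ :* (a :- b))
         refl a b a′ b′) ⟩
  ℚ.∣ a ℚ.* (a′ ℚ.- b′) ℚ.+ b′ ℚ.* (a ℚ.- b) ∣
    ≤⟨ ℚ.∣p+q∣≤∣p∣+∣q∣ (a ℚ.* (a′ ℚ.- b′)) (b′ ℚ.* (a ℚ.- b)) ⟩
  ℚ.∣ a ℚ.* (a′ ℚ.- b′) ∣ ℚ.+ ℚ.∣ b′ ℚ.* (a ℚ.- b) ∣
    <⟨ ℚ.+-mono-< (∣p*q∣<Cd 0<A ∣a∣≤A (Near⇒∣p-q∣<e a′≈b′)) (∣p*q∣<Cd 0<B ∣b′∣≤B (Near⇒∣p-q∣<e a≈b)) ⟩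
  A ℚ.* d ℚ.+ B ℚ.* d
    ≡⟨ ℚ.*-distribʳ-+ d A B ⟨
  (A ℚ.+ B) ℚ.* d ∎)
  where
  open ℚ.≤-Reasoning
  open ℚ-Solver
  ∣p*q∣<Cd : ∀ {C p q} → 0ℚ ℚ.< C → ℚ.∣ p ∣ ℚ.≤ C → ℚ.∣ q ∣ ℚ.< d → ℚ.∣ p ℚ.* q ∣ ℚ.< C ℚ.* d
  ∣p*q∣<Cd {C} {p} {q} 0<C ∣p∣≤C ∣q∣<d = begin-strict
    ℚ.∣ p ℚ.* q ∣         ≡⟨ ℚ.∣p*q∣≡∣p∣*∣q∣ p q ⟩
    ℚ.∣ p ∣ ℚ.* ℚ.∣ q ∣   ≤⟨ ℚ.*-monoʳ-≤-nonNeg ℚ.∣ q ∣ {{ℚ.∣-∣-nonNeg q}} ∣p∣≤C ⟩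
    C ℚ.* ℚ.∣ q ∣         <⟨ ℚ.*-monoʳ-<-pos C {{ℚ.positive 0<C}} ∣q∣<d ⟩
    C ℚ.* d               ∎

-- Real numbers

Eventually : (ℕ → Set) → Set
Eventually P = ∃ λ N → ∀ n → N ℕ.≤ n → P n

always : ∀ {P : ℕ → Set} → (∀ n → P n) → Eventually P
always p = 0 , λ n _ → p n

eventually-map : ∀ {P Q : ℕ → Set} → (∀ n → P n → Q n) → Eventually P → Eventually Q
eventually-map f (N , p) = N , λ n N≤n → f n (p n N≤n)

eventually-zip : ∀ {P Q R : ℕ → Set} → (∀ n → P n → Q n → R n) → Eventually P → Eventually Q → Eventually R
eventually-zip f (M , p) (N , q) = M ℕ.⊔ N , λ n M⊔N≤n →
  f n (p n (ℕ.m⊔n≤o⇒m≤o M N M⊔N≤n)) (q n (ℕ.m⊔n≤o⇒n≤o M N M⊔N≤n))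

eventually-both : ∀ {P Q : ℕ → Set} → Eventually P → Eventually Q → Eventually λ n → P n × Q n
eventually-both = eventually-zip λ _ p q → p , q

eventually⇒∃ : ∀ {P : ℕ → Set} → Eventually P → ∃ P
eventually⇒∃ (N , p) = N , p N ℕ.≤-refl

-- _≈_, _<_ and _≤_ unfold to statements about the sequences alone, from which the real
-- numbers cannot be inferred; the parameters of a record can.
record Close (e : ℚ) (x y : ℝ) : Set where
  constructor mkClose
  field eventually-near : Eventually λ n → Near e (seq x n) (seq y n)

open Close

infix 4 _≃_ _≲_

record _≃_ (x y : ℝ) : Set where
  constructor mk≃
  field close : ∀ {e} → 0ℚ ℚ.< e → Close e x y

open _≃_

record _≲_ (x y : ℝ) : Set where
  constructor mk≲
  field approx : ∀ {e} → 0ℚ ℚ.< e → Eventually λ n → seq x n ℚ.< seq y n ℚ.+ e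

open _≲_

record Positive (x : ℝ) : Set where
  constructor mkPositive
  field
    {bound}          : ℚ
    0<bound          : 0ℚ ℚ.< bound
    eventually-above : Eventually λ n → bound ℚ.< seq x n

≈⇒≃ : ∀ {x y} → x ≈ y → x ≃ y
≈⇒≃ x≈y = mk≃ λ {e} 0<e → mkClose (eventually-map (λ _ → ∣p-q∣<e⇒Near) (x≈y e 0<e))

≃⇒≈ : ∀ {x y} → x ≃ y → x ≈ y
≃⇒≈ x≃y e 0<e = eventually-map (λ _ → Near⇒∣p-q∣<e) (eventually-near (close x≃y 0<e))

0<⇒Positive : ∀ {x} → 0ℝ < x → Positive x
0<⇒Positive {x} (e , 0<e , 0+e<x) =
  mkPositive 0<e (eventually-map (λ n → subst (ℚ._< seq x n) (ℚ.+-identityˡ e)) 0+e<x)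

Positive⇒0< : ∀ {x} → Positive x → 0ℝ < x
Positive⇒0< {x} (mkPositive {e} 0<e e<x) =
  e , 0<e , eventually-map (λ n → subst (ℚ._< seq x n) (sym (ℚ.+-identityˡ e))) e<x

termwise-≃ : ∀ {x y} → (∀ n → seq x n ≡ seq y n) → x ≃ y
termwise-≃ {x} x≡y = mk≃ λ 0<e → mkClose (always λ n → subst (Near _ (seq x n)) (x≡y n) (Near-refl 0<e))

termwise-≲ : ∀ {x y} → (∀ n → seq x n ℚ.≤ seq y n) → x ≲ y
termwise-≲ x≤y = mk≲ λ 0<e → always λ n → ℚ.≤-<-trans (x≤y n) (p<p+e 0<e)

≃⇒≲ : ∀ {x y} → x ≃ y → x ≲ y
≃⇒≲ x≃y = mk≲ λ 0<e → eventually-map (λ _ → below) (eventually-near (close x≃y 0<e))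

≲-antisym : ∀ {x y} → x ≲ y → y ≲ x → x ≃ y
≲-antisym x≲y y≲x = mk≃ λ 0<e → mkClose (eventually-zip (λ _ → _,_) (approx x≲y 0<e) (approx y≲x 0<e))

+-mono-≲ : ∀ {x y x′ y′} → x ≲ y → x′ ≲ y′ → x + x′ ≲ y + y′
+-mono-≲ {x} {y} {x′} {y′} x≲y x′≲y′ = mk≲ λ {e} 0<e → eventually-zip
  (λ n x<y+½e x′<y′+½e → <-resp-difference (ℚ.+-mono-< x<y+½e x′<y′+½e)
    (solve 5 (λ a b a′ b′ e → ((b :+ b′) :+ e) :- (a :+ a′) :=
                              ((b :+ con ½ :* e) :+ (b′ :+ con ½ :* e)) :- (a :+ a′))
       refl (seq x n) (seq y n) (seq x′ n) (seq y′ n) e))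
  (approx x≲y (0<½*e 0<e)) (approx x′≲y′ (0<½*e 0<e))
  where open ℚ-Solver

≲-refl : ∀ {x} → x ≲ x
≲-refl = termwise-≲ λ _ → ℚ.≤-refl

≲-trans : ∀ {x y z} → x ≲ y → y ≲ z → x ≲ z
≲-trans {x} {y} {z} x≲y y≲z = mk≲ λ {e} 0<e → eventually-zip
  (λ n x<y+½e y<z+½e → ℚ.<-trans x<y+½e (<-resp-difference y<z+½e
    (solve 3 (λ y z e → (z :+ e) :- (y :+ con ½ :* e) := (z :+ con ½ :* e) :- y) refl (seq y n) (seq z n) e)))
  (approx x≲y (0<½*e 0<e)) (approx y≲z (0<½*e 0<e))
  where open ℚ-Solver

≃-refl : ∀ {x} → x ≃ x
≃-refl = termwise-≃ λ _ → refl

≃-sym : ∀ {x y} → x ≃ y → y ≃ x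
≃-sym x≃y = mk≃ λ 0<e → mkClose (eventually-map (λ _ → Near-sym) (eventually-near (close x≃y 0<e)))

≲-respʳ-≃ : ∀ {x y z} → y ≃ z → x ≲ y → x ≲ z
≲-respʳ-≃ y≃z x≲y = ≲-trans x≲y (≃⇒≲ y≃z)

≃-trans : ∀ {x y z} → x ≃ y → y ≃ z → x ≃ z
≃-trans x≃y y≃z = ≲-antisym (≲-trans (≃⇒≲ x≃y) (≃⇒≲ y≃z)) (≲-trans (≃⇒≲ (≃-sym y≃z)) (≃⇒≲ (≃-sym x≃y)))

-- Continuity

Continuous₁ : (ℝ → ℝ) → Set
Continuous₁ f = ∀ x {e} → 0ℚ ℚ.< e → ∃ λ d → 0ℚ ℚ.< d × (∀ {y} → Close d x y → Close e (f x) (f y))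

Continuous₂ : (ℝ → ℝ → ℝ) → Set
Continuous₂ _∙_ = ∀ x x′ {e} → 0ℚ ℚ.< e → ∃ λ d → 0ℚ ℚ.< d ×
  (∀ {y y′} → Close d x y → Close d x′ y′ → Close e (x ∙ x′) (y ∙ y′))

continuous⇒cong : ∀ {f} → Continuous₁ f → ∀ {x y} → x ≃ y → f x ≃ f y
continuous⇒cong f-continuous {x} x≃y = mk≃ λ 0<e →
  let _ , 0<d , f-close = f-continuous x 0<e in f-close (close x≃y 0<d)

continuous₂⇒cong : ∀ {_∙_} → Continuous₂ _∙_ → ∀ {x y x′ y′} → x ≃ y → x′ ≃ y′ → (x ∙ x′) ≃ (y ∙ y′)
continuous₂⇒cong ∙-continuous {x} {x′ = x′} x≃y x′≃y′ = mk≃ λ 0<e →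
  let _ , 0<d , ∙-close = ∙-continuous x x′ 0<e in ∙-close (close x≃y 0<d) (close x′≃y′ 0<d)

+-continuous : Continuous₂ _+_
+-continuous x x′ {e} 0<e = ½ ℚ.* e , 0<½*e 0<e , λ {y} {y′} (mkClose x≈y) (mkClose x′≈y′) →
  mkClose (eventually-zip
    (λ n p q → subst (λ e → Near e (seq (x + x′) n) (seq (y + y′) n)) (½*e+½*e≡e e) (Near-+ p q)) x≈y x′≈y′)

neg-continuous : Continuous₁ -_
neg-continuous x {e} 0<e = e , 0<e , λ (mkClose x≈y) → mkClose (eventually-map (λ _ → Near-neg) x≈y)

eventually-bounded : ∀ x → ∃ λ B → 0ℚ ℚ.< B × Eventually λ n → ℚ.∣ seq x n ∣ ℚ.≤ B
eventually-bounded x with cauchy x 1ℚ (ℚ.positive⁻¹ 1ℚ)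
... | N , close = ℚ.∣ seq x N ∣ ℚ.+ 1ℚ , ℚ.+-mono-≤-< (ℚ.0≤∣p∣ (seq x N)) (ℚ.positive⁻¹ 1ℚ) ,
  N , λ n N≤n → Near⇒∣q∣≤∣p∣+e (∣p-q∣<e⇒Near {p = seq x N} {seq x n} (close N n ℕ.≤-refl N≤n))

*-continuous : Continuous₂ _*_
*-continuous x x′ {e} 0<e =
  let A , 0<A , ∣x∣≤A = eventually-bounded x
      B , 0<B , ∣x′∣≤B = eventually-bounded x′
      0<B+1 = 0<p+q 0<B (ℚ.positive⁻¹ 1ℚ)
      d , 0<d , d≤1 , Cd≤e = multiplier≤1 (0<p+q 0<A 0<B+1) 0<e
  in d , 0<d , λ (mkClose x≈y) (mkClose x′≈y′) → mkClose (eventually-zip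
    (λ n (∣x∣≤A , ∣x′∣≤B) (x≈y , x′≈y′) → Near-weaken Cd≤e (Near-* {A} {B ℚ.+ 1ℚ} {d} 0<A 0<B+1 ∣x∣≤A
      (ℚ.≤-trans (Near⇒∣q∣≤∣p∣+e x′≈y′) (ℚ.+-mono-≤ ∣x′∣≤B d≤1)) x≈y x′≈y′))
    (eventually-both ∣x∣≤A ∣x′∣≤B) (eventually-both x≈y x′≈y′))

+-cong : ∀ {x y x′ y′} → x ≃ y → x′ ≃ y′ → x + x′ ≃ y + y′
+-cong = continuous₂⇒cong +-continuous

*-cong : ∀ {x y x′ y′} → x ≃ y → x′ ≃ y′ → x * x′ ≃ y * y′
*-cong = continuous₂⇒cong *-continuous

-‿cong : ∀ {x y} → x ≃ y → - x ≃ - y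
-‿cong = continuous⇒cong neg-continuous

ℝ-commutativeRing : CommutativeRing 0ℓ 0ℓ
ℝ-commutativeRing = record
  { _≈_ = _≃_ ; _+_ = _+_ ; _*_ = _*_ ; -_ = -_ ; 0# = 0ℝ ; 1# = 1ℝ
  ; isCommutativeRing = record
    { isRing = record
      { +-isAbelianGroup = record
        { isGroup = record
          { isMonoid = record
            { isSemigroup = record
              { isMagma = record
                { isEquivalence = record { refl = ≃-refl ; sym = ≃-sym ; trans = ≃-trans }
                ; ∙-cong        = +-cong
                }
              ; assoc = λ x y z → termwise-≃ λ n → ℚ.+-assoc (seq x n) (seq y n) (seq z n)
              }
            ; identity = (λ x → termwise-≃ λ n → ℚ.+-identityˡ (seq x n)) ,
                         (λ x → termwise-≃ λ n → ℚ.+-identityʳ (seq x n))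
            }
          ; inverse = (λ x → termwise-≃ λ n → ℚ.+-inverseˡ (seq x n)) ,
                      (λ x → termwise-≃ λ n → ℚ.+-inverseʳ (seq x n))
          ; ⁻¹-cong = -‿cong
          }
        ; comm = λ x y → termwise-≃ λ n → ℚ.+-comm (seq x n) (seq y n)
        }
      ; *-cong     = *-cong
      ; *-assoc    = λ x y z → termwise-≃ λ n → ℚ.*-assoc (seq x n) (seq y n) (seq z n)
      ; *-identity = (λ x → termwise-≃ λ n → ℚ.*-identityˡ (seq x n)) ,
                     (λ x → termwise-≃ λ n → ℚ.*-identityʳ (seq x n))
      ; distrib    = (λ x y z → termwise-≃ λ n → ℚ.*-distribˡ-+ (seq x n) (seq y n) (seq z n)) ,
                     (λ x y z → termwise-≃ λ n → ℚ.*-distribʳ-+ (seq x n) (seq y n) (seq z n))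
      }
    ; *-comm = λ x y → termwise-≃ λ n → ℚ.*-comm (seq x n) (seq y n)
    }
  }

fromℚ-morphism : ℚ.+-*-rawRing -Raw-AlmostCommutative⟶ fromCommutativeRing ℝ-commutativeRing
fromℚ-morphism = record
  { ⟦_⟧    = fromℚ
  ; +-homo = λ _ _ → termwise-≃ λ _ → refl
  ; *-homo = λ _ _ → termwise-≃ λ _ → refl
  ; -‿homo = λ _ → termwise-≃ λ _ → refl
  ; 0-homo = ≃-refl
  ; 1-homo = ≃-refl
  }

fromℚ≟ : ∀ p q → Maybe (fromℚ p ≃ fromℚ q)
fromℚ≟ p q = Maybe.map (λ { refl → ≃-refl }) (dec⇒maybe (p ℚ.≟ q))

module ℝ-Solver =
  Algebra.Solver.Ring ℚ.+-*-rawRing (fromCommutativeRing ℝ-commutativeRing) fromℚ-morphism fromℚ≟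
module ℝ-ring = CommutativeRing ℝ-commutativeRing
module ≃-Reasoning = Relation.Binary.Reasoning.Setoid ℝ-ring.setoid

open Algebra.Properties.Semiring.Sum ℝ-ring.semiring
  using (∑-distrib-+; sum-replicate-zero; *-distribʳ-sum) renaming (sum-cong-≋ to Σℝ-cong)

-- Order

Positive-mono : ∀ {x y} → x ≲ y → Positive x → Positive y
Positive-mono {x} {y} x≲y (mkPositive {e} 0<e e<x) = mkPositive (0<½*e 0<e) (eventually-zip
  (λ n e<x x<y+½e → <-resp-difference (ℚ.<-trans e<x x<y+½e)
    (solve 2 (λ y e → y :- con ½ :* e := (y :+ con ½ :* e) :- e) refl (seq y n) e))
  e<x (approx x≲y (0<½*e 0<e)))
  where open ℚ-Solver

Positive-resp-≃ : ∀ {x y} → x ≃ y → Positive x → Positive y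
Positive-resp-≃ x≃y = Positive-mono (≃⇒≲ x≃y)

Positive-* : ∀ {x y} → Positive x → Positive y → Positive (x * y)
Positive-* {x} {y} (mkPositive {e} 0<e e<x) (mkPositive {f} 0<f f<y) =
  mkPositive (0<p*q 0<e 0<f) (eventually-zip
    (λ n e<x f<y → ℚ.<-trans (ℚ.*-monoʳ-<-pos e {{ℚ.positive 0<e}} f<y)
      (ℚ.*-monoˡ-<-pos (seq y n) {{ℚ.positive (ℚ.<-trans 0<f f<y)}} e<x))
    e<x f<y)

fromℚ-positive : ∀ {q} → 0ℚ ℚ.< q → Positive (fromℚ q)
fromℚ-positive 0<q = mkPositive (0<½*e 0<q) (always λ _ → ½*e<e 0<q)

fromℚ-positive⁻¹ : ∀ {q} → Positive (fromℚ q) → 0ℚ ℚ.< q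
fromℚ-positive⁻¹ (mkPositive 0<e e<q) = ℚ.<-trans 0<e (proj₂ (eventually⇒∃ e<q))

fromℚ-mono-≲ : ∀ {p q} → p ℚ.≤ q → fromℚ p ≲ fromℚ q
fromℚ-mono-≲ p≤q = termwise-≲ λ _ → p≤q

¬Positive-0 : ¬ Positive 0ℝ
¬Positive-0 0<0 = ℚ.<-irrefl refl (fromℚ-positive⁻¹ 0<0)

located : ∀ x {p q} → p ℚ.< q → Eventually (λ n → p ℚ.< seq x n) ⊎ Eventually (λ n → seq x n ℚ.< q)
located x {p} {q} p<q = by-comparison (seq x N ℚ.≤? mid)
  where
  open ℚ-Solver
  r mid : ℚ
  r   = ½ ℚ.* (q ℚ.- p)
  mid = p ℚ.+ r
  xₘ≈xₙ : ∃ λ N → ∀ m n → N ℕ.≤ m → N ℕ.≤ n → ℚ.∣ seq x m ℚ.- seq x n ∣ ℚ.< r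
  xₘ≈xₙ = cauchy x r (0<½*e {q ℚ.- p} (p<q⇒0<q-p p<q))
  N : ℕ
  N = proj₁ xₘ≈xₙ
  near : ∀ n → N ℕ.≤ n → Near r (seq x n) (seq x N)
  near n N≤n = ∣p-q∣<e⇒Near (proj₂ xₘ≈xₙ n N N≤n ℕ.≤-refl)
  by-comparison : Dec (seq x N ℚ.≤ mid) → Eventually (λ n → p ℚ.< seq x n) ⊎ Eventually (λ n → seq x n ℚ.< q)
  by-comparison (yes xN≤mid) = inj₂ (N , λ n N≤n →
    <-resp-difference (ℚ.<-≤-trans (below (near n N≤n)) (ℚ.+-monoˡ-≤ r xN≤mid))
      (solve 3 (λ p q x → q :- x := ((p :+ con ½ :* (q :- p)) :+ con ½ :* (q :- p)) :- x) refl p q (seq x n)))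
  by-comparison (no xN≰mid) = inj₁ (N , λ n N≤n →
    <-resp-difference (ℚ.<-trans (ℚ.≰⇒> xN≰mid) (above (near n N≤n)))
      (solve 3 (λ p q x → x :- p := (x :+ con ½ :* (q :- p)) :- (p :+ con ½ :* (q :- p))) refl p q (seq x n)))

¬Positive⇒≲0 : ∀ {x} → ¬ Positive x → x ≲ 0ℝ
¬Positive⇒≲0 {x} ¬0<x = mk≲ λ {e} 0<e → [
  (λ ½e<x → contradiction (mkPositive (0<½*e 0<e) ½e<x) ¬0<x) ,
  eventually-map (λ n → subst (seq x n ℚ.<_) (sym (ℚ.+-identityˡ e))) ]′ (located x (½*e<e 0<e))

Positive-summand : ∀ {x y} → Positive (x + y) → Positive x ⊎ Positive y
Positive-summand {x} {y} (mkPositive {e} 0<e e<x+y) = Sum.map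
  (mkPositive (0<½*e (0<½*e 0<e)))
  (λ x<½e → mkPositive (0<½*e 0<e) (eventually-zip
    (λ n e<x+y x<½e → <-resp-difference (ℚ.+-mono-< e<x+y x<½e)
      (solve 3 (λ x y e → y :- con ½ :* e := ((x :+ y) :+ con ½ :* e) :- (e :+ x))
         refl (seq x n) (seq y n) e))
    e<x+y x<½e))
  (located x (½*e<e (0<½*e 0<e)))
  where open ℚ-Solver

¬Positive-difference⇒≲ : ∀ {x y} → ¬ Positive (x + - y) → x ≲ y
¬Positive-difference⇒≲ {x} {y} ¬0<x-y = ≲-trans
  (≃⇒≲ (solve 2 (λ x y → x := (x :+ (:- y)) :+ y) ≃-refl x y))
  (≲-trans (+-mono-≲ (¬Positive⇒≲0 ¬0<x-y) ≲-refl) (≃⇒≲ (ℝ-ring.+-identityˡ y)))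
  where open ℝ-Solver

0≤⇒0≲ : ∀ {x} → 0ℝ ≤ x → 0ℝ ≲ x
0≤⇒0≲ {x} 0≤x = ¬Positive-difference⇒≲ λ (mkPositive {e} 0<e e<0-x) → 0≤x
  (e , 0<e , eventually-map (λ n e<0-x → <-resp-difference e<0-x
    (solve 2 (λ x e → con 0ℚ :- (x :+ e) := (con 0ℚ :- x) :- e) refl (seq x n) e)) e<0-x)
  where open ℚ-Solver

0≲⇒0≤ : ∀ {x} → 0ℝ ≲ x → 0ℝ ≤ x
0≲⇒0≤ 0≲x (e , 0<e , x+e<0) =
  let _ , 0<x+e , x+e<0 = eventually⇒∃ (eventually-both (approx 0≲x 0<e) x+e<0)
  in ℚ.<-irrefl refl (ℚ.<-trans 0<x+e x+e<0)

0≲x+y : ∀ {x y} → 0ℝ ≲ x → 0ℝ ≲ y → 0ℝ ≲ x + y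
0≲x+y 0≲x 0≲y = ≲-trans (≃⇒≲ (≃-sym (ℝ-ring.+-identityˡ 0ℝ))) (+-mono-≲ 0≲x 0≲y)

x≲x+y : ∀ x {y} → 0ℝ ≲ y → x ≲ x + y
x≲x+y x 0≲y = ≲-trans (≃⇒≲ (≃-sym (ℝ-ring.+-identityʳ x))) (+-mono-≲ ≲-refl 0≲y)

x≲y⇒0≲y-x : ∀ {x y} → x ≲ y → 0ℝ ≲ y + - x
x≲y⇒0≲y-x {x} x≲y = ≲-trans (≃⇒≲ (≃-sym (ℝ-ring.-‿inverseʳ x))) (+-mono-≲ x≲y ≲-refl)

x-y≲x : ∀ x {y} → 0ℝ ≲ y → x + - y ≲ x
x-y≲x x {y} 0≲y = ≲-respʳ-≃ (solve 2 (λ x y → (x :+ (:- y)) :+ y := x) ≃-refl x y) (x≲x+y (x + - y) 0≲y)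
  where open ℝ-Solver

halve : ℝ → ℝ
halve x = fromℚ ½ * x

0≲halve : ∀ {x} → 0ℝ ≲ x → 0ℝ ≲ halve x
0≲halve {x} 0≲x = mk≲ λ {e} 0<e → eventually-map
  (λ n 0<x+e → <-resp-difference (0<p+q (0<½*e 0<x+e) (0<½*e 0<e))
    (solve 2 (λ x e → (con ½ :* x :+ e) :- con 0ℚ := (con ½ :* (x :+ e) :+ con ½ :* e) :- con 0ℚ)
       refl (seq x n) e))
  (approx 0≲x 0<e)
  where open ℚ-Solver

halve≲x : ∀ {x} → 0ℝ ≲ x → halve x ≲ x
halve≲x {x} 0≲x = ≲-respʳ-≃ (solve 1 (λ x → con ½ :* x :+ con ½ :* x := x) ≃-refl x)
  (x≲x+y (halve x) (0≲halve 0≲x))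
  where open ℝ-Solver

0≲x*x : ∀ x → 0ℝ ≲ x * x
0≲x*x x = termwise-≲ λ n → 0≤p*p (seq x n)

-- Minimum

private
  opaque
    ⊓-cauchy : ∀ x y → Cauchy (λ n → seq x n ℚ.⊓ seq y n)
    ⊓-cauchy x y e 0<e =
      let M , xₘ≈xₙ = cauchy x e 0<e
          N , yₘ≈yₙ = cauchy y e 0<e
      in M ℕ.⊔ N , λ m n ≤m ≤n → Near⇒∣p-q∣<e (Near-⊓
        (∣p-q∣<e⇒Near {p = seq x m} {seq x n} (xₘ≈xₙ m n (ℕ.m⊔n≤o⇒m≤o M N ≤m) (ℕ.m⊔n≤o⇒m≤o M N ≤n)))
        (∣p-q∣<e⇒Near {p = seq y m} {seq y n} (yₘ≈yₙ m n (ℕ.m⊔n≤o⇒n≤o M N ≤m) (ℕ.m⊔n≤o⇒n≤o M N ≤n))))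

infixl 7 _⊓_

_⊓_ : ℝ → ℝ → ℝ
x ⊓ y = mkℝ (λ n → seq x n ℚ.⊓ seq y n) (⊓-cauchy x y)

⊓-continuous : Continuous₂ _⊓_
⊓-continuous x x′ {e} 0<e = e , 0<e , λ (mkClose x≈y) (mkClose x′≈y′) →
  mkClose (eventually-zip (λ _ → Near-⊓) x≈y x′≈y′)

⊓-cong : ∀ {x y x′ y′} → x ≃ y → x′ ≃ y′ → x ⊓ x′ ≃ y ⊓ y′
⊓-cong = continuous₂⇒cong ⊓-continuous

x⊓y≲x : ∀ x y → x ⊓ y ≲ x
x⊓y≲x x y = termwise-≲ λ n → ℚ.p⊓q≤p (seq x n) (seq y n)

x⊓y≲y : ∀ x y → x ⊓ y ≲ y
x⊓y≲y x y = termwise-≲ λ n → ℚ.p⊓q≤q (seq x n) (seq y n)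

0≲x⊓y : ∀ {x y} → 0ℝ ≲ x → 0ℝ ≲ y → 0ℝ ≲ x ⊓ y
0≲x⊓y {x} {y} 0≲x 0≲y = mk≲ λ {e} 0<e → eventually-zip
  (λ n 0<x+e 0<y+e → subst (0ℚ ℚ.<_) (sym (+-distribʳ-⊓ e (seq x n) (seq y n))) (⊓-mono-< 0<x+e 0<y+e))
  (approx 0≲x 0<e) (approx 0≲y 0<e)

[x+z]⊓[y+z]≃x⊓y+z : ∀ x y z → (x + z) ⊓ (y + z) ≃ x ⊓ y + z
[x+z]⊓[y+z]≃x⊓y+z x y z = termwise-≃ λ n → sym (+-distribʳ-⊓ (seq z n) (seq x n) (seq y n))

Positive-⊓ : ∀ {x y} → Positive x → Positive y → Positive (x ⊓ y)
Positive-⊓ (mkPositive {e} 0<e e<x) (mkPositive {f} 0<f f<y) =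
  mkPositive (⊓-mono-< 0<e 0<f) (eventually-zip (λ _ → ⊓-mono-<) e<x f<y)

Disjoint : ℝ → ℝ → Set
Disjoint x y = ¬ (Positive x × Positive y)

Disjoint-sym : ∀ {x y} → Disjoint x y → Disjoint y x
Disjoint-sym x∥y (0<y , 0<x) = x∥y (0<x , 0<y)

Disjoint-+ : ∀ {x y z} → Disjoint x z → Disjoint y z → Disjoint (x + y) z
Disjoint-+ x∥z y∥z (0<x+y , 0<z) =
  [ (λ 0<x → x∥z (0<x , 0<z)) , (λ 0<y → y∥z (0<y , 0<z)) ]′ (Positive-summand 0<x+y)

Disjoint-anti-mono : ∀ {x y x′ y′} → x ≲ x′ → y ≲ y′ → Disjoint x′ y′ → Disjoint x y
Disjoint-anti-mono x≲x′ y≲y′ x′∥y′ (0<x , 0<y) = x′∥y′ (Positive-mono x≲x′ 0<x , Positive-mono y≲y′ 0<y)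

disjoint⇒⊓≃0 : ∀ {x y} → 0ℝ ≲ x → 0ℝ ≲ y → Disjoint x y → x ⊓ y ≃ 0ℝ
disjoint⇒⊓≃0 {x} {y} 0≲x 0≲y x∥y = ≲-antisym
  (¬Positive⇒≲0 λ 0<x⊓y → x∥y (Positive-mono (x⊓y≲x x y) 0<x⊓y , Positive-mono (x⊓y≲y x y) 0<x⊓y))
  (0≲x⊓y 0≲x 0≲y)

disjoint-remainders : ∀ x y → Disjoint (x + - (x ⊓ y)) (y + - (x ⊓ y))
disjoint-remainders x y (0<x-m , 0<y-m) = ¬Positive-0 (Positive-resp-≃
  (≃-trans ([x+z]⊓[y+z]≃x⊓y+z x y (- (x ⊓ y))) (ℝ-ring.-‿inverseʳ (x ⊓ y)))
  (Positive-⊓ 0<x-m 0<y-m))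

infix 8 _⁺ _⁻

_⁺ _⁻ : ℝ → ℝ
x ⁺ = x + - (x ⊓ 0ℝ)
x ⁻ = - (x ⊓ 0ℝ)

⁺-continuous : Continuous₁ _⁺
⁺-continuous x {e} 0<e = ½ ℚ.* e , 0<½*e 0<e , λ {y} (mkClose x≈y) → mkClose (eventually-map
  (λ n near → subst (λ e → Near e (seq (x ⁺) n) (seq (y ⁺) n)) (½*e+½*e≡e e)
    (Near-+ near (Near-neg (Near-⊓ near (Near-refl (0<½*e 0<e)))))) x≈y)

⁻-continuous : Continuous₁ _⁻
⁻-continuous x {e} 0<e = e , 0<e , λ (mkClose x≈y) → mkClose (eventually-map
  (λ n near → Near-neg (Near-⊓ near (Near-refl 0<e))) x≈y)

x⁺-x⁻≃x : ∀ x → x ⁺ + - (x ⁻) ≃ x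
x⁺-x⁻≃x x = solve 2 (λ x m → (x :+ (:- m)) :+ (:- (:- m)) := x) ≃-refl x (x ⊓ 0ℝ)
  where open ℝ-Solver

0≲x⁺ : ∀ x → 0ℝ ≲ x ⁺
0≲x⁺ x = x≲y⇒0≲y-x (x⊓y≲x x 0ℝ)

0≲x⁻ : ∀ x → 0ℝ ≲ x ⁻
0≲x⁻ x = ≲-respʳ-≃ (ℝ-ring.+-identityˡ (x ⁻)) (x≲y⇒0≲y-x (x⊓y≲y x 0ℝ))

module _ {p q : ℝ} (0≲p : 0ℝ ≲ p) (0≲q : 0ℝ ≲ q) (p∥q : Disjoint p q) where

  ⁻-difference : (p + - q) ⁻ ≃ q
  ⁻-difference = begin
    - ((p + - q) ⊓ 0ℝ)          ≈⟨ -‿cong (⊓-cong ≃-refl (≃-sym (ℝ-ring.-‿inverseʳ q))) ⟩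
    - ((p + - q) ⊓ (q + - q))   ≈⟨ -‿cong ([x+z]⊓[y+z]≃x⊓y+z p q (- q)) ⟩
    - (p ⊓ q + - q)             ≈⟨ -‿cong (+-cong (disjoint⇒⊓≃0 0≲p 0≲q p∥q) ≃-refl) ⟩
    - (0ℝ + - q)                ≈⟨ solve 1 (λ q → :- (con 0ℚ :+ (:- q)) := q) ≃-refl q ⟩
    q                           ∎
    where
    open ≃-Reasoning
    open ℝ-Solver

  ⁺-difference : (p + - q) ⁺ ≃ p
  ⁺-difference = begin
    (p + - q) + (p + - q) ⁻   ≈⟨ +-cong ≃-refl ⁻-difference ⟩
    (p + - q) + q             ≈⟨ solve 2 (λ p q → (p :+ (:- q)) :+ q := p) ≃-refl p q ⟩
    p                         ∎
    where
    open ≃-Reasoning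
    open ℝ-Solver

0≲⇒⁺≃ : ∀ {x} → 0ℝ ≲ x → x ⁺ ≃ x
0≲⇒⁺≃ {x} 0≲x = begin
  x + - (x ⊓ 0ℝ)   ≈⟨ +-cong ≃-refl (-‿cong (disjoint⇒⊓≃0 0≲x ≲-refl (¬Positive-0 ∘ proj₂))) ⟩
  x + - 0ℝ         ≈⟨ solve 1 (λ x → x :+ (:- con 0ℚ) := x) ≃-refl x ⟩
  x                ∎
  where
  open ≃-Reasoning
  open ℝ-Solver

x⁺*x⁻≃0 : ∀ x → x ⁺ * x ⁻ ≃ 0ℝ
x⁺*x⁻≃0 x = termwise-≃ λ n → by-selection (seq x n) (ℚ.⊓-sel (seq x n) 0ℚ)
  where
  open ℚ-Solver
  by-selection : ∀ p → p ℚ.⊓ 0ℚ ≡ p ⊎ p ℚ.⊓ 0ℚ ≡ 0ℚ → (p ℚ.+ ℚ.- (p ℚ.⊓ 0ℚ)) ℚ.* (ℚ.- (p ℚ.⊓ 0ℚ)) ≡ 0ℚ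
  by-selection p (inj₁ eq) rewrite eq = solve 1 (λ p → (p :+ (:- p)) :* (:- p) := con 0ℚ) refl p
  by-selection p (inj₂ eq) rewrite eq = ℚ.*-zeroʳ (p ℚ.+ ℚ.- 0ℚ)

[x⁺]²∥[x⁻]² : ∀ x → Disjoint (x ⁺ * x ⁺) (x ⁻ * x ⁻)
[x⁺]²∥[x⁻]² x (0<[x⁺]² , 0<[x⁻]²) = ¬Positive-0 (Positive-resp-≃ (begin
  (x ⁺ * x ⁺) * (x ⁻ * x ⁻)   ≈⟨ solve 2 (λ p q → (p :* p) :* (q :* q) := (p :* q) :* (p :* q))
                                   ≃-refl (x ⁺) (x ⁻) ⟩
  (x ⁺ * x ⁻) * (x ⁺ * x ⁻)   ≈⟨ *-cong (x⁺*x⁻≃0 x) (x⁺*x⁻≃0 x) ⟩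
  0ℝ * 0ℝ                     ≈⟨ ℝ-ring.zeroˡ 0ℝ ⟩
  0ℝ                          ∎)
  (Positive-* 0<[x⁺]² 0<[x⁻]²))
  where
  open ≃-Reasoning
  open ℝ-Solver

[x⁺]²+[x⁻]²≃x² : ∀ x → x ⁺ * x ⁺ + x ⁻ * x ⁻ ≃ x * x
[x⁺]²+[x⁻]²≃x² x = begin
  x ⁺ * x ⁺ + x ⁻ * x ⁻
    ≈⟨ solve 2 (λ p q → p :* p :+ q :* q := (p :+ (:- q)) :* (p :+ (:- q)) :+ con 2ℚ :* (p :* q))
             ≃-refl (x ⁺) (x ⁻) ⟩
  (x ⁺ + - (x ⁻)) * (x ⁺ + - (x ⁻)) + fromℚ 2ℚ * (x ⁺ * x ⁻)
    ≈⟨ +-cong (*-cong (x⁺-x⁻≃x x) (x⁺-x⁻≃x x)) (*-cong ≃-refl (x⁺*x⁻≃0 x)) ⟩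
  x * x + fromℚ 2ℚ * 0ℝ
    ≈⟨ solve 1 (λ x → x :* x :+ con 2ℚ :* con 0ℚ := x :* x) ≃-refl x ⟩
  x * x ∎
  where
  open ≃-Reasoning
  open ℝ-Solver
  2ℚ : ℚ
  2ℚ = 1ℚ ℚ.+ 1ℚ

-- Square roots

δ : ℕ → ℚ
δ n = mkℚ (+ 1) n (Coprimality.1-coprimeTo (suc n))

0<δ : ∀ n → 0ℚ ℚ.< δ n
0<δ n = ℚ.positive⁻¹ (δ n)

δ-eventually-< : ∀ {e} → 0ℚ ℚ.< e → Eventually λ n → δ n ℚ.< e
δ-eventually-< {mkℚ (+ zero) d _}  (*<* (ℤ.+<+ ()))
δ-eventually-< {mkℚ (+ suc k) d _} _ = suc d , λ n d<n → *<* (ℤ.+<+ (ℕ.s≤s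
  (ℕ.≤-trans (ℕ.≤-reflexive (ℕ.+-identityʳ _)) (ℕ.≤-trans d<n (ℕ.m≤m+n n (k ℕ.* suc n))))))
δ-eventually-< {mkℚ -[1+ k ] d _}  (*<* ())

nat[1+n]*δ≡1 : ∀ n → nat (suc n) ℚ.* δ n ≡ 1ℚ
nat[1+n]*δ≡1 n = ≡.trans
  (cong (ℚ._* δ n) (ℚ.normalize-coprime {suc n} {0} (Coprimality.sym (Coprimality.1-coprimeTo (suc n)))))
  (ℚ.*-inverseˡ (δ n))

q≤nat∣↥q∣ : ∀ {q} → 0ℚ ℚ.≤ q → q ℚ.≤ nat ℤ.∣ ℚ.↥ q ∣
q≤nat∣↥q∣ {q@(mkℚ (+ a) d _)} _ = ℚ.toℚᵘ-cancel-≤ (begin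
  ℚᵘ.mkℚᵘ (+ a) d    ≤⟨ ℚᵘ.*≤* (ℤ.*-monoˡ-≤-nonNeg (+ a) (ℤ.+≤+ (ℕ.s≤s ℕ.z≤n))) ⟩
  ℚᵘ.mkℚᵘ (+ a) 0    ≃⟨ toℚᵘ-ι (+ a) ⟨
  ℚ.toℚᵘ (nat a)     ∎)
  where open ℚᵘ.≤-Reasoning
q≤nat∣↥q∣ {mkℚ -[1+ a ] d _} (*≤* ())

last-holding : ∀ {P : ℕ → Set} → Decidable P → P 0 → ∀ k → ¬ P k → ∃ λ j → P j × ¬ P (suc j)
last-holding P? P0 zero    ¬P0 = contradiction P0 ¬P0
last-holding P? P0 (suc k) ¬Pk+1 with P? k
... | yes Pk = k , Pk , ¬Pk+1
... | no ¬Pk = last-holding P? P0 k ¬Pk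

record ApproximateRoot (n : ℕ) (q : ℚ) : Set where
  field
    root       : ℚ
    0≤root     : 0ℚ ℚ.≤ root
    root²≤     : root ℚ.* root ℚ.≤ q
    <[root+δ]² : q ℚ.< (root ℚ.+ δ n) ℚ.* (root ℚ.+ δ n)

open ApproximateRoot

private
  grid : ℕ → ℕ → ℚ
  grid n k = nat k ℚ.* δ n

  grid-suc : ∀ n k → grid n (suc k) ≡ grid n k ℚ.+ δ n
  grid-suc n k = begin
    nat (suc k) ℚ.* δ n        ≡⟨ cong (ℚ._* δ n) (nat-homo-+ 1 k) ⟩
    (1ℚ ℚ.+ nat k) ℚ.* δ n     ≡⟨ solve 2 (λ k d → (con 1ℚ :+ k) :* d := k :* d :+ d) refl (nat k) (δ n) ⟩
    nat k ℚ.* δ n ℚ.+ δ n      ∎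
    where
    open ≡.≡-Reasoning
    open ℚ-Solver

  grid-* : ∀ n k → grid n (k ℕ.* suc n) ≡ nat k
  grid-* n k = begin
    nat (k ℕ.* suc n) ℚ.* δ n          ≡⟨ cong (ℚ._* δ n) (nat-homo-* k (suc n)) ⟩
    nat k ℚ.* nat (suc n) ℚ.* δ n      ≡⟨ ℚ.*-assoc (nat k) (nat (suc n)) (δ n) ⟩
    nat k ℚ.* (nat (suc n) ℚ.* δ n)    ≡⟨ cong (nat k ℚ.*_) (nat[1+n]*δ≡1 n) ⟩
    nat k ℚ.* 1ℚ                       ≡⟨ ℚ.*-identityʳ (nat k) ⟩
    nat k                              ∎
    where open ≡.≡-Reasoning

opaque
  approximateRoot : ∀ n q → 0ℚ ℚ.≤ q → ApproximateRoot n q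
  approximateRoot n q 0≤q =
    let k , k²≤q , [k+1]²≰q = last-holding (λ k → grid n k ℚ.* grid n k ℚ.≤? q) 0²≤q (K ℕ.* suc n) K²≰q
    in record
      { root       = grid n k
      ; 0≤root     = 0≤p*q (ι-mono-≤ {+ 0} {+ k} (ℤ.+≤+ ℕ.z≤n)) (ℚ.<⇒≤ (0<δ n))
      ; root²≤     = k²≤q
      ; <[root+δ]² = subst (λ r → q ℚ.< r ℚ.* r) (grid-suc n k) (ℚ.≰⇒> [k+1]²≰q)
      }
    where
    K : ℕ
    K = suc ℤ.∣ ℚ.↥ q ∣
    0²≤q : grid n 0 ℚ.* grid n 0 ℚ.≤ q
    0²≤q = subst (ℚ._≤ q) (sym (≡.trans (cong (ℚ._* grid n 0) (ℚ.*-zeroˡ (δ n))) (ℚ.*-zeroˡ (grid n 0)))) 0≤q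
    K²≰q : ¬ grid n (K ℕ.* suc n) ℚ.* grid n (K ℕ.* suc n) ℚ.≤ q
    K²≰q K²≤q = ℕ.<-irrefl refl (ℕ.≤-trans (ℕ.m≤m*n K K) (nat-cancel-≤ (begin
      nat (K ℕ.* K)                                   ≡⟨ nat-homo-* K K ⟩
      nat K ℚ.* nat K                                 ≡⟨ cong₂ ℚ._*_ (grid-* n K) (grid-* n K) ⟨
      grid n (K ℕ.* suc n) ℚ.* grid n (K ℕ.* suc n)   ≤⟨ K²≤q ⟩
      q                                               ≤⟨ q≤nat∣↥q∣ 0≤q ⟩
      nat ℤ.∣ ℚ.↥ q ∣                                 ∎)))
      where open ℚ.≤-Reasoning

root-mono : ∀ {m n p q e} → 0ℚ ℚ.< e → p ℚ.< q ℚ.+ e ℚ.* e →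
            (r : ApproximateRoot m p) (s : ApproximateRoot n q) → root r ℚ.< root s ℚ.+ (δ n ℚ.+ e)
root-mono {n = n} {p} {q} {e} 0<e p<q+e² r s = square-cancel-<
  (ℚ.+-mono-≤ (0≤root s) (ℚ.<⇒≤ (0<p+q (0<δ n) 0<e)))
  (begin-strict
    root r ℚ.* root r
      ≤⟨ root²≤ r ⟩
    p
      <⟨ p<q+e² ⟩
    q ℚ.+ e ℚ.* e
      <⟨ ℚ.+-monoˡ-< (e ℚ.* e) (<[root+δ]² s) ⟩
    t ℚ.* t ℚ.+ e ℚ.* e
      ≤⟨ ≤-resp-difference (0≤p*q 0≤t (ℚ.<⇒≤ (0<p+q 0<e 0<e)))
           (solve 3 (λ s d e → (s :+ (d :+ e)) :* (s :+ (d :+ e)) :- ((s :+ d) :* (s :+ d) :+ e :* e) :=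
                               (s :+ d) :* (e :+ e) :- con 0ℚ) refl (root s) (δ n) e) ⟩
    (root s ℚ.+ (δ n ℚ.+ e)) ℚ.* (root s ℚ.+ (δ n ℚ.+ e)) ∎)
  where
  open ℚ.≤-Reasoning
  open ℚ-Solver
  t : ℚ
  t = root s ℚ.+ δ n
  0≤t : 0ℚ ℚ.≤ t
  0≤t = ℚ.+-mono-≤ (0≤root s) (ℚ.<⇒≤ (0<δ n))

Near-root : ∀ {m n p q e} → 0ℚ ℚ.< e → δ m ℚ.< e → δ n ℚ.< e → Near (e ℚ.* e) p q →
            (r : ApproximateRoot m p) (s : ApproximateRoot n q) → Near (e ℚ.+ e) (root r) (root s)
Near-root {e = e} 0<e δm<e δn<e (p<q+e² , q<p+e²) r s =
  ℚ.<-trans (root-mono 0<e p<q+e² r s) (ℚ.+-monoʳ-< (root s) (ℚ.+-monoˡ-< e δn<e)) ,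
  ℚ.<-trans (root-mono 0<e q<p+e² s r) (ℚ.+-monoʳ-< (root r) (ℚ.+-monoˡ-< e δm<e))

-- √ x is the square root of x ⁺, which makes it total.
√-term : ∀ x n → ApproximateRoot n (seq (x ⁺) n)
√-term x n = approximateRoot n (seq (x ⁺) n) (≤-resp-difference (ℚ.p⊓q≤p p 0ℚ)
  (solve 2 (λ p m → (p :+ (:- m)) :- con 0ℚ := p :- m) refl p (p ℚ.⊓ 0ℚ)))
  where
  open ℚ-Solver
  p : ℚ
  p = seq x n

Near-√ : ∀ {m n x y e} → 0ℚ ℚ.< e → δ m ℚ.< ½ ℚ.* e → δ n ℚ.< ½ ℚ.* e →
         Near ((½ ℚ.* e) ℚ.* (½ ℚ.* e)) (seq (x ⁺) m) (seq (y ⁺) n) →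
         Near e (root (√-term x m)) (root (√-term y n))
Near-√ {m} {n} {x} {y} {e} 0<e δm<½e δn<½e near = subst
  (λ e → Near e (root (√-term x m)) (root (√-term y n))) (½*e+½*e≡e e)
  (Near-root (0<½*e 0<e) δm<½e δn<½e near (√-term x m) (√-term y n))

private
  opaque
    √-cauchy : ∀ x → Cauchy (λ n → root (√-term x n))
    √-cauchy x e 0<e =
      let M , xₘ≈xₙ = cauchy (x ⁺) ((½ ℚ.* e) ℚ.* (½ ℚ.* e)) (0<p*q (0<½*e 0<e) (0<½*e 0<e))
          N , δ<½e  = δ-eventually-< (0<½*e 0<e)
      in M ℕ.⊔ N , λ m n ≤m ≤n → Near⇒∣p-q∣<e (Near-√ {m} {n} {x} {x} 0<e
        (δ<½e m (ℕ.m⊔n≤o⇒n≤o M N ≤m)) (δ<½e n (ℕ.m⊔n≤o⇒n≤o M N ≤n))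
        (∣p-q∣<e⇒Near (xₘ≈xₙ m n (ℕ.m⊔n≤o⇒m≤o M N ≤m) (ℕ.m⊔n≤o⇒m≤o M N ≤n))))

δ-cauchy : Cauchy δ
δ-cauchy e 0<e =
  let N , δ<e = δ-eventually-< 0<e
  in N , λ m n N≤m N≤n → Near⇒∣p-q∣<e (δm<δn+e m n (δ<e m N≤m) , δm<δn+e n m (δ<e n N≤n))
  where
  δm<δn+e : ∀ m n → δ m ℚ.< e → δ m ℚ.< δ n ℚ.+ e
  δm<δn+e m n δm<e = subst (ℚ._< δ n ℚ.+ e) (ℚ.+-identityˡ (δ m)) (ℚ.+-mono-< (0<δ n) δm<e)

ω : ℝ
ω = mkℝ δ δ-cauchy

ω≃0 : ω ≃ 0ℝ
ω≃0 = ≲-antisym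
  (mk≲ λ {e} 0<e → eventually-map (λ n → subst (δ n ℚ.<_) (sym (ℚ.+-identityˡ e))) (δ-eventually-< 0<e))
  (termwise-≲ λ n → ℚ.<⇒≤ (0<δ n))

opaque
  √ : ℝ → ℝ
  √ x = mkℝ (λ n → root (√-term x n)) (√-cauchy x)

  √-continuous : Continuous₁ √
  √-continuous x {e} 0<e =
    let d , 0<d , ⁺-close = ⁺-continuous x (0<p*q (0<½*e 0<e) (0<½*e 0<e))
    in d , 0<d , λ {y} x≈y → mkClose (eventually-zip
      (λ n δ<½e near → Near-√ {n} {n} {x} {y} 0<e δ<½e δ<½e near)
      (δ-eventually-< (0<½*e 0<e)) (eventually-near (⁺-close x≈y)))

  0≲√ : ∀ x → 0ℝ ≲ √ x
  0≲√ x = termwise-≲ λ n → 0≤root (√-term x n)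

  √x*√x≃x⁺ : ∀ x → √ x * √ x ≃ x ⁺
  √x*√x≃x⁺ x = ≲-antisym
    (termwise-≲ λ n → root²≤ (√-term x n))
    (≲-trans {y = (√ x + ω) * (√ x + ω)} (termwise-≲ λ n → ℚ.<⇒≤ (<[root+δ]² (√-term x n)))
      (≃⇒≲ (*-cong {√ x + ω} {√ x} {√ x + ω} {√ x} √x+ω≃√x √x+ω≃√x)))
    where
    √x+ω≃√x : √ x + ω ≃ √ x
    √x+ω≃√x = ≃-trans (+-cong {√ x} {√ x} {ω} {0ℝ} ≃-refl ω≃0) (ℝ-ring.+-identityʳ (√ x))

√x*√x≃x : ∀ {x} → 0ℝ ≲ x → √ x * √ x ≃ x
√x*√x≃x {x} 0≲x = ≃-trans (√x*√x≃x⁺ x) (0≲⇒⁺≃ 0≲x)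

square-cancel-≲ : ∀ {x y} → 0ℝ ≲ y → x * x ≃ y * y → x ≲ y
square-cancel-≲ {x} {y} 0≲y x²≃y² = ¬Positive-difference⇒≲ λ 0<x-y →
  ¬Positive-0 (Positive-resp-≃ [x-y][x+y]≃0 (Positive-* 0<x-y (Positive-mono x-y≲x+y 0<x-y)))
  where
  open ≃-Reasoning
  open ℝ-Solver
  x-y≲x+y : x + - y ≲ x + - y + (y + y)
  x-y≲x+y = x≲x+y (x + - y) (0≲x+y 0≲y 0≲y)
  [x-y][x+y]≃0 : (x + - y) * (x + - y + (y + y)) ≃ 0ℝ
  [x-y][x+y]≃0 = begin
    (x + - y) * (x + - y + (y + y))
      ≈⟨ solve 2 (λ x y → (x :+ (:- y)) :* (x :+ (:- y) :+ (y :+ y)) := x :* x :+ (:- (y :* y))) ≃-refl x y ⟩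
    x * x + - (y * y)
      ≈⟨ +-cong x²≃y² ≃-refl ⟩
    y * y + - (y * y)
      ≈⟨ ℝ-ring.-‿inverseʳ (y * y) ⟩
    0ℝ ∎

square-injective : ∀ {x y} → 0ℝ ≲ x → 0ℝ ≲ y → x * x ≃ y * y → x ≃ y
square-injective 0≲x 0≲y x²≃y² = ≲-antisym (square-cancel-≲ 0≲y x²≃y²) (square-cancel-≲ 0≲x (≃-sym x²≃y²))

√[x*x]≃x : ∀ {x} → 0ℝ ≲ x → √ (x * x) ≃ x
√[x*x]≃x {x} 0≲x = square-injective (0≲√ (x * x)) 0≲x (√x*√x≃x {x * x} (0≲x*x x))

Positive-√⁻¹ : ∀ {x} → 0ℝ ≲ x → Positive (√ x) → Positive x
Positive-√⁻¹ 0≲x 0<√x = Positive-resp-≃ (√x*√x≃x 0≲x) (Positive-* 0<√x 0<√x)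

-- Homeomorphisms

Continuousⁿ : ∀ {m} → (Vector ℝ m → ℝ) → Set
Continuousⁿ f = ∀ x {e} → 0ℚ ℚ.< e → ∃ λ d → 0ℚ ℚ.< d ×
  (∀ {y} → (∀ i → Close d (x i) (y i)) → Close e (f x) (f y))

Close-weaken : ∀ {d e x y} → d ℚ.≤ e → Close d x y → Close e x y
Close-weaken d≤e (mkClose x≈y) = mkClose (eventually-map (λ _ → Near-weaken d≤e) x≈y)

coordinate-continuous : ∀ {m} (i : Fin m) → Continuousⁿ (λ x → x i)
coordinate-continuous i x {e} 0<e = e , 0<e , λ x≈y → x≈y i

constant-continuous : ∀ {m} c → Continuousⁿ {m} (λ _ → c)
constant-continuous c x {e} 0<e = e , 0<e , λ _ → close ≃-refl 0<e

∘-continuous : ∀ {m f} {g : Vector ℝ m → ℝ} → Continuous₁ f → Continuousⁿ g → Continuousⁿ (λ x → f (g x))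
∘-continuous {g = g} f-continuous g-continuous x 0<e =
  let d , 0<d , f-close = f-continuous (g x) 0<e
      c , 0<c , g-close = g-continuous x 0<d
  in c , 0<c , λ x≈y → f-close (g-close x≈y)

∘₂-continuous : ∀ {m _∙_} {f g : Vector ℝ m → ℝ} → Continuous₂ _∙_ → Continuousⁿ f → Continuousⁿ g →
                Continuousⁿ (λ x → f x ∙ g x)
∘₂-continuous {f = f} {g} ∙-continuous f-continuous g-continuous x 0<e =
  let d , 0<d , ∙-close = ∙-continuous (f x) (g x) 0<e
      b , 0<b , f-close = f-continuous x 0<d
      c , 0<c , g-close = g-continuous x 0<d
  in b ℚ.⊓ c , ⊓-mono-< 0<b 0<c , λ x≈y →
    ∙-close (f-close (Close-weaken (ℚ.p⊓q≤p b c) ∘ x≈y)) (g-close (Close-weaken (ℚ.p⊓q≤q b c) ∘ x≈y))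

reindex-continuous : ∀ {l m} {f : Vector ℝ l → ℝ} (π : Fin l → Fin m) →
                     Continuousⁿ f → Continuousⁿ (λ x → f (x ∘ π))
reindex-continuous π f-continuous x 0<e =
  let d , 0<d , f-close = f-continuous (x ∘ π) 0<e in d , 0<d , λ x≈y → f-close (x≈y ∘ π)

continuousⁿ⇒cong : ∀ {m} {f : Vector ℝ m → ℝ} → Continuousⁿ f → ∀ {x y} → (∀ i → x i ≃ y i) → f x ≃ f y
continuousⁿ⇒cong f-continuous {x} x≃y = mk≃ λ 0<e →
  let _ , 0<d , f-close = f-continuous x 0<e in f-close (λ i → close (x≃y i) 0<d)

Within⇒Close : ∀ {m d} {x y : Vector ℝ m} → Within (fromℚ d) x y → ∀ i → Close d (x i) (y i)
Within⇒Close {d = d} {x} {y} within i =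
  let (_ , 0<ε , x+ε<y+d) , (_ , 0<η , y+η<x+d) = within i
  in mkClose (eventually-zip (λ _ p q → ℚ.<-trans (p<p+e 0<ε) p , ℚ.<-trans (p<p+e 0<η) q) x+ε<y+d y+η<x+d)

Close⇒Within : ∀ {m e ε} {x y : Vector ℝ m} → 0ℚ ℚ.< e → Eventually (λ n → e ℚ.< seq ε n) →
               (∀ i → Close (½ ℚ.* e) (x i) (y i)) → Within ε x y
Close⇒Within {e = e} {ε} {x} {y} 0<e e<ε x≈y i =
  (½ ℚ.* e , 0<½*e 0<e ,
    eventually-zip (λ n near → gap (seq (x i) n) (seq (y i) n) (below near)) (eventually-near (x≈y i)) e<ε) ,
  (½ ℚ.* e , 0<½*e 0<e ,
    eventually-zip (λ n near → gap (seq (y i) n) (seq (x i) n) (above near)) (eventually-near (x≈y i)) e<ε)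
  where
  open ℚ-Solver
  gap : ∀ p q {r} → p ℚ.< q ℚ.+ ½ ℚ.* e → e ℚ.< r → p ℚ.+ ½ ℚ.* e ℚ.< q ℚ.+ r
  gap p q {r} p<q+½e e<r = <-resp-difference (ℚ.+-mono-< p<q+½e e<r)
    (solve 4 (λ p q r e → (q :+ r) :- (p :+ con ½ :* e) := ((q :+ con ½ :* e) :+ r) :- (p :+ e)) refl p q r e)

commonModulus : ∀ {m n} {f : Vector ℝ m → Vector ℝ n} → (∀ j → Continuousⁿ (λ x → f x j)) →
  ∀ x {e} → 0ℚ ℚ.< e → ∃ λ d → 0ℚ ℚ.< d ×
  (∀ {y} → (∀ i → Close d (x i) (y i)) → ∀ j → Close e (f x j) (f y j))
commonModulus {n = zero}  f-continuous x 0<e = 1ℚ , ℚ.positive⁻¹ 1ℚ , λ _ ()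
commonModulus {n = suc n} f-continuous x 0<e =
  let b , 0<b , f₀-close = f-continuous zero x 0<e
      c , 0<c , f₊-close = commonModulus (f-continuous ∘ suc) x 0<e
  in b ℚ.⊓ c , ⊓-mono-< 0<b 0<c , λ x≈y → λ
    { zero    → f₀-close (Close-weaken (ℚ.p⊓q≤p b c) ∘ x≈y)
    ; (suc j) → f₊-close (Close-weaken (ℚ.p⊓q≤q b c) ∘ x≈y) j }

module _ {m n} {P : Pred (Vector ℝ m) 0ℓ} {Q : Pred (Vector ℝ n) 0ℓ} (f : Vector ℝ m → Vector ℝ n)
         (f-maps : ∀ {x} → P x → Q (f x)) where

  restrict : Σ (Vector ℝ m) P → Σ (Vector ℝ n) Q
  restrict (x , Px) = f x , f-maps Px

  restrict-continuous : (∀ j → Continuousⁿ (λ x → f x j)) → Continuous {P = P} {Q = Q} restrict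
  restrict-continuous f-continuous (x , _) ε 0<ε =
    let mkPositive {e} 0<e e<ε = 0<⇒Positive {ε} 0<ε
        d , 0<d , f-close      = commonModulus f-continuous x (0<½*e {e} 0<e)
    in fromℚ d , Positive⇒0< (fromℚ-positive 0<d) , λ (y , _) within →
      Close⇒Within {ε = ε} {f x} {f y} 0<e e<ε (f-close (Within⇒Close {x = x} {y} within))

mkHomeomorphism : ∀ {m n} {P : Pred (Vector ℝ m) 0ℓ} {Q : Pred (Vector ℝ n) 0ℓ}
  (f : Vector ℝ m → Vector ℝ n) (g : Vector ℝ n → Vector ℝ m) →
  (∀ j → Continuousⁿ (λ x → f x j)) → (∀ i → Continuousⁿ (λ y → g y i)) →
  (∀ {x} → P x → Q (f x)) → (∀ {y} → Q y → P (g y)) →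
  (∀ {y} → Q y → ∀ j → f (g y) j ≃ y j) → (∀ {x} → P x → ∀ i → g (f x) i ≃ x i) → Homeomorphism P Q
mkHomeomorphism {P = P} {Q} f g f-continuous g-continuous f-maps g-maps f∘g≃id g∘f≃id = record
  { bijection = record
    { to        = restrict {P = P} {Q} f f-maps
    ; from      = restrict {P = Q} {P} g g-maps
    ; to-cong   = λ x≈y j → ≃⇒≈ (f-cong (≈⇒≃ ∘ x≈y) j)
    ; from-cong = λ x≈y i → ≃⇒≈ (g-cong (≈⇒≃ ∘ x≈y) i)
    ; inverse   =
      (λ {(_ , Qy)} x≈gy j → ≃⇒≈ (≃-trans (f-cong (≈⇒≃ ∘ x≈gy) j) (f∘g≃id Qy j))) ,
      (λ {(_ , Px)} y≈fx i → ≃⇒≈ (≃-trans (g-cong (≈⇒≃ ∘ y≈fx) i) (g∘f≃id Px i)))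
    }
  ; to-continuous   = restrict-continuous {P = P} {Q} f f-maps f-continuous
  ; from-continuous = restrict-continuous {P = Q} {P} g g-maps g-continuous
  }
  where
  f-cong : ∀ {x y} → (∀ i → x i ≃ y i) → ∀ j → f x j ≃ f y j
  f-cong x≃y j = continuousⁿ⇒cong (f-continuous j) x≃y
  g-cong : ∀ {x y} → (∀ j → x j ≃ y j) → ∀ i → g x i ≃ g y i
  g-cong x≃y i = continuousⁿ⇒cong (g-continuous i) x≃y

Homeomorphism-trans :
  ∀ {l m n} {P : Pred (Vector ℝ l) 0ℓ} {Q : Pred (Vector ℝ m) 0ℓ} {R : Pred (Vector ℝ n) 0ℓ} →
  Homeomorphism P Q → Homeomorphism Q R → Homeomorphism P R
Homeomorphism-trans P≅Q Q≅R = record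
  { bijection       = inverse P≅Q.bijection Q≅R.bijection
  ; to-continuous   = λ x ε 0<ε →
      let η , 0<η , within-η = Q≅R.to-continuous (P≅Q.to x) ε 0<ε
          δ , 0<δ , within-δ = P≅Q.to-continuous x η 0<η
      in δ , 0<δ , λ y within → within-η (P≅Q.to y) (within-δ y within)
  ; from-continuous = λ z ε 0<ε →
      let η , 0<η , within-η = P≅Q.from-continuous (Q≅R.from z) ε 0<ε
          δ , 0<δ , within-δ = Q≅R.from-continuous z η 0<η
      in δ , 0<δ , λ y within → within-η (Q≅R.from y) (within-δ y within)
  }
  where
  module P≅Q = Homeomorphism P≅Q
  module Q≅R = Homeomorphism Q≅R

-- Clique complexes

record Graph (n : ℕ) : Set where
  field
    adj    : Fin n → Fin n → Bool
    symm   : ∀ i j → adj i j ≡ adj j i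
    irrefl : ∀ i → adj i i ≡ false

  adjacent⇒≢ : ∀ {i j} → adj i j ≡ true → i ≢ j
  adjacent⇒≢ {i} ij refl = contradiction (≡.trans (sym ij) (irrefl i)) λ ()

  adjacent-sym : ∀ {i j} → adj i j ≡ true → adj j i ≡ true
  adjacent-sym {i} {j} ij = ≡.trans (symm j i) ij

open Graph

IsClique : ∀ {n} → Graph n → Subset n → Set
IsClique G σ = ∀ i j → i ∈ σ → j ∈ σ → i ≢ j → adj G i j ≡ true

isClique? : ∀ {n} (G : Graph n) → Decidable (IsClique G)
isClique? G σ = Fin.all? λ i → Fin.all? λ j →
  (i ∈? σ) →-dec ((j ∈? σ) →-dec (¬? (i Fin.≟ j) →-dec (adj G i j Bool.≟ true)))

cliqueComplex : ∀ {n} → Graph n → SimplicialComplex n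
cliqueComplex G = record
  { Face        = IsClique G
  ; face?       = isClique? G
  ; empty-face  = λ i j i∈∅ → contradiction i∈∅ ∉⊥
  ; vertex-face = λ v i j i∈v j∈v i≢j → contradiction (≡.trans (x∈⁅y⁆⇒x≡y v i∈v) (sym (x∈⁅y⁆⇒x≡y v j∈v))) i≢j
  ; down-closed = λ σ⊆τ clique i j i∈σ j∈σ → clique i j (σ⊆τ i∈σ) (σ⊆τ j∈σ)
  }

cliqueComplex-flag : ∀ {n} (G : Graph n) → Flag (cliqueComplex G)
cliqueComplex-flag G σ pairwise i j i∈σ j∈σ i≢j =
  proj₂ (pairwise i j i∈σ j∈σ i≢j) i j (x∈p∪q⁺ (inj₁ (x∈⁅x⁆ i))) (x∈p∪q⁺ (inj₂ (x∈⁅x⁆ j))) i≢j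

record CliqueSupported {n} (G : Graph n) (x : Vector ℝ n) : Set where
  field
    0≲x      : ∀ i → 0ℝ ≲ x i
    disjoint : ∀ i j → i ≢ j → adj G i j ≡ false → Disjoint (x i) (x j)

open CliqueSupported

realization⇒supported : ∀ {n} (G : Graph n) {x} → InRealization (cliqueComplex G) x → CliqueSupported G x
realization⇒supported G {x} (0≤x , _ , support-clique) = record
  { 0≲x      = λ i → 0≤⇒0≲ (0≤x i)
  ; disjoint = λ i j i≢j ij (0<xi , 0<xj) → contradiction
      (≡.trans (sym ij) (support-clique (⁅ i ⁆ ∪ ⁅ j ⁆) (positive 0<xi 0<xj) i j
        (x∈p∪q⁺ (inj₁ (x∈⁅x⁆ i))) (x∈p∪q⁺ (inj₂ (x∈⁅x⁆ j))) i≢j))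
      λ ()
  }
  where
  positive : ∀ {i j} → Positive (x i) → Positive (x j) → ∀ k → k ∈ ⁅ i ⁆ ∪ ⁅ j ⁆ → 0ℝ < x k
  positive {i} {j} 0<xi 0<xj k k∈ with x∈p∪q⁻ ⁅ i ⁆ ⁅ j ⁆ k∈
  ... | inj₁ k∈i rewrite x∈⁅y⁆⇒x≡y i k∈i = Positive⇒0< 0<xi
  ... | inj₂ k∈j rewrite x∈⁅y⁆⇒x≡y j k∈j = Positive⇒0< 0<xj

supported⇒realization : ∀ {n} (G : Graph n) {x} → CliqueSupported G x → Σℝ x ≃ 1ℝ →
                        InRealization (cliqueComplex G) x
supported⇒realization G {x} supported Σx≃1 =
  (λ i → 0≲⇒0≤ (0≲x supported i)) , ≃⇒≈ Σx≃1 , λ τ 0<x i j i∈τ j∈τ i≢j →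
    by-adjacency i j i≢j (0<x i i∈τ) (0<x j j∈τ) (adj G i j) refl
  where
  by-adjacency : ∀ i j → i ≢ j → 0ℝ < x i → 0ℝ < x j → ∀ b → adj G i j ≡ b → b ≡ true
  by-adjacency i j i≢j 0<xi 0<xj true  ij = refl
  by-adjacency i j i≢j 0<xi 0<xj false ij =
    contradiction (0<⇒Positive 0<xi , 0<⇒Positive 0<xj) (disjoint supported i j i≢j ij)

-- Cross-polytopes

∅ᴳ : Graph 0
∅ᴳ = record { adj = λ () ; symm = λ () ; irrefl = λ () }

old : ∀ {n} → Fin n → Fin (2 ℕ.+ n)
old i = suc (suc i)

suspension : ∀ {n} → Graph n → Graph (2 ℕ.+ n)
suspension {n} G = record { adj = adj′ ; symm = symm′ ; irrefl = irrefl′ }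
  where
  isOld : Fin (2 ℕ.+ n) → Bool
  isOld zero          = false
  isOld (suc zero)    = false
  isOld (suc (suc _)) = true
  adj′ : Fin (2 ℕ.+ n) → Fin (2 ℕ.+ n) → Bool
  adj′ (suc (suc i)) (suc (suc j)) = adj G i j
  adj′ (suc (suc i)) j             = true
  adj′ _             j             = isOld j
  symm′ : ∀ i j → adj′ i j ≡ adj′ j i
  symm′ zero          zero          = refl
  symm′ zero          (suc zero)    = refl
  symm′ zero          (suc (suc j)) = refl
  symm′ (suc zero)    zero          = refl
  symm′ (suc zero)    (suc zero)    = refl
  symm′ (suc zero)    (suc (suc j)) = refl
  symm′ (suc (suc i)) zero          = refl
  symm′ (suc (suc i)) (suc zero)    = refl
  symm′ (suc (suc i)) (suc (suc j)) = symm G i j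
  irrefl′ : ∀ i → adj′ i i ≡ false
  irrefl′ zero          = refl
  irrefl′ (suc zero)    = refl
  irrefl′ (suc (suc i)) = irrefl G i

crossPolytope : ∀ n → Graph (n ℕ.* 2)
crossPolytope zero    = ∅ᴳ
crossPolytope (suc n) = suspension (crossPolytope n)

toSphere : ∀ n → Vector ℝ (n ℕ.* 2) → Vector ℝ n
toSphere (suc n) x zero    = √ (x zero) + - √ (x (suc zero))
toSphere (suc n) x (suc k) = toSphere n (x ∘ old) k

fromSphere : ∀ n → Vector ℝ n → Vector ℝ (n ℕ.* 2)
fromSphere (suc n) z zero          = z zero ⁺ * z zero ⁺
fromSphere (suc n) z (suc zero)    = z zero ⁻ * z zero ⁻
fromSphere (suc n) z (suc (suc i)) = fromSphere n (z ∘ suc) i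

toSphere-continuous : ∀ n k → Continuousⁿ (λ x → toSphere n x k)
toSphere-continuous (suc n) zero    = ∘₂-continuous +-continuous
  (∘-continuous √-continuous (coordinate-continuous zero))
  (∘-continuous neg-continuous (∘-continuous √-continuous (coordinate-continuous (suc zero))))
toSphere-continuous (suc n) (suc k) = reindex-continuous old (toSphere-continuous n k)

fromSphere-continuous : ∀ n i → Continuousⁿ (λ z → fromSphere n z i)
fromSphere-continuous (suc n) zero          = ∘₂-continuous *-continuous
  (∘-continuous ⁺-continuous (coordinate-continuous zero))
  (∘-continuous ⁺-continuous (coordinate-continuous zero))
fromSphere-continuous (suc n) (suc zero)    = ∘₂-continuous *-continuous
  (∘-continuous ⁻-continuous (coordinate-continuous zero))
  (∘-continuous ⁻-continuous (coordinate-continuous zero))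
fromSphere-continuous (suc n) (suc (suc i)) = reindex-continuous suc (fromSphere-continuous n i)

toSphere∘fromSphere : ∀ n z k → toSphere n (fromSphere n z) k ≃ z k
toSphere∘fromSphere (suc n) z zero    = ≃-trans
  (+-cong (√[x*x]≃x (0≲x⁺ (z zero))) (-‿cong (√[x*x]≃x (0≲x⁻ (z zero))))) (x⁺-x⁻≃x (z zero))
toSphere∘fromSphere (suc n) z (suc k) = toSphere∘fromSphere n (z ∘ suc) k

Σ-fromSphere : ∀ n z → Σℝ (fromSphere n z) ≃ Σℝ (λ k → z k * z k)
Σ-fromSphere zero    z = ≃-refl
Σ-fromSphere (suc n) z = ≃-trans
  (≃-sym (ℝ-ring.+-assoc (z zero ⁺ * z zero ⁺) (z zero ⁻ * z zero ⁻) (Σℝ (fromSphere n (z ∘ suc)))))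
  (+-cong ([x⁺]²+[x⁻]²≃x² (z zero)) (Σ-fromSphere n (z ∘ suc)))

fromSphere-supported : ∀ n z → CliqueSupported (crossPolytope n) (fromSphere n z)
fromSphere-supported n z = record { 0≲x = nonnegative n z ; disjoint = antipodal n z }
  where
  nonnegative : ∀ n z i → 0ℝ ≲ fromSphere n z i
  nonnegative (suc n) z zero          = 0≲x*x (z zero ⁺)
  nonnegative (suc n) z (suc zero)    = 0≲x*x (z zero ⁻)
  nonnegative (suc n) z (suc (suc i)) = nonnegative n (z ∘ suc) i
  antipodal : ∀ n z i j → i ≢ j → adj (crossPolytope n) i j ≡ false →
              Disjoint (fromSphere n z i) (fromSphere n z j)
  antipodal (suc n) z zero          zero          0≢0 _ = contradiction refl 0≢0
  antipodal (suc n) z zero          (suc zero)    _   _ = [x⁺]²∥[x⁻]² (z zero)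
  antipodal (suc n) z (suc zero)    zero          _   _ = Disjoint-sym ([x⁺]²∥[x⁻]² (z zero))
  antipodal (suc n) z (suc zero)    (suc zero)    1≢1 _ = contradiction refl 1≢1
  antipodal (suc n) z (suc (suc i)) (suc (suc j)) i≢j ij = antipodal n (z ∘ suc) i j (i≢j ∘ cong old) ij

fromSphere∘toSphere : ∀ n {x} → CliqueSupported (crossPolytope n) x →
                      ∀ i → fromSphere n (toSphere n x) i ≃ x i
fromSphere∘toSphere (suc n) {x} supported = λ
  { zero          → ≃-trans (*-cong ⁺≃√x₀ ⁺≃√x₀) (√x*√x≃x (0≲x supported zero))
  ; (suc zero)    → ≃-trans (*-cong ⁻≃√x₁ ⁻≃√x₁) (√x*√x≃x (0≲x supported (suc zero)))
  ; (suc (suc i)) → fromSphere∘toSphere n (record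
      { 0≲x      = 0≲x supported ∘ old
      ; disjoint = λ i j i≢j →
          disjoint supported (old i) (old j) (i≢j ∘ Fin.suc-injective ∘ Fin.suc-injective)
      }) i
  }
  where
  √x₀∥√x₁ : Disjoint (√ (x zero)) (√ (x (suc zero)))
  √x₀∥√x₁ (0<√x₀ , 0<√x₁) = disjoint supported zero (suc zero) (λ ()) refl
    (Positive-√⁻¹ (0≲x supported zero) 0<√x₀ , Positive-√⁻¹ (0≲x supported (suc zero)) 0<√x₁)
  ⁺≃√x₀ : (√ (x zero) + - √ (x (suc zero))) ⁺ ≃ √ (x zero)
  ⁺≃√x₀ = ⁺-difference (0≲√ (x zero)) (0≲√ (x (suc zero))) √x₀∥√x₁
  ⁻≃√x₁ : (√ (x zero) + - √ (x (suc zero))) ⁻ ≃ √ (x (suc zero))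
  ⁻≃√x₁ = ⁻-difference (0≲√ (x zero)) (0≲√ (x (suc zero))) √x₀∥√x₁

crossPolytope-sphere : ∀ d → Homeomorphism (InRealization (cliqueComplex (crossPolytope (suc d)))) (Sphere d)
crossPolytope-sphere d = mkHomeomorphism f (fromSphere (suc d))
  (toSphere-continuous (suc d)) (fromSphere-continuous (suc d))
  (λ {x} real → ≃⇒≈ (f-unit x real))
  (λ {z} z∈Sᵈ → supported⇒realization P (fromSphere-supported (suc d) z)
    (≃-trans (Σ-fromSphere (suc d) z) (≈⇒≃ z∈Sᵈ)))
  (λ {z} _ → toSphere∘fromSphere (suc d) z)
  (λ {x} real → fromSphere∘toSphere (suc d) (realization⇒supported P {x} real))
  where
  open ≃-Reasoning
  P : Graph (suc d ℕ.* 2)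
  P = crossPolytope (suc d)
  f : Vector ℝ (suc d ℕ.* 2) → Vector ℝ (suc d)
  f = toSphere (suc d)
  f-unit : ∀ x → InRealization (cliqueComplex P) x → Σℝ (λ k → f x k * f x k) ≃ 1ℝ
  f-unit x real@(_ , Σx≈1 , _) = begin
    Σℝ (λ k → f x k * f x k)
      ≈⟨ Σ-fromSphere (suc d) (f x) ⟨
    Σℝ (fromSphere (suc d) (f x))
      ≈⟨ Σℝ-cong (fromSphere∘toSphere (suc d) (realization⇒supported P {x} real)) ⟩
    Σℝ x
      ≈⟨ ≈⇒≃ Σx≈1 ⟩
    1ℝ ∎

-- Edge subdivision

_==_ : ∀ {n} → Fin n → Fin n → Bool
i == j = does (i Fin.≟ j)

==-refl : ∀ {n} (i : Fin n) → (i == i) ≡ true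
==-refl i = dec-true (i Fin.≟ i) refl

≢⇒==-false : ∀ {n} {i j : Fin n} → i ≢ j → (i == j) ≡ false
≢⇒==-false {i = i} {j} = dec-false (i Fin.≟ j)

separated-by : ∀ {A : Set} (f : A → Bool) {x y} → f x ≡ true → f y ≡ false → x ≢ y
separated-by f fx fy refl = contradiction (≡.trans (sym fx) fy) λ ()

∧-false⁻ : ∀ a {b} → a ∧ b ≡ false → a ≡ false ⊎ b ≡ false
∧-false⁻ false _       = inj₁ refl
∧-false⁻ true  b≡false = inj₂ b≡false

χ : Bool → ℚ
χ b = if b then 1ℚ else 0ℚ

indicator : Bool → ℝ
indicator b = fromℚ (χ b)

Σ-indicator : ∀ {n} (a : Fin n) → Σℝ (λ i → indicator (i == a)) ≃ 1ℝ
Σ-indicator {suc n} zero    = ≃-trans (+-cong ≃-refl (sum-replicate-zero n)) (ℝ-ring.+-identityʳ 1ℝ)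
Σ-indicator {suc n} (suc a) = ≃-trans (ℝ-ring.+-identityˡ _) (Σ-indicator a)

module Subdivision {n} (G : Graph n) {u v : Fin n} (uv : adj G u v ≡ true) where

  data EdgeView : Fin n → Set where
    at-u : EdgeView u
    at-v : EdgeView v
    away : ∀ {i} → i ≢ u → i ≢ v → EdgeView i

  edgeView : ∀ i → EdgeView i
  edgeView i with i Fin.≟ u | i Fin.≟ v
  ... | yes refl | _        = at-u
  ... | no _     | yes refl = at-v
  ... | no i≢u   | no i≢v   = away i≢u i≢v

  u≢v : u ≢ v
  u≢v = adjacent⇒≢ G uv

  isEdge : Fin n → Fin n → Bool
  isEdge i j = ((i == u) ∧ (j == v)) ∨ ((i == v) ∧ (j == u))

  isEdge-sym : ∀ i j → isEdge i j ≡ isEdge j i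
  isEdge-sym i j = ≡.trans (∨-comm ((i == u) ∧ (j == v)) ((i == v) ∧ (j == u)))
    (cong₂ _∨_ (∧-comm (i == v) (j == u)) (∧-comm (i == u) (j == v)))

  withoutEdge : Graph n
  withoutEdge = record
    { adj    = λ i j → adj G i j ∧ not (isEdge i j)
    ; symm   = λ i j → cong₂ (λ a b → a ∧ not b) (symm G i j) (isEdge-sym i j)
    ; irrefl = λ i → cong (_∧ not (isEdge i i)) (irrefl G i)
    }

  nearEdge : Fin n → Bool
  nearEdge i = ((i == u) ∨ (i == v)) ∨ (adj G u i ∧ adj G v i)

  subdivision : Graph (suc n)
  subdivision = record
    { adj    = λ
      { zero    zero    → false
      ; zero    (suc j) → nearEdge j
      ; (suc i) zero    → nearEdge i
      ; (suc i) (suc j) → adj withoutEdge i j }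
    ; symm   = λ
      { zero    zero    → refl
      ; zero    (suc j) → refl
      ; (suc i) zero    → refl
      ; (suc i) (suc j) → symm withoutEdge i j }
    ; irrefl = λ { zero → refl ; (suc i) → irrefl withoutEdge i }
    }

  isEdge-u : ∀ j → isEdge u j ≡ (j == v)
  isEdge-u j rewrite ==-refl u | ≢⇒==-false u≢v = ∨-identityʳ (j == v)

  withoutEdge-uv : adj withoutEdge u v ≡ false
  withoutEdge-uv rewrite isEdge-u v | ==-refl v = ∧-zeroʳ (adj G u v)

  withoutEdge-awayˡ : ∀ {i} j → i ≢ u → i ≢ v → adj withoutEdge i j ≡ adj G i j
  withoutEdge-awayˡ {i} j i≢u i≢v rewrite ≢⇒==-false i≢u | ≢⇒==-false i≢v = ∧-identityʳ (adj G i j)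

  withoutEdge-awayʳ : ∀ i {j} → j ≢ u → j ≢ v → adj withoutEdge i j ≡ adj G i j
  withoutEdge-awayʳ i {j} j≢u j≢v =
    ≡.trans (symm withoutEdge i j) (≡.trans (withoutEdge-awayˡ i j≢u j≢v) (symm G j i))

  withoutEdge-≢u : ∀ {i j} → i ≢ u → j ≢ u → adj withoutEdge i j ≡ adj G i j
  withoutEdge-≢u {i} {j} i≢u j≢u rewrite ≢⇒==-false i≢u | ≢⇒==-false j≢u | ∧-zeroʳ (i == v) =
    ∧-identityʳ (adj G i j)

  withoutEdge-≢v : ∀ {i j} → i ≢ v → j ≢ v → adj withoutEdge i j ≡ adj G i j
  withoutEdge-≢v {i} {j} i≢v j≢v rewrite ≢⇒==-false i≢v | ≢⇒==-false j≢v | ∧-zeroʳ (i == u) =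
    ∧-identityʳ (adj G i j)

  nearEdge-u : nearEdge u ≡ true
  nearEdge-u rewrite ==-refl u = refl

  nearEdge-v : nearEdge v ≡ true
  nearEdge-v rewrite ==-refl v | ∨-zeroʳ (v == u) = refl

  nearEdge-away : ∀ {i} → i ≢ u → i ≢ v → nearEdge i ≡ adj G u i ∧ adj G v i
  nearEdge-away i≢u i≢v rewrite ≢⇒==-false i≢u | ≢⇒==-false i≢v = refl

module SubdivisionHomeomorphism {n} (G : Graph n) {u v : Fin n} (uv : adj G u v ≡ true) where
  open Subdivision G uv

  private
    onEdge : Fin n → ℝ
    onEdge i = indicator (i == u) + indicator (i == v)

    shift : Vector ℝ n → ℝ → Vector ℝ n
    shift y q i = y i + onEdge i * q

    shift-u : ∀ y q → shift y q u ≃ y u + q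
    shift-u y q rewrite ==-refl u | ≢⇒==-false u≢v =
      solve 2 (λ y q → y :+ (con 1ℚ :+ con 0ℚ) :* q := y :+ q) ≃-refl (y u) q
      where open ℝ-Solver

    shift-v : ∀ y q → shift y q v ≃ y v + q
    shift-v y q rewrite ==-refl v | ≢⇒==-false (u≢v ∘ sym) =
      solve 2 (λ y q → y :+ (con 0ℚ :+ con 1ℚ) :* q := y :+ q) ≃-refl (y v) q
      where open ℝ-Solver

    shift-away : ∀ y q {i} → i ≢ u → i ≢ v → shift y q i ≃ y i
    shift-away y q {i} i≢u i≢v rewrite ≢⇒==-false i≢u | ≢⇒==-false i≢v =
      solve 2 (λ y q → y :+ (con 0ℚ :+ con 0ℚ) :* q := y) ≃-refl (y i) q
      where open ℝ-Solver

    Σ-onEdge : Σℝ onEdge ≃ 1ℝ + 1ℝ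
    Σ-onEdge = ≃-trans (∑-distrib-+ (λ i → indicator (i == u)) (λ i → indicator (i == v)))
      (+-cong (Σ-indicator u) (Σ-indicator v))

    Σ-shift : ∀ y q → Σℝ (shift y q) ≃ Σℝ y + (q + q)
    Σ-shift y q = begin
      Σℝ (shift y q)                   ≈⟨ ∑-distrib-+ y (λ i → onEdge i * q) ⟩
      Σℝ y + Σℝ (λ i → onEdge i * q)   ≈⟨ +-cong ≃-refl (*-distribʳ-sum q onEdge) ⟨
      Σℝ y + Σℝ onEdge * q             ≈⟨ +-cong ≃-refl (*-cong Σ-onEdge ≃-refl) ⟩
      Σℝ y + (1ℝ + 1ℝ) * q             ≈⟨ solve 2 (λ s q → s :+ (con 1ℚ :+ con 1ℚ) :* q := s :+ (q :+ q))
                                            ≃-refl (Σℝ y) q ⟩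
      Σℝ y + (q + q)                   ∎
      where
      open ≃-Reasoning
      open ℝ-Solver

    shift-continuous : ∀ {m} {y : Vector ℝ m → Vector ℝ n} {q : Vector ℝ m → ℝ} →
      (∀ i → Continuousⁿ (λ x → y x i)) → Continuousⁿ q → ∀ i → Continuousⁿ (λ x → shift (y x) (q x) i)
    shift-continuous y-continuous q-continuous i = ∘₂-continuous +-continuous (y-continuous i)
      (∘₂-continuous *-continuous (constant-continuous (onEdge i)) q-continuous)

  -- The new vertex is the midpoint of the edge.
  merge : Vector ℝ (suc n) → Vector ℝ n
  merge x = shift (x ∘ suc) (halve (x zero))

  common : Vector ℝ n → ℝ
  common y = y u ⊓ y v

  split : Vector ℝ n → Vector ℝ (suc n)
  split y zero    = common y + common y
  split y (suc i) = shift y (- common y) i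

  common-continuous : Continuousⁿ common
  common-continuous = ∘₂-continuous ⊓-continuous (coordinate-continuous u) (coordinate-continuous v)

  merge-continuous : ∀ i → Continuousⁿ (λ x → merge x i)
  merge-continuous = shift-continuous (λ i → coordinate-continuous (suc i))
    (∘₂-continuous *-continuous (constant-continuous (fromℚ ½)) (coordinate-continuous zero))

  split-continuous : ∀ i → Continuousⁿ (λ y → split y i)
  split-continuous zero    = ∘₂-continuous +-continuous common-continuous common-continuous
  split-continuous (suc i) =
    shift-continuous coordinate-continuous (∘-continuous neg-continuous common-continuous) i

  Σ-merge : ∀ x → Σℝ (merge x) ≃ Σℝ x
  Σ-merge x = ≃-trans (Σ-shift (x ∘ suc) (halve (x zero)))
    (solve 2 (λ s z → s :+ (con ½ :* z :+ con ½ :* z) := z :+ s) ≃-refl (Σℝ (x ∘ suc)) (x zero))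
    where open ℝ-Solver

  Σ-split : ∀ y → Σℝ (split y) ≃ Σℝ y
  Σ-split y = ≃-trans (+-cong ≃-refl (Σ-shift y (- common y)))
    (solve 2 (λ s m → (m :+ m) :+ (s :+ ((:- m) :+ (:- m))) := s) ≃-refl (Σℝ y) (common y))
    where open ℝ-Solver

  merge∘split : ∀ y i → merge (split y) i ≃ y i
  merge∘split y i = solve 3 (λ y c m → (y :+ c :* (:- m)) :+ c :* (con ½ :* (m :+ m)) := y)
    ≃-refl (y i) (onEdge i) (common y)
    where open ℝ-Solver

  module _ {x : Vector ℝ (suc n)} (supported : CliqueSupported subdivision x) where
    private
      z : ℝ
      z = halve (x zero)

      merge-u : merge x u ≃ x (suc u) + z
      merge-u = shift-u (x ∘ suc) z

      merge-v : merge x v ≃ x (suc v) + z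
      merge-v = shift-v (x ∘ suc) z

      merge-away : ∀ {i} → i ≢ u → i ≢ v → merge x i ≃ x (suc i)
      merge-away = shift-away (x ∘ suc) z

      0≲z : 0ℝ ≲ z
      0≲z = 0≲halve (0≲x supported zero)

    0≲merge : ∀ {i} → EdgeView i → 0ℝ ≲ merge x i
    0≲merge at-u               = ≲-respʳ-≃ (≃-sym merge-u) (0≲x+y (0≲x supported (suc u)) 0≲z)
    0≲merge at-v               = ≲-respʳ-≃ (≃-sym merge-v) (0≲x+y (0≲x supported (suc v)) 0≲z)
    0≲merge (away {i} i≢u i≢v) = ≲-respʳ-≃ (≃-sym (merge-away i≢u i≢v)) (0≲x supported (suc i))

    merge-disjoint-endpoint : ∀ {a j} → merge x a ≃ x (suc a) + z → a ≢ j → j ≢ u → j ≢ v →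
      adj G a j ≡ false → nearEdge j ≡ false → Disjoint (merge x a) (merge x j)
    merge-disjoint-endpoint {a} {j} a≃ a≢j j≢u j≢v aj j-far =
      Disjoint-anti-mono (≃⇒≲ a≃) (≃⇒≲ (merge-away j≢u j≢v)) (Disjoint-+
        (disjoint supported (suc a) (suc j) (a≢j ∘ Fin.suc-injective)
          (≡.trans (withoutEdge-awayʳ a j≢u j≢v) aj))
        (Disjoint-anti-mono (halve≲x (0≲x supported zero)) ≲-refl
          (disjoint supported zero (suc j) (λ ()) j-far)))

    merge-disjoint : ∀ {i j} → EdgeView i → EdgeView j → i ≢ j → adj G i j ≡ false →
                     Disjoint (merge x i) (merge x j)
    merge-disjoint at-u at-u i≢j _  = contradiction refl i≢j
    merge-disjoint at-v at-v i≢j _  = contradiction refl i≢j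
    merge-disjoint at-u at-v _   ij = contradiction (≡.trans (sym uv) ij) λ ()
    merge-disjoint at-v at-u _   ij = contradiction (≡.trans (sym (adjacent-sym G uv)) ij) λ ()
    merge-disjoint at-u (away {j} j≢u j≢v) u≢j uj = merge-disjoint-endpoint merge-u u≢j j≢u j≢v uj
      (≡.trans (nearEdge-away j≢u j≢v) (cong (_∧ adj G v j) uj))
    merge-disjoint at-v (away {j} j≢u j≢v) v≢j vj = merge-disjoint-endpoint merge-v v≢j j≢u j≢v vj
      (≡.trans (nearEdge-away j≢u j≢v) (≡.trans (cong (adj G u j ∧_) vj) (∧-zeroʳ (adj G u j))))
    merge-disjoint i-view@(away {i} _ _) at-u i≢u iu =
      Disjoint-sym (merge-disjoint at-u i-view (i≢u ∘ sym) (≡.trans (symm G u i) iu))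
    merge-disjoint i-view@(away {i} _ _) at-v i≢v iv =
      Disjoint-sym (merge-disjoint at-v i-view (i≢v ∘ sym) (≡.trans (symm G v i) iv))
    merge-disjoint (away {i} i≢u i≢v) (away {j} j≢u j≢v) i≢j ij =
      Disjoint-anti-mono (≃⇒≲ (merge-away i≢u i≢v)) (≃⇒≲ (merge-away j≢u j≢v))
        (disjoint supported (suc i) (suc j) (i≢j ∘ Fin.suc-injective)
          (≡.trans (withoutEdge-awayˡ j i≢u i≢v) ij))

    merge-supported : CliqueSupported G (merge x)
    merge-supported = record
      { 0≲x      = λ i → 0≲merge (edgeView i)
      ; disjoint = λ i j → merge-disjoint (edgeView i) (edgeView j)
      }

    common-merge : common (merge x) ≃ z
    common-merge = begin
      merge x u ⊓ merge x v                ≈⟨ ⊓-cong merge-u merge-v ⟩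
      (x (suc u) + z) ⊓ (x (suc v) + z)    ≈⟨ [x+z]⊓[y+z]≃x⊓y+z (x (suc u)) (x (suc v)) z ⟩
      x (suc u) ⊓ x (suc v) + z            ≈⟨ +-cong xᵤ⊓xᵥ≃0 ≃-refl ⟩
      0ℝ + z                               ≈⟨ ℝ-ring.+-identityˡ z ⟩
      z                                    ∎
      where
      open ≃-Reasoning
      xᵤ⊓xᵥ≃0 : x (suc u) ⊓ x (suc v) ≃ 0ℝ
      xᵤ⊓xᵥ≃0 = disjoint⇒⊓≃0 (0≲x supported (suc u)) (0≲x supported (suc v))
        (disjoint supported (suc u) (suc v) (u≢v ∘ Fin.suc-injective) withoutEdge-uv)

    split∘merge : ∀ i → split (merge x) i ≃ x i
    split∘merge zero    = ≃-trans (+-cong common-merge common-merge)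
      (solve 1 (λ z → con ½ :* z :+ con ½ :* z := z) ≃-refl (x zero))
      where open ℝ-Solver
    split∘merge (suc i) = ≃-trans (+-cong ≃-refl (*-cong ≃-refl (-‿cong common-merge)))
      (solve 3 (λ x c h → (x :+ c :* h) :+ c :* (:- h) := x) ≃-refl (x (suc i)) (onEdge i) z)
      where open ℝ-Solver

  module _ {y : Vector ℝ n} (supported : CliqueSupported G y) where
    private
      split-u : split y (suc u) ≃ y u + - common y
      split-u = shift-u y (- common y)

      split-v : split y (suc v) ≃ y v + - common y
      split-v = shift-v y (- common y)

      split-away : ∀ {i} → i ≢ u → i ≢ v → split y (suc i) ≃ y i
      split-away = shift-away y (- common y)

      0≲common : 0ℝ ≲ common y
      0≲common = 0≲x⊓y (0≲x supported u) (0≲x supported v)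

    0≲split : ∀ {i} → EdgeView i → 0ℝ ≲ split y (suc i)
    0≲split at-u               = ≲-respʳ-≃ (≃-sym split-u) (x≲y⇒0≲y-x (x⊓y≲x (y u) (y v)))
    0≲split at-v               = ≲-respʳ-≃ (≃-sym split-v) (x≲y⇒0≲y-x (x⊓y≲y (y u) (y v)))
    0≲split (away {i} i≢u i≢v) = ≲-respʳ-≃ (≃-sym (split-away i≢u i≢v)) (0≲x supported i)

    split≲ : ∀ {i} → EdgeView i → split y (suc i) ≲ y i
    split≲ at-u           = ≲-trans (≃⇒≲ split-u) (x-y≲x (y u) 0≲common)
    split≲ at-v           = ≲-trans (≃⇒≲ split-v) (x-y≲x (y v) 0≲common)
    split≲ (away i≢u i≢v) = ≃⇒≲ (split-away i≢u i≢v)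

    common-disjoint : ∀ {a j} → common y ≲ y a → a ≢ j → EdgeView j → adj G a j ≡ false →
                      Disjoint (split y zero) (split y (suc j))
    common-disjoint {a} {j} common≲ya a≢j j-view aj =
      Disjoint-anti-mono ≲-refl (split≲ j-view) (Disjoint-+ common∥yj common∥yj)
      where
      common∥yj : Disjoint (common y) (y j)
      common∥yj = Disjoint-anti-mono common≲ya ≲-refl (disjoint supported a j a≢j aj)

    split-disjoint-new : ∀ {j} → EdgeView j → nearEdge j ≡ false → Disjoint (split y zero) (split y (suc j))
    split-disjoint-new at-u u-far = contradiction (≡.trans (sym nearEdge-u) u-far) λ ()
    split-disjoint-new at-v v-far = contradiction (≡.trans (sym nearEdge-v) v-far) λ ()
    split-disjoint-new j-view@(away {j} j≢u j≢v) j-far = [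
      common-disjoint (x⊓y≲x (y u) (y v)) (j≢u ∘ sym) j-view ,
      common-disjoint (x⊓y≲y (y u) (y v)) (j≢v ∘ sym) j-view ]′
      (∧-false⁻ (adj G u j) (≡.trans (sym (nearEdge-away j≢u j≢v)) j-far))

    split-disjoint-ends : Disjoint (split y (suc u)) (split y (suc v))
    split-disjoint-ends = Disjoint-anti-mono (≃⇒≲ split-u) (≃⇒≲ split-v) (disjoint-remainders (y u) (y v))

    split-disjoint-old : ∀ {i j} → EdgeView i → EdgeView j → i ≢ j → adj withoutEdge i j ≡ false →
                         Disjoint (split y (suc i)) (split y (suc j))
    split-disjoint-old at-u at-u i≢j _ = contradiction refl i≢j
    split-disjoint-old at-v at-v i≢j _ = contradiction refl i≢j
    split-disjoint-old at-u at-v _   _ = split-disjoint-ends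
    split-disjoint-old at-v at-u _   _ = Disjoint-sym split-disjoint-ends
    split-disjoint-old {i} {j} i-view (away j≢u j≢v) i≢j ij =
      Disjoint-anti-mono (split≲ i-view) (split≲ (away j≢u j≢v))
        (disjoint supported i j i≢j (≡.trans (sym (withoutEdge-awayʳ i j≢u j≢v)) ij))
    split-disjoint-old {i} {j} (away i≢u i≢v) j-view i≢j ij =
      Disjoint-anti-mono (split≲ (away i≢u i≢v)) (split≲ j-view)
        (disjoint supported i j i≢j (≡.trans (sym (withoutEdge-awayˡ j i≢u i≢v)) ij))

    split-supported : CliqueSupported subdivision (split y)
    split-supported = record
      { 0≲x      = λ { zero → 0≲x+y 0≲common 0≲common ; (suc i) → 0≲split (edgeView i) }
      ; disjoint = λ
        { zero    zero    0≢0 _  → contradiction refl 0≢0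
        ; zero    (suc j) _      → split-disjoint-new (edgeView j)
        ; (suc i) zero    _   i0 → Disjoint-sym (split-disjoint-new (edgeView i) i0)
        ; (suc i) (suc j) i≢j    → split-disjoint-old (edgeView i) (edgeView j) (i≢j ∘ cong suc) }
      }

  subdivision-homeomorphism :
    Homeomorphism (InRealization (cliqueComplex subdivision)) (InRealization (cliqueComplex G))
  subdivision-homeomorphism = mkHomeomorphism merge split merge-continuous split-continuous
    (λ {x} real@(_ , Σx≈1 , _) → supported⇒realization G
      (merge-supported (realization⇒supported subdivision {x} real)) (≃-trans (Σ-merge x) (≈⇒≃ Σx≈1)))
    (λ {y} real@(_ , Σy≈1 , _) → supported⇒realization subdivision
      (split-supported (realization⇒supported G {y} real)) (≃-trans (Σ-split y) (≈⇒≃ Σy≈1)))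
    (λ {y} _ → merge∘split y)
    (λ {x} real → split∘merge (realization⇒supported subdivision {x} real))

-- Clique polynomials

module ∧ = Algebra.Properties.CommutativeSemigroup
  (CommutativeMonoid.commutativeSemigroup ∧-commutativeMonoid)

χ-∧ : ∀ a b → χ (a ∧ b) ≡ χ a ℚ.* χ b
χ-∧ false b = sym (ℚ.*-zeroˡ (χ b))
χ-∧ true  b = sym (ℚ.*-identityˡ (χ b))

VertexSet : ℕ → Set
VertexSet n = Fin n → Bool

infixl 6 _∩_ _∖_

_∩_ : ∀ {n} → VertexSet n → VertexSet n → VertexSet n
(S ∩ R) i = S i ∧ R i

_∖_ : ∀ {n} → VertexSet n → Fin n → VertexSet n
(S ∖ u) i = S i ∧ not (i == u)

everything : ∀ {n} → VertexSet n
everything _ = true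

deleteFirst : ∀ {n} → Graph (suc n) → Graph n
deleteFirst G = record
  { adj    = λ i j → adj G (suc i) (suc j)
  ; symm   = λ i j → symm G (suc i) (suc j)
  ; irrefl = λ i → irrefl G (suc i)
  }

module _ (t : ℚ) where

  -- The generating function, by size, of the cliques contained in S.
  cliquePoly : ∀ {n} → Graph n → VertexSet n → ℚ
  cliquePoly {zero}  G S = 1ℚ
  cliquePoly {suc n} G S = cliquePoly (deleteFirst G) (S ∘ suc) ℚ.+
    χ (S zero) ℚ.* (t ℚ.* cliquePoly (deleteFirst G) ((S ∘ suc) ∩ (adj G zero ∘ suc)))

  cliquePoly-cong : ∀ {n} (G G′ : Graph n) {S S′} → (∀ i → S i ≡ S′ i) →
    (∀ i j → S i ≡ true → S j ≡ true → adj G i j ≡ adj G′ i j) → cliquePoly G S ≡ cliquePoly G′ S′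
  cliquePoly-cong {zero}  G G′ S≗S′ G≗G′ = refl
  cliquePoly-cong {suc n} G G′ {S} {S′} S≗S′ G≗G′ = cong₂ ℚ._+_
    (cliquePoly-cong (deleteFirst G) (deleteFirst G′) (S≗S′ ∘ suc) (λ i j → G≗G′ (suc i) (suc j)))
    (by-membership (S zero) (S′ zero) refl (S≗S′ zero))
    where
    link link′ : ℚ
    link  = t ℚ.* cliquePoly (deleteFirst G) ((S ∘ suc) ∩ (adj G zero ∘ suc))
    link′ = t ℚ.* cliquePoly (deleteFirst G′) ((S′ ∘ suc) ∩ (adj G′ zero ∘ suc))
    by-membership : ∀ b b′ → S zero ≡ b → b ≡ b′ → χ b ℚ.* link ≡ χ b′ ℚ.* link′
    by-membership false .false _  refl = ≡.trans (ℚ.*-zeroˡ link) (sym (ℚ.*-zeroˡ link′))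
    by-membership true  .true  S0 refl = cong (λ p → 1ℚ ℚ.* (t ℚ.* p)) (cliquePoly-cong
      (deleteFirst G) (deleteFirst G′)
      (λ i → neighbours i (S (suc i)) refl)
      (λ i j Si Sj → G≗G′ (suc i) (suc j) (∧-conicalˡ _ _ Si) (∧-conicalˡ _ _ Sj)))
      where
      neighbours : ∀ i b → S (suc i) ≡ b → S (suc i) ∧ adj G zero (suc i) ≡ S′ (suc i) ∧ adj G′ zero (suc i)
      neighbours i false Si rewrite sym (S≗S′ (suc i)) | Si = refl
      neighbours i true  Si rewrite sym (S≗S′ (suc i)) | Si = G≗G′ zero (suc i) S0 Si

  cliquePoly-cong-≗ : ∀ {n} (G : Graph n) {S S′} → (∀ i → S i ≡ S′ i) → cliquePoly G S ≡ cliquePoly G S′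
  cliquePoly-cong-≗ G S≗S′ = cliquePoly-cong G G S≗S′ (λ _ _ _ _ → refl)

  cliquePoly-∌zero : ∀ {n} (G : Graph (suc n)) S → S zero ≡ false →
                     cliquePoly G S ≡ cliquePoly (deleteFirst G) (S ∘ suc)
  cliquePoly-∌zero G S S0 rewrite S0 = ≡.trans
    (cong (cliquePoly (deleteFirst G) (S ∘ suc) ℚ.+_)
      (ℚ.*-zeroˡ (t ℚ.* cliquePoly (deleteFirst G) ((S ∘ suc) ∩ (adj G zero ∘ suc)))))
    (ℚ.+-identityʳ (cliquePoly (deleteFirst G) (S ∘ suc)))

  cliquePoly-∋zero : ∀ {n} (G : Graph (suc n)) S → S zero ≡ true → cliquePoly G S ≡
    cliquePoly (deleteFirst G) (S ∘ suc) ℚ.+ t ℚ.* cliquePoly (deleteFirst G) ((S ∘ suc) ∩ (adj G zero ∘ suc))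
  cliquePoly-∋zero G S S0 rewrite S0 = cong (cliquePoly (deleteFirst G) (S ∘ suc) ℚ.+_)
    (ℚ.*-identityˡ (t ℚ.* cliquePoly (deleteFirst G) ((S ∘ suc) ∩ (adj G zero ∘ suc))))

  cliquePoly-delete-zero : ∀ {n} (G : Graph (suc n)) S →
    cliquePoly G S ≡ cliquePoly G (S ∖ zero) ℚ.+ χ (S zero) ℚ.* (t ℚ.* cliquePoly G (S ∩ adj G zero))
  cliquePoly-delete-zero {n} G S = sym (begin
    cliquePoly G (S ∖ zero) ℚ.+ χ (S zero) ℚ.* (t ℚ.* cliquePoly G (S ∩ adj G zero))
      ≡⟨ cong₂ (λ a b → a ℚ.+ χ (S zero) ℚ.* (t ℚ.* b))
           (cliquePoly-∌zero G (S ∖ zero) (∧-zeroʳ (S zero)))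
           (cliquePoly-∌zero G (S ∩ adj G zero)
             (≡.trans (cong (S zero ∧_) (irrefl G zero)) (∧-zeroʳ (S zero)))) ⟩
    cliquePoly G⁻ ((S ∖ zero) ∘ suc) ℚ.+ χ (S zero) ℚ.* (t ℚ.* cliquePoly G⁻ ((S ∩ adj G zero) ∘ suc))
      ≡⟨ cong (ℚ._+ χ (S zero) ℚ.* (t ℚ.* cliquePoly G⁻ ((S ∩ adj G zero) ∘ suc)))
           (cliquePoly-cong-≗ G⁻ (λ i → ∧-identityʳ (S (suc i)))) ⟩
    cliquePoly G S ∎)
    where
    open ≡.≡-Reasoning
    G⁻ : Graph n
    G⁻ = deleteFirst G

  cliquePoly-delete : ∀ {n} (G : Graph n) S u →
    cliquePoly G S ≡ cliquePoly G (S ∖ u) ℚ.+ χ (S u) ℚ.* (t ℚ.* cliquePoly G (S ∩ adj G u))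
  cliquePoly-delete {suc n} G S zero    = cliquePoly-delete-zero G S
  cliquePoly-delete {suc n} G S (suc u) = begin
    K S⁺ ℚ.+ s ℚ.* (t ℚ.* K (S⁺ ∩ N₀))
      ≡⟨ cong₂ (λ p q → p ℚ.+ s ℚ.* (t ℚ.* q))
           (cliquePoly-delete G⁻ S⁺ u) (cliquePoly-delete G⁻ (S⁺ ∩ N₀) u) ⟩
    (a ℚ.+ χ (S⁺ u) ℚ.* (t ℚ.* b)) ℚ.+ s ℚ.* (t ℚ.* (c ℚ.+ χ (S⁺ u ∧ N₀ u) ℚ.* (t ℚ.* d)))
      ≡⟨ cong (λ e → (a ℚ.+ χ (S⁺ u) ℚ.* (t ℚ.* b)) ℚ.+ s ℚ.* (t ℚ.* (c ℚ.+ e ℚ.* (t ℚ.* d))))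
           (χ-∧ (S⁺ u) (N₀ u)) ⟩
    (a ℚ.+ χ (S⁺ u) ℚ.* (t ℚ.* b)) ℚ.+ s ℚ.* (t ℚ.* (c ℚ.+ (χ (S⁺ u) ℚ.* χ (N₀ u)) ℚ.* (t ℚ.* d)))
      ≡⟨ solve 8 (λ t s x y a b c d → (a :+ x :* (t :* b)) :+ s :* (t :* (c :+ (x :* y) :* (t :* d))) :=
                                      (a :+ s :* (t :* c)) :+ x :* (t :* (b :+ (s :* y) :* (t :* d))))
               refl t s (χ (S⁺ u)) (χ (N₀ u)) a b c d ⟩
    (a ℚ.+ s ℚ.* (t ℚ.* c)) ℚ.+ χ (S⁺ u) ℚ.* (t ℚ.* (b ℚ.+ (s ℚ.* χ (N₀ u)) ℚ.* (t ℚ.* d)))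
      ≡⟨ cong₂ (λ p q → p ℚ.+ χ (S⁺ u) ℚ.* (t ℚ.* q)) deletion link ⟨
    cliquePoly G (S ∖ suc u) ℚ.+ χ (S (suc u)) ℚ.* (t ℚ.* cliquePoly G (S ∩ adj G (suc u))) ∎
    where
    open ≡.≡-Reasoning
    open ℚ-Solver
    G⁻ : Graph n
    G⁻ = deleteFirst G
    K : VertexSet n → ℚ
    K = cliquePoly G⁻
    S⁺ N₀ : VertexSet n
    S⁺ = S ∘ suc
    N₀ = adj G zero ∘ suc
    s a b c d : ℚ
    s = χ (S zero)
    a = K (S⁺ ∖ u)
    b = K (S⁺ ∩ adj G⁻ u)
    c = K ((S⁺ ∩ N₀) ∖ u)
    d = K ((S⁺ ∩ N₀) ∩ adj G⁻ u)
    deletion : cliquePoly G (S ∖ suc u) ≡ a ℚ.+ s ℚ.* (t ℚ.* c)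
    deletion = cong₂ (λ e p → a ℚ.+ χ e ℚ.* (t ℚ.* p)) (∧-identityʳ (S zero))
      (cliquePoly-cong-≗ G⁻ λ i → ∧.xy∙z≈xz∙y (S⁺ i) (not (i == u)) (N₀ i))
    link : cliquePoly G (S ∩ adj G (suc u)) ≡ b ℚ.+ (s ℚ.* χ (N₀ u)) ℚ.* (t ℚ.* d)
    link = cong₂ (λ e p → b ℚ.+ e ℚ.* (t ℚ.* p))
      (≡.trans (χ-∧ (S zero) (adj G (suc u) zero)) (cong (λ e → s ℚ.* χ e) (symm G (suc u) zero)))
      (cliquePoly-cong-≗ G⁻ λ i → ∧.xy∙z≈xz∙y (S⁺ i) (adj G⁻ u i) (N₀ i))

  cliquePoly-∋ : ∀ {n} (G : Graph n) S u → S u ≡ true →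
                 cliquePoly G S ≡ cliquePoly G (S ∖ u) ℚ.+ t ℚ.* cliquePoly G (S ∩ adj G u)
  cliquePoly-∋ G S u Su = begin
    cliquePoly G S
      ≡⟨ cliquePoly-delete G S u ⟩
    cliquePoly G (S ∖ u) ℚ.+ χ (S u) ℚ.* (t ℚ.* cliquePoly G (S ∩ adj G u))
      ≡⟨ cong (λ b → cliquePoly G (S ∖ u) ℚ.+ χ b ℚ.* (t ℚ.* cliquePoly G (S ∩ adj G u))) Su ⟩
    cliquePoly G (S ∖ u) ℚ.+ 1ℚ ℚ.* (t ℚ.* cliquePoly G (S ∩ adj G u))
      ≡⟨ cong (cliquePoly G (S ∖ u) ℚ.+_) (ℚ.*-identityˡ (t ℚ.* cliquePoly G (S ∩ adj G u))) ⟩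
    cliquePoly G (S ∖ u) ℚ.+ t ℚ.* cliquePoly G (S ∩ adj G u) ∎
    where open ≡.≡-Reasoning

  sizeGF : ∀ {n} → List (Subset n) → ℚ
  sizeGF σs = foldr ℚ._+_ 0ℚ (map (λ σ → t ^ ∣ σ ∣) σs)

  sizeGF-++ : ∀ {n} (σs τs : List (Subset n)) → sizeGF (σs ++ τs) ≡ sizeGF σs ℚ.+ sizeGF τs
  sizeGF-++ []       τs = sym (ℚ.+-identityˡ (sizeGF τs))
  sizeGF-++ (σ ∷ σs) τs = ≡.trans (cong (t ^ ∣ σ ∣ ℚ.+_) (sizeGF-++ σs τs))
    (sym (ℚ.+-assoc (t ^ ∣ σ ∣) (sizeGF σs) (sizeGF τs)))

  sizeGF-outside : ∀ {n} {P : Pred (Subset (suc n)) 0ℓ} (P? : Decidable P) σs →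
    sizeGF (filter P? (map (outside ∷_) σs)) ≡ sizeGF (filter (P? ∘ (outside ∷_)) σs)
  sizeGF-outside P? [] = refl
  sizeGF-outside P? (σ ∷ σs) with does (P? (outside ∷ σ))
  ... | true  = cong (t ^ ∣ σ ∣ ℚ.+_) (sizeGF-outside P? σs)
  ... | false = sizeGF-outside P? σs

  sizeGF-inside : ∀ {n} {P : Pred (Subset (suc n)) 0ℓ} (P? : Decidable P) σs →
    sizeGF (filter P? (map (inside ∷_) σs)) ≡ t ℚ.* sizeGF (filter (P? ∘ (inside ∷_)) σs)
  sizeGF-inside P? [] = sym (ℚ.*-zeroʳ t)
  sizeGF-inside P? (σ ∷ σs) with does (P? (inside ∷ σ))
  ... | true  = ≡.trans (cong (t ^ ∣ inside ∷ σ ∣ ℚ.+_) (sizeGF-inside P? σs))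
                        (sym (ℚ.*-distribˡ-+ t (t ^ ∣ σ ∣) (sizeGF (filter (P? ∘ (inside ∷_)) σs))))
  ... | false = sizeGF-inside P? σs

CliqueIn : ∀ {n} → Graph n → VertexSet n → Subset n → Set
CliqueIn G S σ = IsClique G σ × (∀ i → i ∈ σ → S i ≡ true)

cliqueIn? : ∀ {n} (G : Graph n) S → Decidable (CliqueIn G S)
cliqueIn? G S σ = isClique? G σ ×-dec Fin.all? (λ i → (i ∈? σ) →-dec (S i Bool.≟ true))

clique-outside : ∀ {n} (G : Graph (suc n)) S →
  CliqueIn G S ∘ (outside ∷_) ≐ CliqueIn (deleteFirst G) (S ∘ suc)
clique-outside G S =
  (λ (clique , ⊆S) →
    (λ i j i∈ j∈ i≢j → clique (suc i) (suc j) (there i∈) (there j∈) (i≢j ∘ Fin.suc-injective)) ,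
    (λ i i∈ → ⊆S (suc i) (there i∈))) ,
  (λ (clique , ⊆S) →
    (λ { (suc i) (suc j) (there i∈) (there j∈) i≢j → clique i j i∈ j∈ (i≢j ∘ cong suc) }) ,
    (λ { (suc i) (there i∈) → ⊆S i i∈ }))

clique-inside : ∀ {n} (G : Graph (suc n)) S → S zero ≡ true →
  CliqueIn G S ∘ (inside ∷_) ≐ CliqueIn (deleteFirst G) ((S ∘ suc) ∩ (adj G zero ∘ suc))
clique-inside G S S0 =
  (λ (clique , ⊆S) →
    (λ i j i∈ j∈ i≢j → clique (suc i) (suc j) (there i∈) (there j∈) (i≢j ∘ Fin.suc-injective)) ,
    (λ i i∈ → cong₂ _∧_ (⊆S (suc i) (there i∈)) (clique zero (suc i) here (there i∈) λ ()))) ,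
  (λ (clique , ⊆S∩N₀) →
    (λ { zero    zero    _          _          0≢0 → contradiction refl 0≢0
       ; zero    (suc j) _          (there j∈) _   → ∧-conicalʳ (S (suc j)) _ (⊆S∩N₀ j j∈)
       ; (suc i) zero    (there i∈) _          _   → adjacent-sym G (∧-conicalʳ (S (suc i)) _ (⊆S∩N₀ i i∈))
       ; (suc i) (suc j) (there i∈) (there j∈) i≢j → clique i j i∈ j∈ (i≢j ∘ cong suc) }) ,
    (λ { zero here → S0 ; (suc i) (there i∈) → ∧-conicalˡ (S (suc i)) _ (⊆S∩N₀ i i∈) }))

¬clique-inside : ∀ {n} (G : Graph (suc n)) S → S zero ≡ false → ∀ σ → ¬ CliqueIn G S (inside ∷ σ)
¬clique-inside G S S0 σ (_ , ⊆S) = contradiction (≡.trans (sym S0) (⊆S zero here)) λ ()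

sizeGF-cliques : ∀ t {n} (G : Graph n) S → sizeGF t (filter (cliqueIn? G S) (allSubsets n)) ≡ cliquePoly t G S
sizeGF-cliques t {zero}  G S = refl
sizeGF-cliques t {suc n} G S = begin
  sizeGF t (filter P? (map (outside ∷_) Δ ++ map (inside ∷_) Δ))
    ≡⟨ cong (sizeGF t) (filter-++ P? (map (outside ∷_) Δ) (map (inside ∷_) Δ)) ⟩
  sizeGF t (filter P? (map (outside ∷_) Δ) ++ filter P? (map (inside ∷_) Δ))
    ≡⟨ sizeGF-++ t (filter P? (map (outside ∷_) Δ)) (filter P? (map (inside ∷_) Δ)) ⟩
  sizeGF t (filter P? (map (outside ∷_) Δ)) ℚ.+ sizeGF t (filter P? (map (inside ∷_) Δ))
    ≡⟨ cong₂ ℚ._+_ (sizeGF-outside t P? Δ) (sizeGF-inside t P? Δ) ⟩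
  sizeGF t (filter (P? ∘ (outside ∷_)) Δ) ℚ.+ t ℚ.* sizeGF t (filter (P? ∘ (inside ∷_)) Δ)
    ≡⟨ cong₂ ℚ._+_ outsides (insides (S zero) refl) ⟩
  cliquePoly t G S ∎
  where
  open ≡.≡-Reasoning
  Δ : List (Subset n)
  Δ = allSubsets n
  P? : Decidable (CliqueIn G S)
  P? = cliqueIn? G S
  R : VertexSet n
  R = (S ∘ suc) ∩ (adj G zero ∘ suc)
  outsides : sizeGF t (filter (P? ∘ (outside ∷_)) Δ) ≡ cliquePoly t (deleteFirst G) (S ∘ suc)
  outsides = ≡.trans
    (cong (sizeGF t)
      (filter-≐ (P? ∘ (outside ∷_)) (cliqueIn? (deleteFirst G) (S ∘ suc)) (clique-outside G S) Δ))
    (sizeGF-cliques t (deleteFirst G) (S ∘ suc))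
  insides : ∀ b → S zero ≡ b →
    t ℚ.* sizeGF t (filter (P? ∘ (inside ∷_)) Δ) ≡ χ b ℚ.* (t ℚ.* cliquePoly t (deleteFirst G) R)
  insides false S0 = ≡.trans
    (cong (λ σs → t ℚ.* sizeGF t σs)
      (filter-none (P? ∘ (inside ∷_)) (All.universal (¬clique-inside G S S0) Δ)))
    (≡.trans (ℚ.*-zeroʳ t) (sym (ℚ.*-zeroˡ (t ℚ.* cliquePoly t (deleteFirst G) R))))
  insides true S0 = begin
    t ℚ.* sizeGF t (filter (P? ∘ (inside ∷_)) Δ)
      ≡⟨ cong (λ σs → t ℚ.* sizeGF t σs)
           (filter-≐ (P? ∘ (inside ∷_)) (cliqueIn? (deleteFirst G) R) (clique-inside G S S0) Δ) ⟩
    t ℚ.* sizeGF t (filter (cliqueIn? (deleteFirst G) R) Δ)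
      ≡⟨ cong (t ℚ.*_) (sizeGF-cliques t (deleteFirst G) R) ⟩
    t ℚ.* cliquePoly t (deleteFirst G) R
      ≡⟨ ℚ.*-identityˡ (t ℚ.* cliquePoly t (deleteFirst G) R) ⟨
    1ℚ ℚ.* (t ℚ.* cliquePoly t (deleteFirst G) R) ∎

fPolynomial≡cliquePoly : ∀ {n} (G : Graph n) t → fPolynomial (cliqueComplex G) t ≡ cliquePoly t G everything
fPolynomial≡cliquePoly {n} G t = ≡.trans
  (cong (sizeGF t) (filter-≐ (isClique? G) (cliqueIn? G everything)
    ((λ clique → clique , λ _ _ → refl) , proj₁) (allSubsets n)))
  (sizeGF-cliques t G everything)

S⁰Poly : ℚ → ℚ
S⁰Poly t = 1ℚ ℚ.+ (t ℚ.+ t)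

∧-absorb : ∀ x {a} → (x ≡ true → a ≡ true) → x ∧ a ≡ x
∧-absorb false _   = refl
∧-absorb true  x⇒a = x⇒a refl

∖-removes : ∀ {n} (S : VertexSet n) u → (S ∖ u) u ≡ false
∖-removes S u rewrite ==-refl u = ∧-zeroʳ (S u)

∖-keeps : ∀ {n} (S : VertexSet n) {u i} → i ≢ u → (S ∖ u) i ≡ S i
∖-keeps S {i = i} i≢u rewrite ≢⇒==-false i≢u = ∧-identityʳ (S i)

withNew : ∀ {n} → VertexSet n → VertexSet (suc n)
withNew R zero    = true
withNew R (suc i) = R i

module SubdivisionCliques {n} (G : Graph n) {u v : Fin n} (uv : adj G u v ≡ true) (t : ℚ)
                          (R : VertexSet n) (Ru : R u ≡ true) (Rv : R v ≡ true) where
  open Subdivision G uv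
  open ≡.≡-Reasoning
  open ℚ-Solver

  private
    K : Graph n → VertexSet n → ℚ
    K = cliquePoly t

    N N⁻ : Fin n → VertexSet n
    N  = adj G
    N⁻ = adj withoutEdge

    N′ : Fin (suc n) → VertexSet (suc n)
    N′ = adj subdivision

    C : VertexSet n
    C = R ∩ N u ∩ N v

    R⁺ : VertexSet (suc n)
    R⁺ = withNew R

    withoutEdge-cliques : ∀ S → S u ≡ false ⊎ S v ≡ false → K withoutEdge S ≡ K G S
    withoutEdge-cliques S avoids = cliquePoly-cong t withoutEdge G (λ _ → refl) λ i j Si Sj →
      [ (λ Su → withoutEdge-≢u (separated-by S Si Su) (separated-by S Sj Su)) ,
        (λ Sv → withoutEdge-≢v (separated-by S Si Sv) (separated-by S Sj Sv)) ]′ avoids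

    N⁻u≗Nu∖v : ∀ i → N⁻ u i ≡ (N u ∖ v) i
    N⁻u≗Nu∖v i = cong (λ b → N u i ∧ not b) (isEdge-u i)

    Cu : C u ≡ false
    Cu rewrite irrefl G u | ∧-zeroʳ (R u) = refl

    Cv : C v ≡ false
    Cv rewrite irrefl G v = ∧-zeroʳ (R v ∧ N u v)

    cliques-C : ∀ S → S u ≡ false → S v ≡ false → (∀ i → i ≢ u → i ≢ v → S i ≡ C i) → K withoutEdge S ≡ K G C
    cliques-C S Su Sv S≗C = ≡.trans (withoutEdge-cliques S (inj₁ Su))
      (cliquePoly-cong-≗ t G λ i → by-position (edgeView i))
      where
      by-position : ∀ {i} → EdgeView i → S i ≡ C i
      by-position at-u               = ≡.trans Su (sym Cu)
      by-position at-v               = ≡.trans Sv (sym Cv)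
      by-position (away {i} i≢u i≢v) = S≗C i i≢u i≢v

    R∩nearEdge≗C : ∀ i → i ≢ u → i ≢ v → (R ∩ nearEdge) i ≡ C i
    R∩nearEdge≗C i i≢u i≢v = ≡.trans
      (cong (R i ∧_) (nearEdge-away i≢u i≢v)) (sym (∧-assoc (R i) (N u i) (N v i)))

    cliques-R∩nearEdge∩N⁻u : K withoutEdge (R ∩ nearEdge ∩ N⁻ u) ≡ K G C
    cliques-R∩nearEdge∩N⁻u = cliques-C (R ∩ nearEdge ∩ N⁻ u)
      (≡.trans (cong ((R ∩ nearEdge) u ∧_) (irrefl withoutEdge u)) (∧-zeroʳ ((R ∩ nearEdge) u)))
      (≡.trans (cong ((R ∩ nearEdge) v ∧_) withoutEdge-uv) (∧-zeroʳ ((R ∩ nearEdge) v)))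
      λ i i≢u i≢v → ≡.trans (cong₂ _∧_ (R∩nearEdge≗C i i≢u i≢v) (withoutEdge-awayʳ u i≢u i≢v))
        (∧-absorb (C i) λ Ci → ∧-conicalʳ (R i) (N u i) (∧-conicalˡ (R i ∧ N u i) (N v i) Ci))

    cliques-R∩nearEdge : K withoutEdge (R ∩ nearEdge) ≡ S⁰Poly t ℚ.* K G C
    cliques-R∩nearEdge = begin
      K withoutEdge W
        ≡⟨ cliquePoly-∋ t withoutEdge W u (cong₂ _∧_ Ru nearEdge-u) ⟩
      K withoutEdge (W ∖ u) ℚ.+ t ℚ.* K withoutEdge (W ∩ N⁻ u)
        ≡⟨ cong₂ (λ a b → a ℚ.+ t ℚ.* b)
             (cliquePoly-∋ t withoutEdge (W ∖ u) v
               (≡.trans (∖-keeps W (u≢v ∘ sym)) (cong₂ _∧_ Rv nearEdge-v)))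
             cliques-R∩nearEdge∩N⁻u ⟩
      (K withoutEdge (W ∖ u ∖ v) ℚ.+ t ℚ.* K withoutEdge (W ∖ u ∩ N⁻ v)) ℚ.+ t ℚ.* K G C
        ≡⟨ cong₂ (λ a b → (a ℚ.+ t ℚ.* b) ℚ.+ t ℚ.* K G C)
             (cliques-C (W ∖ u ∖ v) (≡.trans (∖-keeps (W ∖ u) u≢v) (∖-removes W u)) (∖-removes (W ∖ u) v)
               λ i i≢u i≢v → ≡.trans (∖-keeps (W ∖ u) i≢v) (W∖u≗C i i≢u i≢v))
             (cliques-C (W ∖ u ∩ N⁻ v) (cong (_∧ N⁻ v u) (∖-removes W u))
               (≡.trans (cong ((W ∖ u) v ∧_) (irrefl withoutEdge v)) (∧-zeroʳ ((W ∖ u) v)))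
               λ i i≢u i≢v → ≡.trans (cong₂ _∧_ (W∖u≗C i i≢u i≢v) (withoutEdge-awayʳ v i≢u i≢v))
                 (∧-absorb (C i) (∧-conicalʳ (R i ∧ N u i) (N v i)))) ⟩
      (K G C ℚ.+ t ℚ.* K G C) ℚ.+ t ℚ.* K G C
        ≡⟨ solve 2 (λ c t → (c :+ t :* c) :+ t :* c := (con 1ℚ :+ (t :+ t)) :* c) refl (K G C) t ⟩
      S⁰Poly t ℚ.* K G C ∎
      where
      W : VertexSet n
      W = R ∩ nearEdge
      W∖u≗C : ∀ i → i ≢ u → i ≢ v → (W ∖ u) i ≡ C i
      W∖u≗C i i≢u i≢v = ≡.trans (∖-keeps W i≢u) (R∩nearEdge≗C i i≢u i≢v)

    withoutEdge-R∩Nu : K withoutEdge (R ∩ N⁻ u) ≡ K G ((R ∩ N u) ∖ v)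
    withoutEdge-R∩Nu = ≡.trans
      (cliquePoly-cong-≗ t withoutEdge λ i →
        ≡.trans (cong (R i ∧_) (N⁻u≗Nu∖v i)) (sym (∧-assoc (R i) (N u i) (not (i == v)))))
      (withoutEdge-cliques ((R ∩ N u) ∖ v) (inj₂ (∖-removes (R ∩ N u) v)))

    cliques-R∩Nu : K G (R ∩ N u) ≡ K G ((R ∩ N u) ∖ v) ℚ.+ t ℚ.* K G C
    cliques-R∩Nu = cliquePoly-∋ t G (R ∩ N u) v (cong₂ _∧_ Rv uv)

    cliques-R : K G R ≡ K withoutEdge R ℚ.+ t ℚ.* (t ℚ.* K G C)
    cliques-R = begin
      K G R
        ≡⟨ cliquePoly-∋ t G R u Ru ⟩
      K G (R ∖ u) ℚ.+ t ℚ.* K G (R ∩ N u)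
        ≡⟨ cong (λ p → K G (R ∖ u) ℚ.+ t ℚ.* p) cliques-R∩Nu ⟩
      K G (R ∖ u) ℚ.+ t ℚ.* (K G ((R ∩ N u) ∖ v) ℚ.+ t ℚ.* K G C)
        ≡⟨ solve 4 (λ a b c t → a :+ t :* (b :+ t :* c) := (a :+ t :* b) :+ t :* (t :* c))
                 refl (K G (R ∖ u)) (K G ((R ∩ N u) ∖ v)) (K G C) t ⟩
      (K G (R ∖ u) ℚ.+ t ℚ.* K G ((R ∩ N u) ∖ v)) ℚ.+ t ℚ.* (t ℚ.* K G C)
        ≡⟨ cong₂ (λ a b → (a ℚ.+ t ℚ.* b) ℚ.+ t ℚ.* (t ℚ.* K G C))
             (withoutEdge-cliques (R ∖ u) (inj₁ (∖-removes R u))) withoutEdge-R∩Nu ⟨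
      (K withoutEdge (R ∖ u) ℚ.+ t ℚ.* K withoutEdge (R ∩ N⁻ u)) ℚ.+ t ℚ.* (t ℚ.* K G C)
        ≡⟨ cong (ℚ._+ t ℚ.* (t ℚ.* K G C)) (cliquePoly-∋ t withoutEdge R u Ru) ⟨
      K withoutEdge R ℚ.+ t ℚ.* (t ℚ.* K G C) ∎

  subdivision-cliques : cliquePoly t subdivision R⁺ ≡ K G R ℚ.+ (t ℚ.+ t ℚ.* t) ℚ.* K G (R ∩ N u ∩ N v)
  subdivision-cliques = begin
    cliquePoly t subdivision R⁺
      ≡⟨ cliquePoly-∋zero t subdivision R⁺ refl ⟩
    K withoutEdge R ℚ.+ t ℚ.* K withoutEdge (R ∩ nearEdge)
      ≡⟨ cong (λ p → K withoutEdge R ℚ.+ t ℚ.* p) cliques-R∩nearEdge ⟩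
    K withoutEdge R ℚ.+ t ℚ.* (S⁰Poly t ℚ.* K G C)
      ≡⟨ solve 3 (λ a c t → a :+ t :* ((con 1ℚ :+ (t :+ t)) :* c) :=
                            (a :+ t :* (t :* c)) :+ (t :+ t :* t) :* c)
               refl (K withoutEdge R) (K G C) t ⟩
    (K withoutEdge R ℚ.+ t ℚ.* (t ℚ.* K G C)) ℚ.+ (t ℚ.+ t ℚ.* t) ℚ.* K G C
      ≡⟨ cong (ℚ._+ (t ℚ.+ t ℚ.* t) ℚ.* K G C) cliques-R ⟨
    K G R ℚ.+ (t ℚ.+ t ℚ.* t) ℚ.* K G C ∎

  subdivision-cliques-new : cliquePoly t subdivision (R⁺ ∩ N′ zero) ≡ S⁰Poly t ℚ.* K G (R ∩ N u ∩ N v)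
  subdivision-cliques-new = ≡.trans (cliquePoly-∌zero t subdivision (R⁺ ∩ N′ zero) refl) cliques-R∩nearEdge

  subdivision-cliques-new-end : cliquePoly t subdivision (R⁺ ∩ N′ zero ∩ N′ (suc u)) ≡ K G (R ∩ N u ∩ N v)
  subdivision-cliques-new-end =
    ≡.trans (cliquePoly-∌zero t subdivision (R⁺ ∩ N′ zero ∩ N′ (suc u)) refl) cliques-R∩nearEdge∩N⁻u

  subdivision-cliques-end : cliquePoly t subdivision (R⁺ ∩ N′ (suc u)) ≡ K G (R ∩ N u)
  subdivision-cliques-end = begin
    cliquePoly t subdivision (R⁺ ∩ N′ (suc u))
      ≡⟨ cliquePoly-∋zero t subdivision (R⁺ ∩ N′ (suc u)) nearEdge-u ⟩
    K withoutEdge (R ∩ N⁻ u) ℚ.+ t ℚ.* K withoutEdge (R ∩ N⁻ u ∩ nearEdge)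
      ≡⟨ cong (λ p → K withoutEdge (R ∩ N⁻ u) ℚ.+ t ℚ.* p)
           (cliquePoly-cong-≗ t withoutEdge λ i → ∧.xy∙z≈xz∙y (R i) (N⁻ u i) (nearEdge i)) ⟩
    K withoutEdge (R ∩ N⁻ u) ℚ.+ t ℚ.* K withoutEdge (R ∩ nearEdge ∩ N⁻ u)
      ≡⟨ cong₂ (λ a b → a ℚ.+ t ℚ.* b) withoutEdge-R∩Nu cliques-R∩nearEdge∩N⁻u ⟩
    K G ((R ∩ N u) ∖ v) ℚ.+ t ℚ.* K G C
      ≡⟨ cliques-R∩Nu ⟨
    K G (R ∩ N u) ∎

-- Links of marked cliques

link : ∀ {n d} → Graph n → (Fin d → Fin n) → Subset d → VertexSet n
link G φ []            i = true
link G φ (outside ∷ τ) i = link G (φ ∘ suc) τ i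
link G φ (inside ∷ τ)  i = link G (φ ∘ suc) τ i ∧ adj G (φ zero) i

link-cong : ∀ {m n d} (G : Graph m) (H : Graph n) {φ : Fin d → Fin m} {ψ : Fin d → Fin n} {i j} τ →
  (∀ c → lookup τ c ≡ inside → adj G (φ c) i ≡ adj H (ψ c) j) → link G φ τ i ≡ link H ψ τ j
link-cong G H []            eq = refl
link-cong G H (outside ∷ τ) eq = link-cong G H τ (eq ∘ suc)
link-cong G H (inside ∷ τ)  eq = cong₂ _∧_ (link-cong G H τ (eq ∘ suc)) (eq zero refl)

link-true : ∀ {n d} (G : Graph n) {φ : Fin d → Fin n} {i} (τ : Subset d) →
  (∀ c → lookup τ c ≡ inside → adj G (φ c) i ≡ true) → link G φ τ i ≡ true
link-true G []            eq = refl
link-true G (outside ∷ τ) eq = link-true G τ (eq ∘ suc)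
link-true G (inside ∷ τ)  eq = cong₂ _∧_ (link-true G τ (eq ∘ suc)) (eq zero refl)

link-insert : ∀ {n d} (G : Graph n) {φ : Fin d → Fin n} (τ : Subset d) a → lookup τ a ≡ outside →
  ∀ i → link G φ (τ [ a ]≔ inside) i ≡ (link G φ τ ∩ adj G (φ a)) i
link-insert G         (outside ∷ τ) zero    _  i = refl
link-insert G         (outside ∷ τ) (suc a) a∉ i = link-insert G τ a a∉ i
link-insert G {φ = φ} (inside ∷ τ)  (suc a) a∉ i = ≡.trans
  (cong (_∧ adj G (φ zero) i) (link-insert G τ a a∉ i))
  (∧.xy∙z≈xz∙y (link G (φ ∘ suc) τ i) (adj G (φ (suc a)) i) (adj G (φ zero) i))

linkPoly : ∀ {n d} → Graph n → (Fin d → Fin n) → Subset d → ℚ → ℚ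
linkPoly G φ τ t = cliquePoly t G (link G φ τ)

module SubdivideClique {n d} (G : Graph n) (φ : Fin d → Fin n)
                       (clique : ∀ c c′ → c ≢ c′ → adj G (φ c) (φ c′) ≡ true)
                       (kept replaced : Fin d) (kept≢replaced : kept ≢ replaced) where
  open Subdivision G (clique kept replaced kept≢replaced) public

  φ′ : Fin d → Fin (suc n)
  φ′ = updateAt (suc ∘ φ) replaced (λ _ → zero)

  φ′-replaced : φ′ replaced ≡ zero
  φ′-replaced = updateAt-updates replaced (suc ∘ φ)

  φ′-other : ∀ {c} → c ≢ replaced → φ′ c ≡ suc (φ c)
  φ′-other {c} = updateAt-minimal c replaced (suc ∘ φ)

  φ-injective : ∀ {c c′} → c ≢ c′ → φ c ≢ φ c′
  φ-injective c≢c′ = adjacent⇒≢ G (clique _ _ c≢c′)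

  nearEdge-φ : ∀ {c} → c ≢ replaced → nearEdge (φ c) ≡ true
  nearEdge-φ {c} c≢r with c Fin.≟ kept
  ... | yes refl = nearEdge-u
  ... | no c≢k   = ≡.trans (nearEdge-away (φ-injective c≢k) (φ-injective c≢r))
    (cong₂ _∧_ (clique kept c (c≢k ∘ sym)) (clique replaced c (c≢r ∘ sym)))

  clique′ : ∀ c c′ → c ≢ c′ → adj subdivision (φ′ c) (φ′ c′) ≡ true
  clique′ c c′ c≢c′ with c Fin.≟ replaced | c′ Fin.≟ replaced
  ... | yes refl | yes refl = contradiction refl c≢c′
  ... | yes refl | no c′≢r rewrite φ′-replaced | φ′-other c′≢r = nearEdge-φ c′≢r
  ... | no c≢r | yes refl rewrite φ′-replaced | φ′-other c≢r = nearEdge-φ c≢r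
  ... | no c≢r | no c′≢r rewrite φ′-other c≢r | φ′-other c′≢r =
    ≡.trans (withoutEdge-≢v (φ-injective c≢r) (φ-injective c′≢r)) (clique c c′ c≢c′)

  module _ (τ : Subset d) (k∉τ : lookup τ kept ≡ outside) (r∉τ : lookup τ replaced ≡ outside) where
    private
      R : VertexSet n
      R = link G φ τ

      ∉τ⇒≢ : ∀ {a c} → lookup τ a ≡ outside → lookup τ c ≡ inside → c ≢ a
      ∉τ⇒≢ a∉τ c∈τ = separated-by (lookup τ) c∈τ a∉τ

      ∈link : ∀ {a} → lookup τ a ≡ outside → R (φ a) ≡ true
      ∈link a∉τ = link-true G τ λ c c∈τ → clique c _ (∉τ⇒≢ a∉τ c∈τ)

      link′≗withNew : ∀ i → link subdivision φ′ τ i ≡ withNew R i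
      link′≗withNew zero    = link-true subdivision τ λ c c∈τ →
        ≡.trans (cong (λ j → adj subdivision j zero) (φ′-other (∉τ⇒≢ r∉τ c∈τ))) (nearEdge-φ (∉τ⇒≢ r∉τ c∈τ))
      link′≗withNew (suc i) = link-cong subdivision G τ λ c c∈τ →
        ≡.trans (cong (λ j → adj subdivision j (suc i)) (φ′-other (∉τ⇒≢ r∉τ c∈τ)))
                (withoutEdge-awayˡ i (φ-injective (∉τ⇒≢ k∉τ c∈τ)) (φ-injective (∉τ⇒≢ r∉τ c∈τ)))

    τ+kept τ+replaced τ+edge : Subset d
    τ+kept     = τ [ kept ]≔ inside
    τ+replaced = τ [ replaced ]≔ inside
    τ+edge     = τ+kept [ replaced ]≔ inside

    private
      r∉τ+kept : lookup τ+kept replaced ≡ outside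
      r∉τ+kept = ≡.trans (lookup∘update′ (kept≢replaced ∘ sym) τ inside) r∉τ

      edge-link : ∀ i → link G φ τ+edge i ≡ (R ∩ adj G (φ kept) ∩ adj G (φ replaced)) i
      edge-link i = ≡.trans (link-insert G τ+kept replaced r∉τ+kept i)
        (cong (_∧ adj G (φ replaced) i) (link-insert G τ kept k∉τ i))

      link′-kept : ∀ i → link subdivision φ′ τ+kept i ≡ (withNew R ∩ adj subdivision (suc (φ kept))) i
      link′-kept i = ≡.trans (link-insert subdivision τ kept k∉τ i)
        (cong₂ _∧_ (link′≗withNew i) (cong (λ j → adj subdivision j i) (φ′-other kept≢replaced)))

      link′-replaced : ∀ i → link subdivision φ′ τ+replaced i ≡ (withNew R ∩ adj subdivision zero) i
      link′-replaced i = ≡.trans (link-insert subdivision τ replaced r∉τ i)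
        (cong₂ _∧_ (link′≗withNew i) (cong (λ j → adj subdivision j i) φ′-replaced))

      link′-edge : ∀ i → link subdivision φ′ τ+edge i ≡
                         (withNew R ∩ adj subdivision zero ∩ adj subdivision (suc (φ kept))) i
      link′-edge i = begin
        link subdivision φ′ τ+edge i
          ≡⟨ link-insert subdivision τ+kept replaced r∉τ+kept i ⟩
        link subdivision φ′ τ+kept i ∧ adj subdivision (φ′ replaced) i
          ≡⟨ cong₂ _∧_ (link′-kept i) (cong (λ j → adj subdivision j i) φ′-replaced) ⟩
        (withNew R i ∧ adj subdivision (suc (φ kept)) i) ∧ adj subdivision zero i
          ≡⟨ ∧.xy∙z≈xz∙y (withNew R i) (adj subdivision (suc (φ kept)) i) (adj subdivision zero i) ⟩
        (withNew R i ∧ adj subdivision zero i) ∧ adj subdivision (suc (φ kept)) i ∎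
        where open ≡.≡-Reasoning

    module _ (t : ℚ) where
      open SubdivisionCliques G (clique kept replaced kept≢replaced) t R (∈link k∉τ) (∈link r∉τ)
      open ≡.≡-Reasoning

      linkPoly-avoiding : linkPoly subdivision φ′ τ t ≡
        linkPoly G φ τ t ℚ.+ (t ℚ.+ t ℚ.* t) ℚ.* linkPoly G φ τ+edge t
      linkPoly-avoiding = begin
        linkPoly subdivision φ′ τ t
          ≡⟨ cliquePoly-cong-≗ t subdivision link′≗withNew ⟩
        cliquePoly t subdivision (withNew R)
          ≡⟨ subdivision-cliques ⟩
        linkPoly G φ τ t ℚ.+ (t ℚ.+ t ℚ.* t) ℚ.* cliquePoly t G (R ∩ adj G (φ kept) ∩ adj G (φ replaced))
          ≡⟨ cong (λ p → linkPoly G φ τ t ℚ.+ (t ℚ.+ t ℚ.* t) ℚ.* p) (cliquePoly-cong-≗ t G edge-link) ⟨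
        linkPoly G φ τ t ℚ.+ (t ℚ.+ t ℚ.* t) ℚ.* linkPoly G φ τ+edge t ∎

      linkPoly-kept : linkPoly subdivision φ′ τ+kept t ≡ linkPoly G φ τ+kept t
      linkPoly-kept = begin
        linkPoly subdivision φ′ τ+kept t
          ≡⟨ cliquePoly-cong-≗ t subdivision link′-kept ⟩
        cliquePoly t subdivision (withNew R ∩ adj subdivision (suc (φ kept)))
          ≡⟨ subdivision-cliques-end ⟩
        cliquePoly t G (R ∩ adj G (φ kept))
          ≡⟨ cliquePoly-cong-≗ t G (link-insert G τ kept k∉τ) ⟨
        linkPoly G φ τ+kept t ∎

      linkPoly-new : linkPoly subdivision φ′ τ+replaced t ≡ S⁰Poly t ℚ.* linkPoly G φ τ+edge t
      linkPoly-new = begin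
        linkPoly subdivision φ′ τ+replaced t
          ≡⟨ cliquePoly-cong-≗ t subdivision link′-replaced ⟩
        cliquePoly t subdivision (withNew R ∩ adj subdivision zero)
          ≡⟨ subdivision-cliques-new ⟩
        S⁰Poly t ℚ.* cliquePoly t G (R ∩ adj G (φ kept) ∩ adj G (φ replaced))
          ≡⟨ cong (S⁰Poly t ℚ.*_) (cliquePoly-cong-≗ t G edge-link) ⟨
        S⁰Poly t ℚ.* linkPoly G φ τ+edge t ∎

      linkPoly-new-kept : linkPoly subdivision φ′ τ+edge t ≡ linkPoly G φ τ+edge t
      linkPoly-new-kept = begin
        linkPoly subdivision φ′ τ+edge t
          ≡⟨ cliquePoly-cong-≗ t subdivision link′-edge ⟩
        cliquePoly t subdivision (withNew R ∩ adj subdivision zero ∩ adj subdivision (suc (φ kept)))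
          ≡⟨ subdivision-cliques-new-end ⟩
        cliquePoly t G (R ∩ adj G (φ kept) ∩ adj G (φ replaced))
          ≡⟨ cliquePoly-cong-≗ t G edge-link ⟨
        linkPoly G φ τ+edge t ∎

-- Cross-polytope links

pole : ∀ {n} → Fin n → Fin (n ℕ.* 2)
pole zero    = zero
pole (suc k) = suc (suc (pole k))

cliquePoly-suspension : ∀ t {n} (G : Graph n) S {b} → S zero ≡ b → S (suc zero) ≡ b →
  cliquePoly t (suspension G) S ≡ (1ℚ ℚ.+ χ b ℚ.* (t ℚ.+ t)) ℚ.* cliquePoly t G (S ∘ old)
cliquePoly-suspension t G S {false} S0 S1 = ≡.trans (cliquePoly-∌zero t (suspension G) S S0)
  (≡.trans (cliquePoly-∌zero t (deleteFirst (suspension G)) (S ∘ suc) S1)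
    (solve 2 (λ t p → p := (con 1ℚ :+ con 0ℚ :* (t :+ t)) :* p) refl t (cliquePoly t G (S ∘ old))))
  where open ℚ-Solver
cliquePoly-suspension t {n} G S {true} S0 S1 = begin
  cliquePoly t (suspension G) S
    ≡⟨ cliquePoly-∋zero t (suspension G) S S0 ⟩
  cliquePoly t G₁ (S ∘ suc) ℚ.+ t ℚ.* cliquePoly t G₁ ((S ∘ suc) ∩ (adj (suspension G) zero ∘ suc))
    ≡⟨ cong₂ (λ p q → p ℚ.+ t ℚ.* q) (cliquePoly-∋zero t G₁ (S ∘ suc) S1)
         (cliquePoly-∌zero t G₁ ((S ∘ suc) ∩ (adj (suspension G) zero ∘ suc)) (∧-zeroʳ (S (suc zero)))) ⟩
  (cliquePoly t G S₂ ℚ.+ t ℚ.* cliquePoly t G (S₂ ∩ everything)) ℚ.+ t ℚ.* cliquePoly t G (S₂ ∩ everything)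
    ≡⟨ cong (λ p → (cliquePoly t G S₂ ℚ.+ t ℚ.* p) ℚ.+ t ℚ.* p) (cliquePoly-cong-≗ t G (∧-identityʳ ∘ S₂)) ⟩
  (cliquePoly t G S₂ ℚ.+ t ℚ.* cliquePoly t G S₂) ℚ.+ t ℚ.* cliquePoly t G S₂
    ≡⟨ solve 2 (λ t p → (p :+ t :* p) :+ t :* p := (con 1ℚ :+ con 1ℚ :* (t :+ t)) :* p)
             refl t (cliquePoly t G S₂) ⟩
  (1ℚ ℚ.+ 1ℚ ℚ.* (t ℚ.+ t)) ℚ.* cliquePoly t G S₂ ∎
  where
  open ≡.≡-Reasoning
  open ℚ-Solver
  G₁ : Graph (suc n)
  G₁ = deleteFirst (suspension G)
  S₂ : VertexSet n
  S₂ = S ∘ old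

linkPoly-crossPolytope : ∀ n (τ : Subset n) t → linkPoly (crossPolytope n) pole τ t ≡ S⁰Poly t ^ ∣ ∁ τ ∣
linkPoly-crossPolytope zero    []            t = refl
linkPoly-crossPolytope (suc n) (outside ∷ τ) t = begin
  linkPoly P (pole {suc n}) (outside ∷ τ) t
    ≡⟨ cliquePoly-suspension t (crossPolytope n) (link P pole (outside ∷ τ))
         (link-true P {pole ∘ suc} τ λ _ _ → refl) (link-true P {pole ∘ suc} τ λ _ _ → refl) ⟩
  (1ℚ ℚ.+ 1ℚ ℚ.* (t ℚ.+ t)) ℚ.* cliquePoly t (crossPolytope n) (link P (pole ∘ suc) τ ∘ old)
    ≡⟨ cong₂ (λ p q → (1ℚ ℚ.+ p) ℚ.* q) (ℚ.*-identityˡ (t ℚ.+ t)) (≡.trans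
         (cliquePoly-cong-≗ t (crossPolytope n) λ i →
           link-cong P (crossPolytope n) {pole ∘ suc} {pole} τ λ _ _ → refl)
         (linkPoly-crossPolytope n τ t)) ⟩
  S⁰Poly t ^ ∣ ∁ (outside ∷ τ) ∣ ∎
  where
  open ≡.≡-Reasoning
  P : Graph (suc n ℕ.* 2)
  P = crossPolytope (suc n)
linkPoly-crossPolytope (suc n) (inside ∷ τ)  t = begin
  linkPoly P (pole {suc n}) (inside ∷ τ) t
    ≡⟨ cliquePoly-suspension t (crossPolytope n) (link P pole (inside ∷ τ)) (∧-zeroʳ _) (∧-zeroʳ _) ⟩
  (1ℚ ℚ.+ 0ℚ ℚ.* (t ℚ.+ t)) ℚ.* cliquePoly t (crossPolytope n) (link P pole (inside ∷ τ) ∘ old)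
    ≡⟨ cong₂ (λ p q → (1ℚ ℚ.+ p) ℚ.* q) (ℚ.*-zeroˡ (t ℚ.+ t)) (≡.trans
         (cliquePoly-cong-≗ t (crossPolytope n) λ i → ≡.trans (∧-identityʳ (link P (pole ∘ suc) τ (old i)))
           (link-cong P (crossPolytope n) {pole ∘ suc} {pole} τ λ _ _ → refl))
         (linkPoly-crossPolytope n τ t)) ⟩
  (1ℚ ℚ.+ 0ℚ) ℚ.* S⁰Poly t ^ ∣ ∁ τ ∣
    ≡⟨ ℚ.*-identityˡ (S⁰Poly t ^ ∣ ∁ τ ∣) ⟩
  S⁰Poly t ^ ∣ ∁ (inside ∷ τ) ∣ ∎
  where
  open ≡.≡-Reasoning
  P : Graph (suc n ℕ.* 2)
  P = crossPolytope (suc n)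

-- Flag 3-spheres with a marked facet

quadraticForm : ℚ → ℚ → ℚ → ℚ → ℚ
quadraticForm A B d e = d ℚ.* d ℚ.+ (A ℚ.* (d ℚ.* e) ℚ.+ B ℚ.* (e ℚ.* e))

polygonPoly : ℕ → ℚ → ℚ
polygonPoly k t = S⁰Poly t ^ 2 ℚ.+ nat k ℚ.* (t ℚ.+ t ℚ.* t)

spherePoly : ℕ → ℕ → ℚ → ℚ
spherePoly γ₁ γ₂ t = quadraticForm (nat γ₁) (nat γ₂) (S⁰Poly t ^ 2) (t ℚ.+ t ℚ.* t)

polygonPoly-0 : ∀ t → S⁰Poly t ^ 2 ≡ polygonPoly 0 t
polygonPoly-0 t = solve 2 (λ s w → s := s :+ con 0ℚ :* w) refl (S⁰Poly t ^ 2) (t ℚ.+ t ℚ.* t)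
  where open ℚ-Solver

spherePoly-0-0 : ∀ t → S⁰Poly t ^ 4 ≡ spherePoly 0 0 t
spherePoly-0-0 t = solve 2 (λ s w →
    s :^ 4 := (s :^ 2) :* (s :^ 2) :+ (con 0ℚ :* ((s :^ 2) :* w) :+ con 0ℚ :* (w :* w)))
  refl (S⁰Poly t) (t ℚ.+ t ℚ.* t)
  where open ℚ-Solver

polygonPoly-suc : ∀ k t → polygonPoly k t ℚ.+ (t ℚ.+ t ℚ.* t) ℚ.* 1ℚ ≡ polygonPoly (suc k) t
polygonPoly-suc k t = begin
  polygonPoly k t ℚ.+ w ℚ.* 1ℚ
    ≡⟨ solve 3 (λ s k w → (s :+ k :* w) :+ w :* con 1ℚ := s :+ (con 1ℚ :+ k) :* w)
             refl (S⁰Poly t ^ 2) (nat k) w ⟩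
  S⁰Poly t ^ 2 ℚ.+ (1ℚ ℚ.+ nat k) ℚ.* w
    ≡⟨ cong (λ m → S⁰Poly t ^ 2 ℚ.+ m ℚ.* w) (nat-homo-+ 1 k) ⟨
  polygonPoly (suc k) t ∎
  where
  open ≡.≡-Reasoning
  open ℚ-Solver
  w : ℚ
  w = t ℚ.+ t ℚ.* t

spherePoly-step : ∀ γ₁ γ₂ k t →
  spherePoly γ₁ γ₂ t ℚ.+ (t ℚ.+ t ℚ.* t) ℚ.* polygonPoly k t ≡ spherePoly (suc γ₁) (γ₂ ℕ.+ k) t
spherePoly-step γ₁ γ₂ k t = begin
  quadraticForm (nat γ₁) (nat γ₂) s w ℚ.+ w ℚ.* (s ℚ.+ nat k ℚ.* w)
    ≡⟨ solve 5 (λ a b k s w → (s :* s :+ (a :* (s :* w) :+ b :* (w :* w))) :+ w :* (s :+ k :* w) :=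
                              s :* s :+ ((con 1ℚ :+ a) :* (s :* w) :+ (b :+ k) :* (w :* w)))
             refl (nat γ₁) (nat γ₂) (nat k) s w ⟩
  quadraticForm (1ℚ ℚ.+ nat γ₁) (nat γ₂ ℚ.+ nat k) s w
    ≡⟨ cong₂ (λ a b → quadraticForm a b s w) (nat-homo-+ 1 γ₁) (nat-homo-+ γ₂ k) ⟨
  spherePoly (suc γ₁) (γ₂ ℕ.+ k) t ∎
  where
  open ≡.≡-Reasoning
  open ℚ-Solver
  s w : ℚ
  s = S⁰Poly t ^ 2
  w = t ℚ.+ t ℚ.* t

record MarkedSphere : Set where
  field
    {size}       : ℕ
    graph        : Graph size
    triangulates : TriangulatesS³ (cliqueComplex graph)
    facet        : Fin 4 → Fin size
    facet-clique : ∀ c c′ → c ≢ c′ → adj graph (facet c) (facet c′) ≡ true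

open MarkedSphere

v₀ v₁ v₂ v₃ : Fin 4
v₀ = zero
v₁ = suc zero
v₂ = suc (suc zero)
v₃ = suc (suc (suc zero))

-- The links of the opposite edges v₀v₁ and v₂v₃ of the marked facet are polygons with
-- 4 + k and 4 + l vertices, that of v₁v₂ is a quadrilateral.
record Shape (X : MarkedSphere) (k l γ₁ γ₂ : ℕ) : Set where
  field
    link-∅    : ∀ t → linkPoly (graph X) (facet X) ∅ t ≡ spherePoly γ₁ γ₂ t
    link-01   : ∀ t → linkPoly (graph X) (facet X) (⁅ v₀ ⁆ ∪ ⁅ v₁ ⁆) t ≡ polygonPoly k t
    link-23   : ∀ t → linkPoly (graph X) (facet X) (⁅ v₂ ⁆ ∪ ⁅ v₃ ⁆) t ≡ polygonPoly l t
    link-12   : ∀ t → linkPoly (graph X) (facet X) (⁅ v₁ ⁆ ∪ ⁅ v₂ ⁆) t ≡ polygonPoly 0 t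
    link-012  : ∀ t → linkPoly (graph X) (facet X) (⁅ v₀ ⁆ ∪ ⁅ v₁ ⁆ ∪ ⁅ v₂ ⁆) t ≡ S⁰Poly t
    link-0123 : ∀ t → linkPoly (graph X) (facet X) (⁅ v₀ ⁆ ∪ ⁅ v₁ ⁆ ∪ ⁅ v₂ ⁆ ∪ ⁅ v₃ ⁆) t ≡ 1ℚ

open Shape

pole-clique : ∀ n (c c′ : Fin n) → c ≢ c′ → adj (crossPolytope n) (pole c) (pole c′) ≡ true
pole-clique (suc n) zero    zero     0≢0  = contradiction refl 0≢0
pole-clique (suc n) zero    (suc c′) _    = refl
pole-clique (suc n) (suc c) zero     _    = refl
pole-clique (suc n) (suc c) (suc c′) c≢c′ = pole-clique n c c′ (c≢c′ ∘ cong suc)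

initial : MarkedSphere
initial = record
  { graph        = crossPolytope 4
  ; triangulates = crossPolytope-sphere 3
  ; facet        = pole
  ; facet-clique = pole-clique 4
  }

initial-shape : Shape initial 0 0 0 0
initial-shape = record
  { link-∅    = λ t → ≡.trans (linkPoly-crossPolytope 4 ∅ t) (spherePoly-0-0 t)
  ; link-01   = quadrilateral (⁅ v₀ ⁆ ∪ ⁅ v₁ ⁆) refl
  ; link-23   = quadrilateral (⁅ v₂ ⁆ ∪ ⁅ v₃ ⁆) refl
  ; link-12   = quadrilateral (⁅ v₁ ⁆ ∪ ⁅ v₂ ⁆) refl
  ; link-012  = λ t →
      ≡.trans (linkPoly-crossPolytope 4 (⁅ v₀ ⁆ ∪ ⁅ v₁ ⁆ ∪ ⁅ v₂ ⁆) t) (ℚ.*-identityʳ (S⁰Poly t))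
  ; link-0123 = linkPoly-crossPolytope 4 (⁅ v₀ ⁆ ∪ ⁅ v₁ ⁆ ∪ ⁅ v₂ ⁆ ∪ ⁅ v₃ ⁆)
  }
  where
  quadrilateral : ∀ τ → ∣ ∁ τ ∣ ≡ 2 → ∀ t → linkPoly (crossPolytope 4) pole τ t ≡ polygonPoly 0 t
  quadrilateral τ ∣∁τ∣≡2 t = ≡.trans (linkPoly-crossPolytope 4 τ t)
    (≡.trans (cong (S⁰Poly t ^_) ∣∁τ∣≡2) (polygonPoly-0 t))

subdivide : MarkedSphere → (kept replaced : Fin 4) → kept ≢ replaced → MarkedSphere
subdivide X kept replaced kept≢replaced = record
  { graph        = subdivision
  ; triangulates = Homeomorphism-trans subdivision-homeomorphism (triangulates X)
  ; facet        = φ′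
  ; facet-clique = clique′
  }
  where
  open SubdivideClique (graph X) (facet X) (facet-clique X) kept replaced kept≢replaced
  open SubdivisionHomeomorphism (graph X) (facet-clique X kept replaced kept≢replaced)

module _ {X : MarkedSphere} {k l γ₁ γ₂ : ℕ} (shape : Shape X k l γ₁ γ₂) where

  subdivide-23 : Shape (subdivide X v₂ v₃ λ ()) (suc k) l (suc γ₁) (γ₂ ℕ.+ l)
  subdivide-23 = record
    { link-∅    = λ t → ≡.trans (linkPoly-avoiding ∅ refl refl t) (≡.trans
        (cong₂ (λ p q → p ℚ.+ (t ℚ.+ t ℚ.* t) ℚ.* q) (link-∅ shape t) (link-23 shape t))
        (spherePoly-step γ₁ γ₂ l t))
    ; link-01   = λ t → ≡.trans (linkPoly-avoiding (⁅ v₀ ⁆ ∪ ⁅ v₁ ⁆) refl refl t) (≡.trans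
        (cong₂ (λ p q → p ℚ.+ (t ℚ.+ t ℚ.* t) ℚ.* q) (link-01 shape t) (link-0123 shape t))
        (polygonPoly-suc k t))
    ; link-23   = λ t → ≡.trans (linkPoly-new-kept ∅ refl refl t) (link-23 shape t)
    ; link-12   = λ t → ≡.trans (linkPoly-kept ⁅ v₁ ⁆ refl refl t) (link-12 shape t)
    ; link-012  = λ t → ≡.trans (linkPoly-kept (⁅ v₀ ⁆ ∪ ⁅ v₁ ⁆) refl refl t) (link-012 shape t)
    ; link-0123 = λ t → ≡.trans (linkPoly-new-kept (⁅ v₀ ⁆ ∪ ⁅ v₁ ⁆) refl refl t) (link-0123 shape t)
    }
    where open SubdivideClique (graph X) (facet X) (facet-clique X) v₂ v₃ (λ ())

  subdivide-01 : Shape (subdivide X v₁ v₀ λ ()) k (suc l) (suc γ₁) (γ₂ ℕ.+ k)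
  subdivide-01 = record
    { link-∅    = λ t → ≡.trans (linkPoly-avoiding ∅ refl refl t) (≡.trans
        (cong₂ (λ p q → p ℚ.+ (t ℚ.+ t ℚ.* t) ℚ.* q) (link-∅ shape t) (link-01 shape t))
        (spherePoly-step γ₁ γ₂ k t))
    ; link-01   = λ t → ≡.trans (linkPoly-new-kept ∅ refl refl t) (link-01 shape t)
    ; link-23   = λ t → ≡.trans (linkPoly-avoiding (⁅ v₂ ⁆ ∪ ⁅ v₃ ⁆) refl refl t) (≡.trans
        (cong₂ (λ p q → p ℚ.+ (t ℚ.+ t ℚ.* t) ℚ.* q) (link-23 shape t) (link-0123 shape t))
        (polygonPoly-suc l t))
    ; link-12   = λ t → ≡.trans (linkPoly-kept ⁅ v₂ ⁆ refl refl t) (link-12 shape t)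
    ; link-012  = λ t → ≡.trans (linkPoly-new-kept ⁅ v₂ ⁆ refl refl t) (link-012 shape t)
    ; link-0123 = λ t → ≡.trans (linkPoly-new-kept (⁅ v₂ ⁆ ∪ ⁅ v₃ ⁆) refl refl t) (link-0123 shape t)
    }
    where open SubdivideClique (graph X) (facet X) (facet-clique X) v₁ v₀ (λ ())

  subdivide-12 : Shape (subdivide X v₂ v₁ λ ()) 0 l (suc γ₁) γ₂
  subdivide-12 = record
    { link-∅    = λ t → ≡.trans (linkPoly-avoiding ∅ refl refl t) (≡.trans
        (cong₂ (λ p q → p ℚ.+ (t ℚ.+ t ℚ.* t) ℚ.* q) (link-∅ shape t) (link-12 shape t))
        (≡.trans (spherePoly-step γ₁ γ₂ 0 t) (cong (λ b → spherePoly (suc γ₁) b t) (ℕ.+-identityʳ γ₂))))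
    ; link-01   = λ t → ≡.trans (linkPoly-new ⁅ v₀ ⁆ refl refl t) (≡.trans
        (cong (S⁰Poly t ℚ.*_) (≡.trans (link-012 shape t) (sym (ℚ.*-identityʳ (S⁰Poly t)))))
        (polygonPoly-0 t))
    ; link-23   = λ t → ≡.trans (linkPoly-kept ⁅ v₃ ⁆ refl refl t) (link-23 shape t)
    ; link-12   = λ t → ≡.trans (linkPoly-new-kept ∅ refl refl t) (link-12 shape t)
    ; link-012  = λ t → ≡.trans (linkPoly-new-kept ⁅ v₀ ⁆ refl refl t) (link-012 shape t)
    ; link-0123 = λ t → ≡.trans (linkPoly-new-kept (⁅ v₀ ⁆ ∪ ⁅ v₃ ⁆) refl refl t) (link-0123 shape t)
    }
    where open SubdivideClique (graph X) (facet X) (facet-clique X) v₂ v₁ (λ ())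

SphereOfShape : (k l γ₁ γ₂ : ℕ) → Set
SphereOfShape k l γ₁ γ₂ = ∃ λ X → Shape X k l γ₁ γ₂

[m*n+o]+n≡[1+m]*n+o : ∀ m n o → (m ℕ.* n ℕ.+ o) ℕ.+ n ≡ suc m ℕ.* n ℕ.+ o
[m*n+o]+n≡[1+m]*n+o = solve 3 (λ m n o → (m :* n :+ o) :+ n := (con 1 :+ m) :* n :+ o) refl
  where open ℕ-Solver

iterate-23 : ∀ m {k l γ₁ γ₂} → SphereOfShape k l γ₁ γ₂ → SphereOfShape (m ℕ.+ k) l (m ℕ.+ γ₁) (m ℕ.* l ℕ.+ γ₂)
iterate-23 zero    S = S
iterate-23 (suc m) {l = l} {γ₂ = γ₂} S = let _ , shape = iterate-23 m S in
  subst (SphereOfShape _ l _) ([m*n+o]+n≡[1+m]*n+o m l γ₂) (_ , subdivide-23 shape)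

iterate-01 : ∀ m {k l γ₁ γ₂} → SphereOfShape k l γ₁ γ₂ → SphereOfShape k (m ℕ.+ l) (m ℕ.+ γ₁) (m ℕ.* k ℕ.+ γ₂)
iterate-01 zero    S = S
iterate-01 (suc m) {k} {γ₂ = γ₂} S = let _ , shape = iterate-01 m S in
  subst (SphereOfShape k _ _) ([m*n+o]+n≡[1+m]*n+o m k γ₂) (_ , subdivide-01 shape)

iterate-12 : ∀ m {k l γ₁ γ₂} → SphereOfShape k l γ₁ γ₂ → SphereOfShape 0 l (suc m ℕ.+ γ₁) γ₂
iterate-12 zero    (_ , shape) = _ , subdivide-12 shape
iterate-12 (suc m) S = let _ , shape = iterate-12 m S in _ , subdivide-12 shape

sphere-c*[r+b]+r : ∀ b c o r → ∃₂ λ k l →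
  SphereOfShape k l (suc ((r ℕ.+ b) ℕ.+ (suc c ℕ.+ o))) (c ℕ.* (r ℕ.+ b) ℕ.+ r)
sphere-c*[r+b]+r b c o r = _ , _ , subst₂ (SphereOfShape _ _)
  (solve 4 (λ b c o r → con 1 :+ (r :+ ((con 1 :+ o) :+ (b :+ (c :+ con 0)))) :=
                        con 1 :+ ((r :+ b) :+ ((con 1 :+ c) :+ o))) refl b c o r)
  (solve 3 (λ b c r →
      (r :* (c :+ con 0) :+ (b :* (c :+ con 0) :+ (c :* con 0 :+ con 0))) :+ (r :+ con 0) :=
      c :* (r :+ b) :+ r) refl b c r)
  (_ , subdivide-01 (proj₂
    (iterate-23 r (iterate-12 o (iterate-23 b (iterate-01 c (initial , initial-shape)))))))
  where open ℕ-Solver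

⌊a/2⌋*⌈a/2⌉-bound : ∀ a → a ℕ.* a ℕ.≤ suc (4 ℕ.* (⌊ a /2⌋ ℕ.* ⌈ a /2⌉))
⌊a/2⌋*⌈a/2⌉-bound zero          = ℕ.z≤n
⌊a/2⌋*⌈a/2⌉-bound (suc zero)    = ℕ.s≤s ℕ.z≤n
⌊a/2⌋*⌈a/2⌉-bound (suc (suc a)) = begin
  (2 ℕ.+ a) ℕ.* (2 ℕ.+ a)
    ≡⟨ solve 1 (λ a → (con 2 :+ a) :* (con 2 :+ a) := a :* a :+ (con 4 :* a :+ con 4)) refl a ⟩
  a ℕ.* a ℕ.+ (4 ℕ.* a ℕ.+ 4)
    ≤⟨ ℕ.+-monoˡ-≤ (4 ℕ.* a ℕ.+ 4) (⌊a/2⌋*⌈a/2⌉-bound a) ⟩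
  suc (4 ℕ.* (⌊ a /2⌋ ℕ.* ⌈ a /2⌉)) ℕ.+ (4 ℕ.* a ℕ.+ 4)
    ≡⟨ cong (λ b → suc (4 ℕ.* (⌊ a /2⌋ ℕ.* ⌈ a /2⌉)) ℕ.+ (4 ℕ.* b ℕ.+ 4)) (ℕ.⌊n/2⌋+⌈n/2⌉≡n a) ⟨
  suc (4 ℕ.* (⌊ a /2⌋ ℕ.* ⌈ a /2⌉)) ℕ.+ (4 ℕ.* (⌊ a /2⌋ ℕ.+ ⌈ a /2⌉) ℕ.+ 4)
    ≡⟨ solve 2 (λ h h′ → con 1 :+ con 4 :* (h :* h′) :+ (con 4 :* (h :+ h′) :+ con 4) :=
                         con 1 :+ con 4 :* ((con 1 :+ h) :* (con 1 :+ h′))) refl ⌊ a /2⌋ ⌈ a /2⌉ ⟩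
  suc (4 ℕ.* (suc ⌊ a /2⌋ ℕ.* suc ⌈ a /2⌉)) ∎
  where
  open ℕ.≤-Reasoning
  open ℕ-Solver

4g≤a²⇒g≤⌊a/2⌋*⌈a/2⌉ : ∀ {a g} → 4 ℕ.* g ℕ.≤ a ℕ.* a → g ℕ.≤ ⌊ a /2⌋ ℕ.* ⌈ a /2⌉
4g≤a²⇒g≤⌊a/2⌋*⌈a/2⌉ {a} {g} 4g≤a² = ℕ.≤-pred (ℕ.*-cancelˡ-< 4 g (suc (⌊ a /2⌋ ℕ.* ⌈ a /2⌉)) (begin-strict
  4 ℕ.* g                                      ≤⟨ 4g≤a² ⟩
  a ℕ.* a                                      ≤⟨ ⌊a/2⌋*⌈a/2⌉-bound a ⟩
  1 ℕ.+ 4 ℕ.* (⌊ a /2⌋ ℕ.* ⌈ a /2⌉)            <⟨ ℕ.+-monoˡ-< (4 ℕ.* (⌊ a /2⌋ ℕ.* ⌈ a /2⌉)) {1} {4}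
                                                    (ℕ.s≤s (ℕ.s≤s ℕ.z≤n)) ⟩
  4 ℕ.+ 4 ℕ.* (⌊ a /2⌋ ℕ.* ⌈ a /2⌉)            ≡⟨ ℕ.*-suc 4 (⌊ a /2⌋ ℕ.* ⌈ a /2⌉) ⟨
  4 ℕ.* suc (⌊ a /2⌋ ℕ.* ⌈ a /2⌉)              ∎))
  where open ℕ.≤-Reasoning

sphereWithGamma : ∀ a g → 4 ℕ.* g ℕ.≤ a ℕ.* a → ∃₂ λ k l → SphereOfShape k l (suc a) g
sphereWithGamma a zero    _     = 0 , 0 ,
  subst (λ γ₁ → SphereOfShape 0 0 γ₁ 0) (cong suc (ℕ.+-identityʳ a)) (iterate-12 a (initial , initial-shape))
sphereWithGamma a (suc g) 4g≤a² =
  by-halves ⌊ a /2⌋ ⌈ a /2⌉ (ℕ.⌊n/2⌋+⌈n/2⌉≡n a) (4g≤a²⇒g≤⌊a/2⌋*⌈a/2⌉ {a} 4g≤a²)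
  where
  by-halves : ∀ h h′ → h ℕ.+ h′ ≡ a → g ℕ.< h ℕ.* h′ → ∃₂ λ k l → SphereOfShape k l (suc a) (suc g)
  by-halves (suc h) h′ h+h′≡a g<hh′ =
    let c          = g / suc h
        r          = suc (g % suc h)
        b , r+b≡h  = ℕ.m≤n⇒∃[o]m+o≡n (m%n<n g (suc h))
        o , c+o≡h′ = ℕ.m≤n⇒∃[o]m+o≡n (m<n*o⇒m/o<n {n = h′} (subst (g ℕ.<_) (ℕ.*-comm (suc h) h′) g<hh′))
        k , l , S  = sphere-c*[r+b]+r b c o r
    in k , l , subst₂ (SphereOfShape k l)
         (cong suc (≡.trans (cong₂ ℕ._+_ r+b≡h c+o≡h′) h+h′≡a))
         (begin
           c ℕ.* (r ℕ.+ b) ℕ.+ r                  ≡⟨ cong (λ n → c ℕ.* n ℕ.+ r) r+b≡h ⟩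
           c ℕ.* suc h ℕ.+ r                      ≡⟨ ℕ.+-comm (c ℕ.* suc h) r ⟩
           suc (g % suc h ℕ.+ c ℕ.* suc h)        ≡⟨ cong suc (m≡m%n+[m/n]*n g (suc h)) ⟨
           suc g                                  ∎)
         S
    where open ≡.≡-Reasoning

-- The h-polynomial

quadraticForm-homogeneous : ∀ c A B d e →
  c ^ 2 ℚ.* quadraticForm A B d e ≡ quadraticForm A B (c ℚ.* d) (c ℚ.* e)
quadraticForm-homogeneous = solve 5 (λ c A B d e →
  (c :^ 2) :* (d :* d :+ (A :* (d :* e) :+ B :* (e :* e))) :=
  (c :* d) :* (c :* d) :+ (A :* ((c :* d) :* (c :* e)) :+ B :* ((c :* e) :* (c :* e)))) refl
  where open ℚ-Solver

hPolynomial : ℤ → ℤ → Polynomial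
hPolynomial γ₁ γ₂ = + 1 ∷ + 4 ℤ.+ γ₁ ∷ + 6 ℤ.+ (γ₁ ℤ.+ γ₁ ℤ.+ γ₂) ∷ + 4 ℤ.+ γ₁ ∷ + 1 ∷ []

evalℚ-hPolynomial : ∀ γ₁ γ₂ t → evalℚ (hPolynomial γ₁ γ₂) t ≡ quadraticForm (ι γ₁) (ι γ₂) ((1ℚ ℚ.+ t) ^ 2) t
evalℚ-hPolynomial γ₁ γ₂ t = begin
  horner (ι (+ 4 ℤ.+ γ₁)) (ι (+ 6 ℤ.+ (γ₁ ℤ.+ γ₁ ℤ.+ γ₂)))
    ≡⟨ cong₂ horner (ι-homo-+ (+ 4) γ₁) (≡.trans (ι-homo-+ (+ 6) (γ₁ ℤ.+ γ₁ ℤ.+ γ₂)) (cong (ι (+ 6) ℚ.+_)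
         (≡.trans (ι-homo-+ (γ₁ ℤ.+ γ₁) γ₂) (cong (ℚ._+ ι γ₂) (ι-homo-+ γ₁ γ₁))))) ⟩
  horner (ι (+ 4) ℚ.+ ι γ₁) (ι (+ 6) ℚ.+ (ι γ₁ ℚ.+ ι γ₁ ℚ.+ ι γ₂))
    ≡⟨ solve 3 (λ A B t → con 1ℚ :+ t :* ((con (ι (+ 4)) :+ A) :+ t :* ((con (ι (+ 6)) :+ (A :+ A :+ B)) :+
                 t :* ((con (ι (+ 4)) :+ A) :+ t :* (con 1ℚ :+ t :* con 0ℚ)))) :=
               ((con 1ℚ :+ t) :^ 2) :* ((con 1ℚ :+ t) :^ 2) :+
                 (A :* (((con 1ℚ :+ t) :^ 2) :* t) :+ B :* (t :* t)))
             refl (ι γ₁) (ι γ₂) t ⟩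
  quadraticForm (ι γ₁) (ι γ₂) ((1ℚ ℚ.+ t) ^ 2) t ∎
  where
  open ≡.≡-Reasoning
  open ℚ-Solver
  horner : ℚ → ℚ → ℚ
  horner h₁ h₂ = 1ℚ ℚ.+ t ℚ.* (h₁ ℚ.+ t ℚ.* (h₂ ℚ.+ t ℚ.* (h₁ ℚ.+ t ℚ.* (1ℚ ℚ.+ t ℚ.* 0ℚ))))

p⁴≡[p²]² : ∀ p → p ^ 4 ≡ (p ^ 2) ^ 2
p⁴≡[p²]² = solve 1 (λ p → p :^ 4 := (p :^ 2) :^ 2) refl
  where open ℚ-Solver

hPolynomial-γ : ∀ γ₁ γ₂ → Is[1+t]⁴p[t/[1+t]²] (hPolynomial γ₁ γ₂) (+ 1 ∷ γ₁ ∷ γ₂ ∷ [])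
hPolynomial-γ γ₁ γ₂ t = begin
  evalℚ (hPolynomial γ₁ γ₂) t
    ≡⟨ evalℚ-hPolynomial γ₁ γ₂ t ⟩
  quadraticForm (ι γ₁) (ι γ₂) (y ^ 2) t
    ≡⟨ cong₂ (quadraticForm (ι γ₁) (ι γ₂)) (ℚ.*-identityʳ (y ^ 2)) y²q≡t ⟨
  quadraticForm (ι γ₁) (ι γ₂) (y ^ 2 ℚ.* 1ℚ) (y ^ 2 ℚ.* q)
    ≡⟨ quadraticForm-homogeneous (y ^ 2) (ι γ₁) (ι γ₂) 1ℚ q ⟨
  (y ^ 2) ^ 2 ℚ.* quadraticForm (ι γ₁) (ι γ₂) 1ℚ q
    ≡⟨ cong₂ ℚ._*_ (p⁴≡[p²]² y) (solve 3 (λ A B q → con 1ℚ :+ q :* (A :+ q :* (B :+ q :* con 0ℚ)) :=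
         con 1ℚ :* con 1ℚ :+ (A :* (con 1ℚ :* q) :+ B :* (q :* q))) refl (ι γ₁) (ι γ₂) q) ⟨
  y ^ 4 ℚ.* evalℚ (+ 1 ∷ γ₁ ∷ γ₂ ∷ []) q ∎
  where
  open ≡.≡-Reasoning
  open ℚ-Solver
  y q : ℚ
  y = 1ℚ ℚ.+ t
  q = t ℚ.÷ (y ^ 2)
  y²q≡t : y ^ 2 ℚ.* q ≡ t
  y²q≡t = begin
    y ^ 2 ℚ.* (t ℚ.* ℚ.1/ (y ^ 2))
      ≡⟨ solve 3 (λ s t i → s :* (t :* i) := t :* (s :* i)) refl (y ^ 2) t (ℚ.1/ (y ^ 2)) ⟩
    t ℚ.* (y ^ 2 ℚ.* ℚ.1/ (y ^ 2))
      ≡⟨ cong (t ℚ.*_) (ℚ.*-inverseʳ (y ^ 2)) ⟩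
    t ℚ.* 1ℚ
      ≡⟨ ℚ.*-identityʳ t ⟩
    t ∎

module _ (p : ℚ) .{{_ : ℚ.NonZero p}} where
  open ≡.≡-Reasoning
  open ℚ-Solver
  private
    p⁻¹ : ℚ
    p⁻¹ = ℚ.1/ p

  p²*p⁻¹≡p : p ^ 2 ℚ.* p⁻¹ ≡ p
  p²*p⁻¹≡p = begin
    p ^ 2 ℚ.* p⁻¹     ≡⟨ solve 2 (λ p i → (p :^ 2) :* i := p :* (p :* i)) refl p p⁻¹ ⟩
    p ℚ.* (p ℚ.* p⁻¹) ≡⟨ cong (p ℚ.*_) (ℚ.*-inverseʳ p) ⟩
    p ℚ.* 1ℚ          ≡⟨ ℚ.*-identityʳ p ⟩
    p                 ∎

  p²[1+p⁻¹]²≡[1+p]² : p ^ 2 ℚ.* (1ℚ ℚ.+ p⁻¹) ^ 2 ≡ (1ℚ ℚ.+ p) ^ 2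
  p²[1+p⁻¹]²≡[1+p]² = begin
    p ^ 2 ℚ.* (1ℚ ℚ.+ p⁻¹) ^ 2   ≡⟨ solve 2 (λ p i → (p :^ 2) :* ((con 1ℚ :+ i) :^ 2) := (p :* i :+ p) :^ 2)
                                      refl p p⁻¹ ⟩
    (p ℚ.* p⁻¹ ℚ.+ p) ^ 2        ≡⟨ cong (λ u → (u ℚ.+ p) ^ 2) (ℚ.*-inverseʳ p) ⟩
    (1ℚ ℚ.+ p) ^ 2               ∎

  p²[p⁻¹+p⁻²]≡1+p : p ^ 2 ℚ.* (p⁻¹ ℚ.+ p⁻¹ ℚ.* p⁻¹) ≡ 1ℚ ℚ.+ p
  p²[p⁻¹+p⁻²]≡1+p = begin
    p ^ 2 ℚ.* (p⁻¹ ℚ.+ p⁻¹ ℚ.* p⁻¹)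
      ≡⟨ solve 2 (λ p i → (p :^ 2) :* (i :+ i :* i) := (p :* i) :^ 2 :+ (p :* i) :* p) refl p p⁻¹ ⟩
    (p ℚ.* p⁻¹) ^ 2 ℚ.+ (p ℚ.* p⁻¹) ℚ.* p
      ≡⟨ cong (λ u → u ^ 2 ℚ.+ u ℚ.* p) (ℚ.*-inverseʳ p) ⟩
    1ℚ ℚ.+ 1ℚ ℚ.* p
      ≡⟨ cong (1ℚ ℚ.+_) (ℚ.*-identityˡ p) ⟩
    1ℚ ℚ.+ p ∎

  p²*S⁰Poly[p⁻¹]²≡[2+p]² : p ^ 2 ℚ.* S⁰Poly p⁻¹ ^ 2 ≡ (1ℚ ℚ.+ (1ℚ ℚ.+ p)) ^ 2
  p²*S⁰Poly[p⁻¹]²≡[2+p]² = begin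
    p ^ 2 ℚ.* S⁰Poly p⁻¹ ^ 2
      ≡⟨ solve 2 (λ p i → (p :^ 2) :* ((con 1ℚ :+ (i :+ i)) :^ 2) := (p :* i :+ (p :* i :+ p)) :^ 2)
               refl p p⁻¹ ⟩
    (p ℚ.* p⁻¹ ℚ.+ (p ℚ.* p⁻¹ ℚ.+ p)) ^ 2
      ≡⟨ cong (λ u → (u ℚ.+ (u ℚ.+ p)) ^ 2) (ℚ.*-inverseʳ p) ⟩
    (1ℚ ℚ.+ (1ℚ ℚ.+ p)) ^ 2 ∎

-- Both sides of the defining identity are quadraticForm a b ((2 + t) ^ 2) (1 + t).
hPolynomial-isHPolynomial : ∀ {n} (X : SimplicialComplex n) a b → (∀ t → fPolynomial X t ≡ spherePoly a b t) →
                            IsHPolynomial X (hPolynomial (+ a) (+ b))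
hPolynomial-isHPolynomial X a b f≡ t = begin
  y ^ 4 ℚ.* evalℚ (hPolynomial (+ a) (+ b)) y⁻¹
    ≡⟨ cong₂ ℚ._*_ (p⁴≡[p²]² y) (evalℚ-hPolynomial (+ a) (+ b) y⁻¹) ⟩
  (y ^ 2) ^ 2 ℚ.* quadraticForm (nat a) (nat b) ((1ℚ ℚ.+ y⁻¹) ^ 2) y⁻¹
    ≡⟨ quadraticForm-homogeneous (y ^ 2) (nat a) (nat b) ((1ℚ ℚ.+ y⁻¹) ^ 2) y⁻¹ ⟩
  quadraticForm (nat a) (nat b) (y ^ 2 ℚ.* (1ℚ ℚ.+ y⁻¹) ^ 2) (y ^ 2 ℚ.* y⁻¹)
    ≡⟨ cong₂ (quadraticForm (nat a) (nat b)) (p²[1+p⁻¹]²≡[1+p]² y) (p²*p⁻¹≡p y) ⟩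
  quadraticForm (nat a) (nat b) ((1ℚ ℚ.+ y) ^ 2) y
    ≡⟨ cong₂ (quadraticForm (nat a) (nat b)) (p²*S⁰Poly[p⁻¹]²≡[2+p]² t) (p²[p⁻¹+p⁻²]≡1+p t) ⟨
  quadraticForm (nat a) (nat b) (t ^ 2 ℚ.* S⁰Poly t⁻¹ ^ 2) (t ^ 2 ℚ.* (t⁻¹ ℚ.+ t⁻¹ ℚ.* t⁻¹))
    ≡⟨ quadraticForm-homogeneous (t ^ 2) (nat a) (nat b) (S⁰Poly t⁻¹ ^ 2) (t⁻¹ ℚ.+ t⁻¹ ℚ.* t⁻¹) ⟨
  (t ^ 2) ^ 2 ℚ.* spherePoly a b t⁻¹
    ≡⟨ cong₂ ℚ._*_ (p⁴≡[p²]² t) (f≡ t⁻¹) ⟨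
  t ^ 4 ℚ.* fPolynomial X t⁻¹ ∎
  where
  open ≡.≡-Reasoning
  y y⁻¹ t⁻¹ : ℚ
  y   = 1ℚ ℚ.+ t
  y⁻¹ = ℚ.1/ y
  t⁻¹ = ℚ.1/ t

-- The roots of γ(t) − t

NegativeRoots : ℤ → ℤ → Set
NegativeRoots γ₁ γ₂ = ∀ z → IsRootOf[ + 1 ∷ γ₁ ∷ γ₂ ∷ [] -t] z → im z ≈ 0ℝ × re z < 0ℝ

<0⇒Positive-neg : ∀ {x} → x < 0ℝ → Positive (- x)
<0⇒Positive-neg {x} (e , 0<e , x+e<0) = mkPositive (0<½*e 0<e) (eventually-map
  (λ n x+e<0 → <-resp-difference (ℚ.+-mono-< x+e<0 (0<½*e 0<e))
    (solve 2 (λ x e → (:- x) :- con ½ :* e := (con 0ℚ :+ con ½ :* e) :- ((x :+ e) :+ con 0ℚ))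
       refl (seq x n) e)) x+e<0)
  where open ℚ-Solver

module _ (γ₁ γ₂ : ℤ) where
  private
    A B : ℚ
    A = ι γ₁
    B = ι γ₂

  isRoot : ∀ r s → 1ℝ + (fromℚ A + - 1ℝ) * r + fromℚ B * (r * r + - (s * s)) ≃ 0ℝ →
           (fromℚ A + - 1ℝ + (fromℚ B * r + fromℚ B * r)) * s ≃ 0ℝ →
           IsRootOf[ + 1 ∷ γ₁ ∷ γ₂ ∷ [] -t] (r +i s)
  isRoot r s real≃0 imaginary≃0 =
    ≃⇒≈ (≃-trans
      (solve 4 (λ A B r s → let R , _ = γ A B r s in
          R :+ (:- r) := con 1ℚ :+ (A :+ (:- con 1ℚ)) :* r :+ B :* (r :* r :+ (:- (s :* s))))
        ≃-refl (fromℚ A) (fromℚ B) r s)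
      real≃0) ,
    ≃⇒≈ (≃-trans
      (solve 4 (λ A B r s → let _ , I = γ A B r s in
          I :+ (:- s) := (A :+ (:- con 1ℚ) :+ (B :* r :+ B :* r)) :* s)
        ≃-refl (fromℚ A) (fromℚ B) r s)
      imaginary≃0)
    where
    open ℝ-Solver renaming (Polynomial to Expr)
    step : ∀ {n} → Expr n → Expr n → Expr n → Expr n × Expr n → Expr n × Expr n
    step r s a (P , Q) = (a :+ (r :* P :+ (:- (s :* Q)))) , (con 0ℚ :+ (r :* Q :+ s :* P))
    γ : ∀ {n} → Expr n → Expr n → Expr n → Expr n → Expr n × Expr n
    γ A B r s = step r s (con 1ℚ) (step r s A (step r s B (con 0ℚ , con 0ℚ)))

  GammaBounds : Set
  GammaBounds = 1ℚ ℚ.≤ A × 0ℚ ℚ.≤ B × ι (+ 4) ℚ.* B ℚ.≤ (A ℚ.- 1ℚ) ℚ.* (A ℚ.- 1ℚ)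

  module CompletedSquare {b c : ℚ} (A-1≡-2Bb : A ℚ.- 1ℚ ≡ ℚ.- (B ℚ.* b ℚ.+ B ℚ.* b))
                         (B[b²-c]≡1 : B ℚ.* (b ℚ.* b ℚ.- c) ≡ 1ℚ) where

    private
      linear : ℝ
      linear = (fromℚ A + - 1ℝ) + (fromℚ B * fromℚ b + fromℚ B * fromℚ b)

      linear≃0 : linear ≃ 0ℝ
      linear≃0 = termwise-≃ λ _ →
        ≡.trans (cong (ℚ._+ (B ℚ.* b ℚ.+ B ℚ.* b)) A-1≡-2Bb) (ℚ.+-inverseˡ (B ℚ.* b ℚ.+ B ℚ.* b))

      constant : ℝ
      constant = 1ℝ + - (fromℚ B * (fromℚ b * fromℚ b + - fromℚ c))

      constant≃0 : constant ≃ 0ℝ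
      constant≃0 = termwise-≃ λ _ → ≡.trans (cong (λ p → 1ℚ ℚ.- p) B[b²-c]≡1) (ℚ.+-inverseʳ 1ℚ)

    real-part≃0 : ∀ ρ s → ρ * ρ + - (s * s) ≃ fromℚ c → let r = fromℚ b + ρ in
      1ℝ + (fromℚ A + - 1ℝ) * r + fromℚ B * (r * r + - (s * s)) ≃ 0ℝ
    real-part≃0 ρ s ρ²-s²≃c = begin
      1ℝ + (fromℚ A + - 1ℝ) * r + fromℚ B * (r * r + - (s * s))
        ≈⟨ solve 6 (λ A B b c ρ s →
             con 1ℚ :+ (A :+ (:- con 1ℚ)) :* (b :+ ρ) :+ B :* ((b :+ ρ) :* (b :+ ρ) :+ (:- (s :* s))) :=
             (con 1ℚ :+ (:- (B :* (b :* b :+ (:- c))))) :+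
               ((A :+ (:- con 1ℚ)) :+ (B :* b :+ B :* b)) :* (b :+ ρ) :+
               B :* ((ρ :* ρ :+ (:- (s :* s))) :+ (:- c)))
           ≃-refl (fromℚ A) (fromℚ B) (fromℚ b) (fromℚ c) ρ s ⟩
      constant + linear * r + fromℚ B * ((ρ * ρ + - (s * s)) + - fromℚ c)
        ≈⟨ +-cong (+-cong constant≃0 (*-cong linear≃0 ≃-refl)) (*-cong ≃-refl (+-cong ρ²-s²≃c ≃-refl)) ⟩
      0ℝ + 0ℝ * r + fromℚ B * (fromℚ c + - fromℚ c)
        ≈⟨ solve 3 (λ B c r → con 0ℚ :+ con 0ℚ :* r :+ B :* (c :+ (:- c)) := con 0ℚ)
             ≃-refl (fromℚ B) (fromℚ c) r ⟩
      0ℝ ∎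
      where
      open ≃-Reasoning
      open ℝ-Solver
      r : ℝ
      r = fromℚ b + ρ

    imaginary-part≃0 : ∀ ρ s → ρ * s ≃ 0ℝ → let r = fromℚ b + ρ in
      (fromℚ A + - 1ℝ + (fromℚ B * r + fromℚ B * r)) * s ≃ 0ℝ
    imaginary-part≃0 ρ s ρs≃0 = begin
      (fromℚ A + - 1ℝ + (fromℚ B * (fromℚ b + ρ) + fromℚ B * (fromℚ b + ρ))) * s
        ≈⟨ solve 5 (λ A B b ρ s → (A :+ (:- con 1ℚ) :+ (B :* (b :+ ρ) :+ B :* (b :+ ρ))) :* s :=
             ((A :+ (:- con 1ℚ)) :+ (B :* b :+ B :* b)) :* s :+ (B :+ B) :* (ρ :* s))
           ≃-refl (fromℚ A) (fromℚ B) (fromℚ b) ρ s ⟩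
      linear * s + (fromℚ B + fromℚ B) * (ρ * s)
        ≈⟨ +-cong (*-cong linear≃0 ≃-refl) (*-cong ≃-refl ρs≃0) ⟩
      0ℝ * s + (fromℚ B + fromℚ B) * 0ℝ
        ≈⟨ solve 2 (λ B s → con 0ℚ :* s :+ (B :+ B) :* con 0ℚ := con 0ℚ) ≃-refl (fromℚ B) s ⟩
      0ℝ ∎
      where
      open ≃-Reasoning
      open ℝ-Solver

    -- γ(b + w) − (b + w) = B (w² − c) for w = ρ + i s.
    isRoot-shifted : ∀ ρ s → ρ * ρ + - (s * s) ≃ fromℚ c → ρ * s ≃ 0ℝ →
                     IsRootOf[ + 1 ∷ γ₁ ∷ γ₂ ∷ [] -t] ((fromℚ b + ρ) +i s)
    isRoot-shifted ρ s ρ²-s²≃c ρs≃0 =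
      isRoot (fromℚ b + ρ) s (real-part≃0 ρ s ρ²-s²≃c) (imaginary-part≃0 ρ s ρs≃0)

    module _ (roots : NegativeRoots γ₁ γ₂) where

      0≤c : 0ℚ ℚ.≤ c
      0≤c = ℚ.≮⇒≥ λ c<0 → let 0<-c = ℚ.neg-antimono-< c<0 in
        ¬Positive-0 (Positive-resp-≃ (-c≃0 0<-c) (fromℚ-positive 0<-c))
        where
        open ≃-Reasoning
        open ℝ-Solver
        -c≃0 : 0ℚ ℚ.< ℚ.- c → fromℚ (ℚ.- c) ≃ 0ℝ
        -c≃0 0<-c = begin
          fromℚ (ℚ.- c)   ≈⟨ s²≃-c ⟨
          s * s           ≈⟨ *-cong s≃0 s≃0 ⟩
          0ℝ * 0ℝ         ≈⟨ ℝ-ring.zeroˡ 0ℝ ⟩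
          0ℝ              ∎
          where
          s : ℝ
          s = √ (fromℚ (ℚ.- c))
          s²≃-c : s * s ≃ fromℚ (ℚ.- c)
          s²≃-c = √x*√x≃x (fromℚ-mono-≲ (ℚ.<⇒≤ 0<-c))
          0²-s²≃c : 0ℝ * 0ℝ + - (s * s) ≃ fromℚ c
          0²-s²≃c = begin
            0ℝ * 0ℝ + - (s * s)         ≈⟨ +-cong ≃-refl (-‿cong s²≃-c) ⟩
            0ℝ * 0ℝ + - fromℚ (ℚ.- c)   ≈⟨ +-cong ≃-refl (-‿cong (termwise-≃ λ _ → refl)) ⟩
            0ℝ * 0ℝ + - (- fromℚ c)     ≈⟨ solve 1 (λ c → con 0ℚ :* con 0ℚ :+ (:- (:- c)) := c)
                                             ≃-refl (fromℚ c) ⟩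
            fromℚ c                     ∎
          s≃0 : s ≃ 0ℝ
          s≃0 = ≈⇒≃ (proj₁ (roots ((fromℚ b + 0ℝ) +i s) (isRoot-shifted 0ℝ s 0²-s²≃c (ℝ-ring.zeroˡ s))))

      private
        σ : ℝ
        σ = √ (fromℚ c)

        0<-[b+σ] : Positive (- (fromℚ b + σ))
        0<-[b+σ] = <0⇒Positive-neg (proj₂ (roots ((fromℚ b + σ) +i 0ℝ) (isRoot-shifted σ 0ℝ
          (begin
            σ * σ + - (0ℝ * 0ℝ)     ≈⟨ +-cong (√x*√x≃x (fromℚ-mono-≲ 0≤c)) ≃-refl ⟩
            fromℚ c + - (0ℝ * 0ℝ)   ≈⟨ solve 1 (λ c → c :+ (:- (con 0ℚ :* con 0ℚ)) := c) ≃-refl (fromℚ c) ⟩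
            fromℚ c                 ∎)
          (ℝ-ring.zeroʳ σ))))
          where
          open ≃-Reasoning
          open ℝ-Solver

      0<-b : 0ℚ ℚ.< ℚ.- b
      0<-b = fromℚ-positive⁻¹ (Positive-resp-≃ -[b+σ]+σ≃-b
        (Positive-mono (x≲x+y (- (fromℚ b + σ)) (0≲√ (fromℚ c))) 0<-[b+σ]))
        where
        open ℝ-Solver
        -[b+σ]+σ≃-b : - (fromℚ b + σ) + σ ≃ fromℚ (ℚ.- b)
        -[b+σ]+σ≃-b = ≃-trans
          (solve 2 (λ b σ → (:- (b :+ σ)) :+ σ := :- b) ≃-refl (fromℚ b) σ)
          (termwise-≃ λ _ → refl)

      c<b² : c ℚ.< b ℚ.* b
      c<b² = 0<q-p⇒p<q (fromℚ-positive⁻¹ (Positive-resp-≃ [b+σ][b-σ]≃b²-c (Positive-* 0<-[b+σ]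
        (Positive-mono (x≲x+y (- (fromℚ b + σ)) (0≲x+y (0≲√ (fromℚ c)) (0≲√ (fromℚ c)))) 0<-[b+σ]))))
        where
        open ≃-Reasoning
        open ℝ-Solver
        [b+σ][b-σ]≃b²-c : - (fromℚ b + σ) * (- (fromℚ b + σ) + (σ + σ)) ≃ fromℚ (b ℚ.* b ℚ.- c)
        [b+σ][b-σ]≃b²-c = begin
          - (fromℚ b + σ) * (- (fromℚ b + σ) + (σ + σ))
            ≈⟨ solve 2 (λ b σ → (:- (b :+ σ)) :* ((:- (b :+ σ)) :+ (σ :+ σ)) := b :* b :+ (:- (σ :* σ)))
                     ≃-refl (fromℚ b) σ ⟩
          fromℚ b * fromℚ b + - (σ * σ)
            ≈⟨ +-cong ≃-refl (-‿cong (√x*√x≃x (fromℚ-mono-≲ 0≤c))) ⟩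
          fromℚ b * fromℚ b + - fromℚ c
            ≈⟨ termwise-≃ (λ _ → refl) ⟩
          fromℚ (b ℚ.* b ℚ.- c) ∎

      0<B : 0ℚ ℚ.< B
      0<B = ℚ.*-cancelʳ-<-nonNeg (b ℚ.* b ℚ.- c) {{ℚ.nonNegative (ℚ.<⇒≤ (p<q⇒0<q-p c<b²))}}
        (subst₂ ℚ._<_ (sym (ℚ.*-zeroˡ (b ℚ.* b ℚ.- c))) (sym B[b²-c]≡1) (ℚ.positive⁻¹ 1ℚ))

      1≤A : 1ℚ ℚ.≤ A
      1≤A = ℚ.<⇒≤ (<-resp-difference (0<p+q 0<-Bb 0<-Bb) (≡.trans A-1≡-2Bb
        (solve 2 (λ B b → :- (B :* b :+ B :* b) := (B :* (:- b) :+ B :* (:- b)) :- con 0ℚ) refl B b)))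
        where
        open ℚ-Solver
        0<-Bb : 0ℚ ℚ.< B ℚ.* (ℚ.- b)
        0<-Bb = 0<p*q 0<B 0<-b

      4B≤[A-1]² : ι (+ 4) ℚ.* B ℚ.≤ (A ℚ.- 1ℚ) ℚ.* (A ℚ.- 1ℚ)
      4B≤[A-1]² = ≤-resp-difference (0≤p*q (0≤p*p (B ℚ.+ B)) 0≤c) (begin
        (A ℚ.- 1ℚ) ℚ.* (A ℚ.- 1ℚ) ℚ.- ι (+ 4) ℚ.* B
          ≡⟨ cong₂ (λ p q → p ℚ.* p ℚ.- ι (+ 4) ℚ.* q) A-1≡-2Bb B≡B[B[b²-c]] ⟩
        ℚ.- (B ℚ.* b ℚ.+ B ℚ.* b) ℚ.* ℚ.- (B ℚ.* b ℚ.+ B ℚ.* b) ℚ.-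
          ι (+ 4) ℚ.* (B ℚ.* (B ℚ.* (b ℚ.* b ℚ.- c)))
          ≡⟨ solve 3 (λ B b c → (:- (B :* b :+ B :* b)) :* (:- (B :* b :+ B :* b)) :-
                                  con (ι (+ 4)) :* (B :* (B :* (b :* b :- c))) :=
                                ((B :+ B) :* (B :+ B)) :* c :- con 0ℚ) refl B b c ⟩
        ((B ℚ.+ B) ℚ.* (B ℚ.+ B)) ℚ.* c ℚ.- 0ℚ ∎)
        where
        open ≡.≡-Reasoning
        open ℚ-Solver
        B≡B[B[b²-c]] : B ≡ B ℚ.* (B ℚ.* (b ℚ.* b ℚ.- c))
        B≡B[B[b²-c]] = ≡.trans (sym (ℚ.*-identityʳ B)) (cong (B ℚ.*_) (sym B[b²-c]≡1))

  linear-bounds : NegativeRoots γ₁ γ₂ → B ≡ 0ℚ → GammaBounds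
  linear-bounds roots B≡0 = ℚ.≮⇒≥ A≮1 , ℚ.≤-reflexive (sym B≡0) , 4B≤[A-1]²
    where
    4B≤[A-1]² : ι (+ 4) ℚ.* B ℚ.≤ (A ℚ.- 1ℚ) ℚ.* (A ℚ.- 1ℚ)
    4B≤[A-1]² rewrite B≡0 = 0≤p*p (A ℚ.- 1ℚ)
    A≮1 : A ℚ.< 1ℚ → ⊥
    A≮1 A<1 =
      let _ , 0<e , r+e<0 = proj₂ (roots (fromℚ r +i 0ℝ) (isRoot (fromℚ r) 0ℝ real≃0
            (ℝ-ring.zeroʳ (fromℚ A + - 1ℝ + (fromℚ B * fromℚ r + fromℚ B * fromℚ r)))))
      in ℚ.<-irrefl refl (ℚ.<-trans (0<p+q 0<r 0<e) (proj₂ (eventually⇒∃ r+e<0)))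
      where
      open ≡.≡-Reasoning
      open ℚ-Solver
      instance
        1-A-positive : ℚ.Positive (1ℚ ℚ.- A)
        1-A-positive = ℚ.positive (p<q⇒0<q-p A<1)
        1-A-nonZero : ℚ.NonZero (1ℚ ℚ.- A)
        1-A-nonZero = ℚ.pos⇒nonZero (1ℚ ℚ.- A)
      r : ℚ
      r = ℚ.1/ (1ℚ ℚ.- A)
      0<r : 0ℚ ℚ.< r
      0<r = ℚ.positive⁻¹ r {{ℚ.1/pos⇒pos (1ℚ ℚ.- A)}}
      real≃0 : 1ℝ + (fromℚ A + - 1ℝ) * fromℚ r + fromℚ B * (fromℚ r * fromℚ r + - (0ℝ * 0ℝ)) ≃ 0ℝ
      real≃0 = termwise-≃ λ _ → begin
        1ℚ ℚ.+ (A ℚ.- 1ℚ) ℚ.* r ℚ.+ B ℚ.* (r ℚ.* r ℚ.- 0ℚ ℚ.* 0ℚ)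
          ≡⟨ cong (λ B → 1ℚ ℚ.+ (A ℚ.- 1ℚ) ℚ.* r ℚ.+ B ℚ.* (r ℚ.* r ℚ.- 0ℚ ℚ.* 0ℚ)) B≡0 ⟩
        1ℚ ℚ.+ (A ℚ.- 1ℚ) ℚ.* r ℚ.+ 0ℚ ℚ.* (r ℚ.* r ℚ.- 0ℚ ℚ.* 0ℚ)
          ≡⟨ solve 2 (λ A r → con 1ℚ :+ (A :- con 1ℚ) :* r :+ con 0ℚ :* (r :* r :- con 0ℚ :* con 0ℚ) :=
                              con 1ℚ :- (con 1ℚ :- A) :* r) refl A r ⟩
        1ℚ ℚ.- (1ℚ ℚ.- A) ℚ.* r
          ≡⟨ cong (λ p → 1ℚ ℚ.- p) (ℚ.*-inverseʳ (1ℚ ℚ.- A)) ⟩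
        0ℚ ∎

  quadratic-bounds : NegativeRoots γ₁ γ₂ → B ≢ 0ℚ → GammaBounds
  quadratic-bounds roots B≢0 = 1≤A roots , ℚ.<⇒≤ (0<B roots) , 4B≤[A-1]² roots
    where
    open ≡.≡-Reasoning
    open ℚ-Solver
    instance
      B-nonZero : ℚ.NonZero B
      B-nonZero = ℚ.≢-nonZero B≢0
    i b c : ℚ
    i = ℚ.1/ B
    b = ½ ℚ.* (1ℚ ℚ.- A) ℚ.* i
    c = b ℚ.* b ℚ.- i
    A-1≡-2Bb : A ℚ.- 1ℚ ≡ ℚ.- (B ℚ.* b ℚ.+ B ℚ.* b)
    A-1≡-2Bb = sym (begin
      ℚ.- (B ℚ.* b ℚ.+ B ℚ.* b)
        ≡⟨ solve 3 (λ A B i → :- (B :* (con ½ :* (con 1ℚ :- A) :* i) :+ B :* (con ½ :* (con 1ℚ :- A) :* i)) :=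
                              (A :- con 1ℚ) :* (B :* i)) refl A B i ⟩
      (A ℚ.- 1ℚ) ℚ.* (B ℚ.* i)
        ≡⟨ cong ((A ℚ.- 1ℚ) ℚ.*_) (ℚ.*-inverseʳ B) ⟩
      (A ℚ.- 1ℚ) ℚ.* 1ℚ
        ≡⟨ ℚ.*-identityʳ (A ℚ.- 1ℚ) ⟩
      A ℚ.- 1ℚ ∎)
    B[b²-c]≡1 : B ℚ.* (b ℚ.* b ℚ.- c) ≡ 1ℚ
    B[b²-c]≡1 = ≡.trans
      (solve 3 (λ B b i → B :* (b :* b :- (b :* b :- i)) := B :* i) refl B b i) (ℚ.*-inverseʳ B)
    open CompletedSquare A-1≡-2Bb B[b²-c]≡1

  gamma-bounds : NegativeRoots γ₁ γ₂ → GammaBounds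
  gamma-bounds roots with B ℚ.≟ 0ℚ
  ... | yes B≡0 = linear-bounds roots B≡0
  ... | no  B≢0 = quadratic-bounds roots B≢0

gammaBounds⇒naturals : ∀ γ₁ γ₂ → GammaBounds γ₁ γ₂ →
                       ∃₂ λ a g → γ₁ ≡ + suc a × γ₂ ≡ + g × 4 ℕ.* g ℕ.≤ a ℕ.* a
gammaBounds⇒naturals γ₁ γ₂ (1≤A , 0≤B , 4B≤[A-1]²)
  with ι-cancel-≤ {+ 1} {γ₁} 1≤A | ι-cancel-≤ {+ 0} {γ₂} 0≤B
... | ℤ.+≤+ {n = suc a} (ℕ.s≤s _) | ℤ.+≤+ {n = g} _ = a , g , refl , refl , nat-cancel-≤ (begin
  nat (4 ℕ.* g)                                       ≡⟨ nat-homo-* 4 g ⟩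
  nat 4 ℚ.* nat g                                     ≤⟨ 4B≤[A-1]² ⟩
  (nat (suc a) ℚ.- 1ℚ) ℚ.* (nat (suc a) ℚ.- 1ℚ)       ≡⟨ cong (λ p → p ℚ.* p) nat[1+a]-1≡nat-a ⟩
  nat a ℚ.* nat a                                     ≡⟨ nat-homo-* a a ⟨
  nat (a ℕ.* a)                                       ∎)
  where
  open ℚ.≤-Reasoning
  open ℚ-Solver
  nat[1+a]-1≡nat-a : nat (suc a) ℚ.- 1ℚ ≡ nat a
  nat[1+a]-1≡nat-a = ≡.trans (cong (ℚ._- 1ℚ) (nat-homo-+ 1 a))
    (solve 1 (λ p → con 1ℚ :+ p :- con 1ℚ := p) refl (nat a))

theorem3p2p1 : (γ₁ γ₂ : ℤ) → let γ = + 1 ∷ γ₁ ∷ γ₂ ∷ [] in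
    (∀ z → IsRootOf[ γ -t] z → im z ≈ 0ℝ × re z < 0ℝ) →
    Σ[ h ∈ Polynomial ] Is[1+t]⁴p[t/[1+t]²] h γ ×
      (Σ[ n ∈ ℕ ] Σ[ X ∈ SimplicialComplex n ] Flag X × TriangulatesS³ X × IsHPolynomial X h)
theorem3p2p1 γ₁ γ₂ roots with gammaBounds⇒naturals γ₁ γ₂ (gamma-bounds γ₁ γ₂ roots)
... | a , g , refl , refl , 4g≤a² =
  let _ , _ , X , shape = sphereWithGamma a g 4g≤a²
      G = graph X
  in hPolynomial (+ suc a) (+ g) , hPolynomial-γ (+ suc a) (+ g) ,
     _ , cliqueComplex G , cliqueComplex-flag G , triangulates X ,
     hPolynomial-isHPolynomial (cliqueComplex G) (suc a) g λ t →
       ≡.trans (fPolynomial≡cliquePoly G t) (link-∅ shape t)
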